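{- Let $n\ge 3$, let $M,N\in\mathbb{Z}^{n-1}$ and let $D=(D_1,\dots,D_{n-1})$ be a tuple of positive integers. If $\gcd(D_1\cdots D_{n-2},D_{n-1})=1$, then the long Weyl element Kloosterman sums satisfy $$S_n(M,N;D)=S_{n-1}\big(M',(N_1,\dots,N_{n-2});(D_1,\dots,D_{n-2})\big)\cdot S_2(D_{n-2}M_{n-1},N_{n-1};D_{n-1}),$$ where $M'=(M_1,\dots,M_{n-3},D_{n-1}M_{n-2})$.
   Context: Definition of $S_n(M,N;D)$ for any $n\ge2$, $M,N\in\mathbb{Z}^{n-1}$ and $D$ an $(n-1)$-tuple of positive integers: $e(z)=e^{2\pi i z}$. $U$ is the group of upper triangular unipotent $n\times n$ matrices. For $N\in\mathbb{Z}^{n-1}$, $\psi_N$ is the character of $U(\mathbb{R})$, trivial on $U(\mathbb{Z})$, given by $\psi_N(u)=e(N_1u_{1,2}+N_2u_{2,3}+\cdots+N_{n-1}u_{n-1,n})$. For $M\in \mathbb{Z}^{n-1}$, $\tilde M=(M_{n-1},\dots,M_1)$. Let $w_0$ be the long Weyl element: the $n\times n$ matrix whose only nonzero entries are on the anti-diagonal, the entry at position $(n-k+1,k)$ being $(-1)^{k-1}$ ($1\le k\le n$). Let $c=\mathrm{Diag}(1/D_{n-1},\,D_{n-1}/D_{n-2},\dots,D_2/D_1,\,D_1)$, $C(c)=U(\mathbb{R})\,c\,w_0\,U(\mathbb{R})\cap SL(n,\mathbb{Z})$ and $X(c)=U(\mathbb{Z})\backslash C(c)/U(\mathbb{Z})$.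 Each $\gamma\in C(c)$ is uniquely $\gamma=b_1cw_0b_2$ with $b_1,b_2\in U(\mathbb{R})$; set $\mu(\gamma)=b_1\in U(\mathbb{Z})\backslash U(\mathbb{R})$ and $\mu'(\gamma)=b_2\in U(\mathbb{R})/U(\mathbb{Z})$. Then $$S_n(M,N;D)=\sum_{x\in X(c)}\psi_{\tilde M}(\mu(x))\,\psi_N(\mu'(x)).$$ For $n=2$ the arguments are integers (1-tuples). -}

module Defs where

open import Algebra.Bundles using (CommutativeRing)
open import Data.Bool.Base using (if_then_else_)
open import Data.Empty using (⊥-elim)
open import Data.Fin.Base using (Fin; zero; suc; toℕ; _<_; punchIn; inject₁; fromℕ; fromℕ<; opposite; finToFun; funToFin)
import Data.Fin.Properties as FP
open import Data.Fin.Properties using (_≟_; punchInᵢ≢i; <-cmp; all?; _<?_; opposite-involutive; opposite-prop; finToFun-funToFin)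
open import Data.Integer.Base as ℤ using (ℤ; +_; -[1+_]; 1ℤ)
import Data.Integer.DivMod as ℤ
import Data.Integer.Properties as ℤ
open import Data.List.Base as List using (List; concatMap; allFin; deduplicate)
open import Data.List.Membership.Propositional using (lose)
open import Data.List.Membership.Propositional.Properties using (∈-allFin)
open import Data.List.Relation.Unary.Any using (Any; here)
import Data.List.Relation.Unary.Any.Properties as Any
open import Data.List.Relation.Unary.Enumerates.Setoid using (IsEnumeration)
import Data.List.Relation.Unary.Enumerates.Setoid.Properties as Enumerates
open import Data.List.Relation.Unary.Unique.Setoid using (Unique)
import Data.List.Relation.Unary.Unique.DecSetoid.Properties as Unique
open import Data.Nat.Base as ℕ using (ℕ; NonZero; s≤s; z≤n; s<s; zero; suc)
import Data.Nat.Coprimality as Coprimality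
import Data.Nat.Properties as ℕ
open import Data.Product.Base using (_×_; _,_; proj₁; proj₂; ∃; ∃₂)
open import Data.Rational.Base as ℚ using (ℚ; 0ℚ; 1ℚ; _/_; toℚᵘ; ↥_; ↧_; ↧ₙ_)
import Data.Rational.Properties as ℚ
open import Data.Rational.Unnormalised.Base as ℚᵘ using (mkℚᵘ; *≡*)
import Data.Rational.Unnormalised.Properties as ℚᵘ
open import Data.Vec.Functional using (Vector; _∷_; removeAt; insertAt; reverse)
open import Data.Vec.Functional.Properties using (insertAt-lookup)
open import Function.Base using (_∘_)
open import Level using (0ℓ; _⊔_)
open import Relation.Binary.Bundles using (Setoid; DecSetoid)
open import Relation.Binary.Definitions using (tri<; tri≈; tri>)
open import Relation.Binary.PropositionalEquality as ≡ using (_≡_; _≢_)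
import Relation.Binary.Construct.On as On
import Relation.Binary.Reasoning.Setoid as SetoidReasoning
open import Relation.Nullary using (Dec; does; yes; no; map′; _×-dec_; _→-dec_)

------------------------------------------------------------------------

module Matrices {a ℓ} (R : CommutativeRing a ℓ) where
  open CommutativeRing R hiding (zero)
  open import Algebra.Properties.Semiring.Sum semiring using (sum-syntax)
  open import Algebra.Properties.Semiring.Exp semiring using (_^_)

  Matrix : ℕ → Set a
  Matrix n = Vector (Vector Carrier n) n

  infix  4 _≋_ _∼_
  infixl 7 _·_

  _≋_ : ∀ {n} → Matrix n → Matrix n → Set ℓ
  A ≋ B = ∀ i j → A i j ≈ B i j

  diag : ∀ {n} → Vector Carrier n → Matrix n
  diag d i j = if does (i ≟ j) then d i else 0#

  1ₘ : ∀ {n} → Matrix n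
  1ₘ = diag (λ _ → 1#)

  _·_ : ∀ {n} → Matrix n → Matrix n → Matrix n
  _·_ {n} A B i j = ∑[ k < n ] (A i k * B k j)

  sgn : ∀ {n} → Fin n → Carrier
  sgn j = (- 1#) ^ toℕ j

  minor : ∀ {n} → Vector (Vector Carrier (suc n)) n → Fin (suc n) → Matrix n
  minor A j i k = A i (punchIn j k)

  -- Laplace expansion along the first row.
  det : ∀ {n} → Matrix n → Carrier
  det {zero}  A = 1#
  det {suc n} A = ∑[ j < suc n ] (sgn j * (A zero j * det (minor (A ∘ suc) j)))

  -- Upper triangular with ones on the diagonal, i.e. A ∈ U(R).
  Unipotent : ∀ {n} → Matrix n → Set ℓ
  Unipotent A = (∀ i → A i i ≈ 1#) × (∀ i j → j < i → A i j ≈ 0#)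

  -- A and B lie in the same double coset of U(R) \ – / U(R).
  _∼_ : ∀ {n} → Matrix n → Matrix n → Set (a ⊔ ℓ)
  A ∼ B = ∃₂ λ u v → Unipotent u × Unipotent v × u · A · v ≋ B

module ℤM = Matrices ℤ.+-*-commutativeRing
module ℚM = Matrices ℚ.+-*-commutativeRing

------------------------------------------------------------------------
-- The set C(c).  Throughout r = n - 1, so that D is an r-tuple and the
-- matrices are of size 1 + r.

ι : ℤ → ℚ
ι z = z / 1

record ℕ⁺ : Set where
  field
    value       : ℕ
    ⦃ nonZero ⦄ : NonZero value

open ℕ⁺ public using (value)

1⁺ : ℕ⁺
1⁺ = record { value = 1 }

_÷_ : ℕ⁺ → ℕ⁺ → ℚ
m ÷ n = (+ value m / value n) ⦃ ℕ⁺.nonZero n ⦄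

-- (1 , D₁ , … , Dₙ₋₁ , 1), i.e. D with D₀ = Dₙ = 1 adjoined.
extend : ∀ {r} → Vector ℕ⁺ r → Vector ℕ⁺ (2 ℕ.+ r)
extend {r} D = 1⁺ ∷ insertAt D (fromℕ r) 1⁺

-- Diag (1/Dₙ₋₁ , Dₙ₋₁/Dₙ₋₂ , … , D₂/D₁ , D₁).  Counting rows from 1, the
-- j-th entry is Dₙ₋ⱼ₊₁/Dₙ₋ⱼ; for the row i = j - 1 : Fin n, the number
-- opposite i is n - j.
c : ∀ {r} → Vector ℕ⁺ r → ℚM.Matrix (1 ℕ.+ r)
c D = ℚM.diag λ i → extend D (suc (opposite i)) ÷ extend D (inject₁ (opposite i))

-- The entry in column k = j + 1, counted from 1, is in row n - k + 1, which
-- is row n - k = opposite j counted from 0.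
w₀ : ∀ {n} → ℚM.Matrix n
w₀ i j = if does (i ≟ opposite j) then ℚM.sgn j else 0ℚ

-- U(ℝ) c w₀ U(ℝ) ∩ SL(n,ℤ).  Since b₁ and b₂ are determined by γ through
-- ratios of minors of γ, they are rational, and ℚ may be used in place of ℝ.
record C {r} (D : Vector ℕ⁺ r) : Set where
  open ℚM
  field
    γ      : ℤM.Matrix (1 ℕ.+ r)
    det-γ  : ℤM.det γ ≡ 1ℤ
    b₁ b₂  : Matrix (1 ℕ.+ r)
    unip₁  : Unipotent b₁
    unip₂  : Unipotent b₂
    bruhat : (λ i j → ι (γ i j)) ≋ b₁ · c D · w₀ · b₂

------------------------------------------------------------------------

module MatrixProperties {a ℓ} (R : CommutativeRing a ℓ) where
  open CommutativeRing R hiding (zero)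
  open Matrices R public
  open import Algebra.Properties.Semiring.Sum semiring
  open import Algebra.Properties.Semiring.Exp semiring using (_^_)
  open import Algebra.Properties.Ring ring using (-‿involutive; -1*x≈-x)
  open import Relation.Binary.Reasoning.Setoid setoid

  ----------------------------------------------------------------------

  sum-zero : ∀ {n} {f : Vector Carrier n} → (∀ i → f i ≈ 0#) → sum f ≈ 0#
  sum-zero {n} h = trans (sum-cong-≋ h) (sum-replicate-zero n)

  sum-single : ∀ {n} (i : Fin n) {f : Vector Carrier n} →
               (∀ k → k ≢ i → f k ≈ 0#) → sum f ≈ f i
  sum-single {suc n} i {f} h = begin
    sum f                     ≈⟨ sum-remove f ⟩
    f i + sum (removeAt f i)  ≈⟨ +-congˡ (sum-zero (λ k → h (punchIn i k) (punchInᵢ≢i i k))) ⟩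
    f i + 0#                  ≈⟨ +-identityʳ _ ⟩
    f i                       ∎

  diag-≡ : ∀ {n} (d : Vector Carrier n) i → diag d i i ≡ d i
  diag-≡ d i with i ≟ i
  ... | yes _  = ≡.refl
  ... | no i≢i = ⊥-elim (i≢i ≡.refl)

  diag-≢ : ∀ {n} (d : Vector Carrier n) {i j} → i ≢ j → diag d i j ≡ 0#
  diag-≢ d {i} {j} i≢j with i ≟ j
  ... | yes i≡j = ⊥-elim (i≢j i≡j)
  ... | no _    = ≡.refl

  diag-· : ∀ {n} (d : Vector Carrier n) (A : Matrix n) i j → (diag d · A) i j ≈ d i * A i j
  diag-· d A i j = trans
    (sum-single i (λ k k≢i → trans (*-congʳ (reflexive (diag-≢ d (k≢i ∘ ≡.sym)))) (zeroˡ _)))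
    (*-congʳ (reflexive (diag-≡ d i)))

  ----------------------------------------------------------------------

  ≋-refl : ∀ {n} {A : Matrix n} → A ≋ A
  ≋-refl i j = refl

  ≋-sym : ∀ {n} {A B : Matrix n} → A ≋ B → B ≋ A
  ≋-sym e i j = sym (e i j)

  ≋-trans : ∀ {n} {A B C : Matrix n} → A ≋ B → B ≋ C → A ≋ C
  ≋-trans e f i j = trans (e i j) (f i j)

  ≋-setoid : ℕ → Setoid a ℓ
  ≋-setoid n = record
    { Carrier = Matrix n ; _≈_ = _≋_
    ; isEquivalence = record { refl = ≋-refl ; sym = ≋-sym ; trans = ≋-trans } }

  ·-cong : ∀ {n} {A A′ B B′ : Matrix n} → A ≋ A′ → B ≋ B′ → A · B ≋ A′ · B′
  ·-cong e f i j = sum-cong-≋ (λ k → *-cong (e i k) (f k j))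

  ·-congˡ : ∀ {n} {A B B′ : Matrix n} → B ≋ B′ → A · B ≋ A · B′
  ·-congˡ = ·-cong ≋-refl

  ·-congʳ : ∀ {n} {A A′ B : Matrix n} → A ≋ A′ → A · B ≋ A′ · B
  ·-congʳ e = ·-cong e ≋-refl

  ·-assoc : ∀ {n} (A B C : Matrix n) → (A · B) · C ≋ A · (B · C)
  ·-assoc {n} A B C i j = begin
    ∑[ k < n ] (∑[ l < n ] (A i l * B l k) * C k j)    ≈⟨ sum-cong-≋ (λ k → *-distribʳ-sum {n} (C k j) _) ⟩
    ∑[ k < n ] ∑[ l < n ] (A i l * B l k * C k j)      ≈⟨ ∑-comm (λ k l → A i l * B l k * C k j) ⟩
    ∑[ l < n ] ∑[ k < n ] (A i l * B l k * C k j)      ≈⟨ sum-cong-≋ {n} (λ l → sum-cong-≋ {n} (λ k → *-assoc _ _ _)) ⟩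
    ∑[ l < n ] ∑[ k < n ] (A i l * (B l k * C k j))    ≈⟨ sum-cong-≋ (λ l → *-distribˡ-sum {n} (A i l) _) ⟨
    ∑[ l < n ] (A i l * ∑[ k < n ] (B l k * C k j))    ∎

  ·-identityˡ : ∀ {n} (A : Matrix n) → 1ₘ · A ≋ A
  ·-identityˡ A i j = trans (diag-· _ A i j) (*-identityˡ _)

  ·-identityʳ : ∀ {n} (A : Matrix n) → A · 1ₘ ≋ A
  ·-identityʳ A i j = trans
    (sum-single j (λ k k≢j → trans (*-congˡ (reflexive (diag-≢ _ k≢j))) (zeroʳ _)))
    (trans (*-congˡ (reflexive (diag-≡ _ j))) (*-identityʳ _))

  ----------------------------------------------------------------------

  U-resp : ∀ {n} {A B : Matrix n} → A ≋ B → Unipotent A → Unipotent B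
  U-resp e (d , z) = (λ i → trans (sym (e i i)) (d i)) , (λ i j j<i → trans (sym (e i j)) (z i j j<i))

  U-1 : ∀ {n} → Unipotent (1ₘ {n})
  U-1 = (λ i → reflexive (diag-≡ _ i)) , λ i j j<i → reflexive (diag-≢ (λ _ → 1#) {i} {j} (λ { ≡.refl → ℕ.<-irrefl ≡.refl j<i }))

  U-· : ∀ {n} {A B : Matrix n} → Unipotent A → Unipotent B → Unipotent (A · B)
  U-· {n} {A} {B} (dA , zA) (dB , zB) = diagonal , lower
    where
    off : ∀ i k → k ≢ i → A i k * B k i ≈ 0#
    off i k k≢i with <-cmp k i
    ... | tri< k<i _ _ = trans (*-congʳ (zA i k k<i)) (zeroˡ _)
    ... | tri≈ _ k≡i _ = ⊥-elim (k≢i k≡i)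
    ... | tri> _ _ i<k = trans (*-congˡ (zB k i i<k)) (zeroʳ _)
    diagonal : ∀ i → (A · B) i i ≈ 1#
    diagonal i = trans (sum-single i (off i))
                       (trans (*-cong (dA i) (dB i)) (*-identityˡ _))
    lower : ∀ i j → j < i → (A · B) i j ≈ 0#
    lower i j j<i = sum-zero term
      where
      term : ∀ k → A i k * B k j ≈ 0#
      term k with <-cmp k i
      ... | tri< k<i _ _    = trans (*-congʳ (zA i k k<i)) (zeroˡ _)
      ... | tri≈ _ ≡.refl _ = trans (*-congˡ (zB i j j<i)) (zeroʳ _)
      ... | tri> _ _ i<k    = trans (*-congˡ (zB k j (ℕ.<-trans j<i i<k))) (zeroʳ _)

  lower-right : ∀ {n} → Matrix (suc n) → Matrix n
  lower-right A i j = A (suc i) (suc j)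

  U-tail : ∀ {n} {A : Matrix (suc n)} → Unipotent A → Unipotent (lower-right A)
  U-tail (d , z) = (d ∘ suc) , λ i j j<i → z (suc i) (suc j) (s<s j<i)

  -- The block matrix with rows (1 , x) and (0 , A).
  block : ∀ {n} → Vector Carrier n → Matrix n → Matrix (suc n)
  block x A zero    zero    = 1#
  block x A zero    (suc j) = x j
  block x A (suc i) zero    = 0#
  block x A (suc i) (suc j) = A i j

  U-block : ∀ {n} (x : Vector Carrier n) {A} → Unipotent A → Unipotent (block x A)
  U-block x {A} (d , z) = diagonal , lower
    where
    diagonal : ∀ i → block x A i i ≈ 1#
    diagonal zero    = refl
    diagonal (suc i) = d i
    lower : ∀ i j → j < i → block x A i j ≈ 0#
    lower (suc i) zero    _         = refl
    lower (suc i) (suc j) (s<s j<i) = z i j j<i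

  inv : ∀ {n} → Matrix n → Matrix n
  inv {zero}  A = A
  inv {suc n} A = block (λ j → - (∑[ k < n ] (A zero (suc k) * inv (lower-right A) k j)))
                        (inv (lower-right A))

  U-inv : ∀ {n} {A : Matrix n} → Unipotent A → Unipotent (inv A)
  U-inv {zero}  u = u
  U-inv {suc n} u = U-block _ (U-inv (U-tail u))

  inverseʳ : ∀ {n} {A : Matrix n} → Unipotent A → A · inv A ≋ 1ₘ
  inverseʳ {suc n} {A} u@(d , z) = go
    where
    A′ = lower-right A
    IH = inverseʳ (U-tail u)
    go : A · inv A ≋ 1ₘ
    go zero zero = trans (+-cong (*-identityʳ _) (sum-zero {n} (λ k → zeroʳ _))) (trans (+-identityʳ _) (d zero))
    go zero (suc j) = trans (+-congʳ (trans (*-congʳ (d zero)) (*-identityˡ _))) (-‿inverseˡ _)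
    go (suc i) zero = trans (+-cong (*-identityʳ _) (sum-zero {n} (λ k → zeroʳ _)))
                            (trans (+-identityʳ _) (z (suc i) zero (s≤s z≤n)))
    go (suc i) (suc j) = trans (+-congʳ (trans (*-congʳ (z (suc i) zero (s≤s z≤n))) (zeroˡ _)))
                               (trans (+-identityˡ _) (trans (IH i j) (reflexive (δ i j))))
      where
      δ : ∀ i j → 1ₘ i j ≡ 1ₘ (suc i) (suc j)
      δ i j with i ≟ j
      ... | yes ≡.refl = ≡.refl
      ... | no _       = ≡.refl

  inverseˡ : ∀ {n} {A : Matrix n} → Unipotent A → inv A · A ≋ 1ₘ
  inverseˡ {n} {A} u = ≋-trans (·-congˡ A≋A″) (inverseʳ u′)
    where
    u′ = U-inv u
    A≋A″ : A ≋ inv (inv A)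
    A≋A″ = ≋-trans (≋-sym (·-identityʳ A))
           (≋-trans (·-congˡ (≋-sym (inverseʳ u′)))
           (≋-trans (≋-sym (·-assoc A _ _))
           (≋-trans (·-congʳ (inverseʳ u)) (·-identityˡ _))))

  cancelˡ : ∀ {n} {A : Matrix n} → Unipotent A → ∀ B → inv A · (A · B) ≋ B
  cancelˡ u B = ≋-trans (≋-sym (·-assoc _ _ B)) (≋-trans (·-congʳ (inverseˡ u)) (·-identityˡ B))

  cancelʳ : ∀ {n} {A : Matrix n} → Unipotent A → ∀ B → B · A · inv A ≋ B
  cancelʳ u B = ≋-trans (·-assoc B _ _) (≋-trans (·-congˡ (inverseʳ u)) (·-identityʳ B))

  ----------------------------------------------------------------------

  open import Algebra.Solver.CommutativeMonoid *-commutativeMonoid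
    using (solve; _⊕_; _⊜_)

  neg-sgn : ∀ x → x + (- 1#) * x ≈ 0#
  neg-sgn x = trans (+-congˡ (-1*x≈-x x)) (-‿inverseʳ x)

  -1² : (- 1#) * (- 1#) ≈ 1#
  -1² = trans (-1*x≈-x _) (-‿involutive 1#)

  sgn² : ∀ m → (- 1#) ^ m * (- 1#) ^ m ≈ 1#
  sgn² zero    = *-identityˡ 1#
  sgn² (suc m) = begin
    (- 1# * x) * (- 1# * x)  ≈⟨ solve 2 (λ a b → (a ⊕ b) ⊕ (a ⊕ b) ⊜ (a ⊕ a) ⊕ (b ⊕ b)) refl (- 1#) x ⟩
    (- 1# * - 1#) * (x * x)  ≈⟨ *-cong -1² (sgn² m) ⟩
    1# * 1#                  ≈⟨ *-identityˡ 1# ⟩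
    1#                       ∎
    where x = (- 1#) ^ m

  opaque
    -- sum, blocked from unfolding so that summands can be inferred.
    Sum : ∀ n → Vector Carrier n → Carrier
    Sum n f = sum f

    syntax Sum n (λ i → x) = ∑′[ i < n ] x

    Sum-sum : ∀ {n} {f : Vector Carrier n} → Sum n f ≡ sum f
    Sum-sum = ≡.refl

    Sum-suc : ∀ {n} (f : Vector Carrier (suc n)) → Sum (suc n) f ≡ f zero + Sum n (f ∘ suc)
    Sum-suc f = ≡.refl

    Sum-cong : ∀ {n} {f g : Vector Carrier n} → (∀ i → f i ≈ g i) → Sum n f ≈ Sum n g
    Sum-cong {n} = sum-cong-≋ {n}

    Sum-+ : ∀ {n} (f g : Vector Carrier n) → ∑′[ i < n ] (f i + g i) ≈ Sum n f + Sum n g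
    Sum-+ = ∑-distrib-+

    *-distribˡ-Sum : ∀ {n} x (f : Vector Carrier n) → x * Sum n f ≈ ∑′[ i < n ] (x * f i)
    *-distribˡ-Sum = *-distribˡ-sum

    *-distribʳ-Sum : ∀ {n} x (f : Vector Carrier n) → Sum n f * x ≈ ∑′[ i < n ] (f i * x)
    *-distribʳ-Sum = *-distribʳ-sum

    Sum-comm : ∀ {m n} (f : Fin m → Fin n → Carrier) →
               ∑′[ i < m ] ∑′[ j < n ] f i j ≈ ∑′[ j < n ] ∑′[ i < m ] f i j
    Sum-comm = ∑-comm

    Sum-zero : ∀ {n} {f : Vector Carrier n} → (∀ i → f i ≈ 0#) → Sum n f ≈ 0#
    Sum-zero = sum-zero

    Sum-single : ∀ {n} (i : Fin n) {f : Vector Carrier n} → (∀ k → k ≢ i → f k ≈ 0#) → Sum n f ≈ f i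
    Sum-single = sum-single

    det-suc : ∀ {n} (A : Matrix (suc n)) →
              det A ≡ ∑′[ j < suc n ] (sgn j * (A zero j * det (minor (A ∘ suc) j)))
    det-suc A = ≡.refl

    ·-suc : ∀ {n} (A B : Matrix (suc n)) i j →
            (A · B) i j ≡ A i zero * B zero j + ∑′[ k < n ] (A i (suc k) * B (suc k) j)
    ·-suc A B i j = ≡.refl

    ·-Sum : ∀ {n} (A B : Matrix n) i j → (A · B) i j ≡ ∑′[ k < n ] (A i k * B k j)
    ·-Sum A B i j = ≡.refl

  det-cong : ∀ {n} {A B : Matrix n} → A ≋ B → det A ≈ det B
  det-cong {zero}  e = refl
  det-cong {suc n} {A} {B} e = begin
    det A                                                            ≡⟨ det-suc A ⟩
    ∑′[ j < suc n ] (sgn j * (A zero j * det (minor (A ∘ suc) j)))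
      ≈⟨ Sum-cong (λ j → *-congˡ (*-cong (e zero j) (det-cong (λ i k → e (suc i) (punchIn j k))))) ⟩
    ∑′[ j < suc n ] (sgn j * (B zero j * det (minor (B ∘ suc) j)))  ≡⟨ det-suc B ⟨
    det B                                                            ∎

  -- (j , k) and (j′ , k′) list the same two columns in opposite orders.
  data Swap : ∀ {n} → Fin (suc (suc n)) → Fin (suc n) → Fin (suc (suc n)) → Fin (suc n) → Set where
    here  : ∀ {n} (k : Fin (suc n)) → Swap zero k (suc k) zero
    there : ∀ {n j j′} {k k′ : Fin (suc n)} → Swap j k j′ k′ → Swap (suc j) (suc k) (suc j′) (suc k′)

  swap-fst : ∀ {n j j′} {k k′ : Fin (suc n)} → Swap j k j′ k′ → punchIn j k ≡ j′
  swap-fst (here k)  = ≡.refl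
  swap-fst (there s) = ≡.cong suc (swap-fst s)

  swap-snd : ∀ {n j j′} {k k′ : Fin (suc n)} → Swap j k j′ k′ → punchIn j′ k′ ≡ j
  swap-snd (here k)  = ≡.refl
  swap-snd (there s) = ≡.cong suc (swap-snd s)

  swap-rest : ∀ {n j j′} {k k′ : Fin (suc n)} → Swap j k j′ k′ →
              ∀ l → punchIn j (punchIn k l) ≡ punchIn j′ (punchIn k′ l)
  swap-rest (here k)  l       = ≡.refl
  swap-rest (there s) zero    = ≡.refl
  swap-rest (there s) (suc l) = ≡.cong suc (swap-rest s l)

  swap-sgn : ∀ {n j j′} {k k′ : Fin (suc n)} → Swap j k j′ k′ → sgn j * sgn k + sgn j′ * sgn k′ ≈ 0#
  swap-sgn (here k) = begin
    1# * sgn k + (- 1# * sgn k) * 1#  ≈⟨ +-cong (*-identityˡ _) (*-identityʳ _) ⟩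
    sgn k + - 1# * sgn k              ≈⟨ neg-sgn (sgn k) ⟩
    0#                                ∎
  swap-sgn (there {j = j} {j′} {k} {k′} s) = trans (+-cong (square _ _) (square _ _)) (swap-sgn s)
    where
    square : ∀ x y → (- 1# * x) * (- 1# * y) ≈ x * y
    square x y = trans (solve 3 (λ a b c → (a ⊕ b) ⊕ (a ⊕ c) ⊜ (a ⊕ a) ⊕ (b ⊕ c)) refl (- 1#) x y)
                       (trans (*-congʳ -1²) (*-identityˡ _))

  antisym-sum : ∀ {n} (G : Fin (suc (suc n)) → Fin (suc n) → Carrier) →
                (∀ {j k j′ k′} → Swap j k j′ k′ → G j k + G j′ k′ ≈ 0#) →
                ∑′[ j < suc (suc n) ] ∑′[ k < suc n ] G j k ≈ 0#
  antisym-sum {n} G h = begin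
    ∑′[ j < suc (suc n) ] ∑′[ k < suc n ] G j k
      ≡⟨ Sum-suc {suc n} _ ⟩
    Sum (suc n) (G zero) + ∑′[ j < suc n ] ∑′[ k < suc n ] G (suc j) k
      ≈⟨ +-congˡ (Sum-cong (λ j → reflexive (Sum-suc (G (suc j))))) ⟩
    Sum (suc n) (G zero) + ∑′[ j < suc n ] (G (suc j) zero + ∑′[ k < n ] G (suc j) (suc k))
      ≈⟨ +-congˡ (Sum-+ _ _) ⟩
    Sum (suc n) (G zero) + (∑′[ j < suc n ] G (suc j) zero + ∑′[ j < suc n ] ∑′[ k < n ] G (suc j) (suc k))
      ≈⟨ +-congˡ (trans (+-congˡ (rest n G h)) (+-identityʳ _)) ⟩
    Sum (suc n) (G zero) + ∑′[ j < suc n ] G (suc j) zero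
      ≈⟨ Sum-+ _ _ ⟨
    ∑′[ k < suc n ] (G zero k + G (suc k) zero)
      ≈⟨ Sum-zero (λ k → h (here k)) ⟩
    0# ∎
    where
    rest : ∀ n (G : Fin (suc (suc n)) → Fin (suc n) → Carrier) →
           (∀ {j k j′ k′} → Swap j k j′ k′ → G j k + G j′ k′ ≈ 0#) →
           ∑′[ j < suc n ] ∑′[ k < n ] G (suc j) (suc k) ≈ 0#
    rest zero    G h = Sum-zero (λ _ → Sum-zero λ ())
    rest (suc n) G h = antisym-sum (λ j k → G (suc j) (suc k)) (λ s → h (there s))

  private
    E : ∀ {n} → Matrix (suc (suc n)) → Fin (suc (suc n)) → Fin (suc n) → Carrier
    E M j k = det (λ i l → M (suc (suc i)) (punchIn j (punchIn k l)))

    T : ∀ {n} → Matrix (suc (suc n)) → Fin (suc (suc n)) → Fin (suc n) → Carrier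
    T M j k = sgn j * (M zero j * (sgn k * (M (suc zero) (punchIn j k) * E M j k)))

    expand : ∀ {n} (M : Matrix (suc (suc n))) →
             det M ≈ ∑′[ j < suc (suc n) ] ∑′[ k < suc n ] T M j k
    expand {n} M = begin
      det M
        ≡⟨ det-suc M ⟩
      ∑′[ j < suc (suc n) ] (sgn j * (M zero j * det (minor (M ∘ suc) j)))
        ≈⟨ Sum-cong (λ j → *-congˡ (*-congˡ (reflexive (det-suc (minor (M ∘ suc) j))))) ⟩
      ∑′[ j < suc (suc n) ] (sgn j * (M zero j * ∑′[ k < suc n ] (sgn k * (M (suc zero) (punchIn j k) * E M j k))))
        ≈⟨ Sum-cong (λ j → trans (*-congˡ (*-distribˡ-Sum _ _)) (*-distribˡ-Sum _ _)) ⟩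
      ∑′[ j < suc (suc n) ] ∑′[ k < suc n ] T M j k ∎

    pair : ∀ {n} (M M′ : Matrix (suc (suc n))) →
           (∀ j → M zero j ≈ M′ (suc zero) j) → (∀ j → M (suc zero) j ≈ M′ zero j) →
           (∀ i j → M (suc (suc i)) j ≈ M′ (suc (suc i)) j) →
           ∀ {j k j′ k′} → Swap j k j′ k′ → T M j k + T M′ j′ k′ ≈ 0#
    pair M M′ e₀ e₁ e {j} {k} {j′} {k′} s = begin
      T M j k + T M′ j′ k′
        ≈⟨ +-cong (solve 5 (λ a b c d f → a ⊕ (b ⊕ (c ⊕ (d ⊕ f))) ⊜ (a ⊕ c) ⊕ (b ⊕ (d ⊕ f))) refl _ _ _ _ _)
                  (solve 5 (λ a b c d f → a ⊕ (b ⊕ (c ⊕ (d ⊕ f))) ⊜ (a ⊕ c) ⊕ (d ⊕ (b ⊕ f))) refl _ _ _ _ _) ⟩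
      (sgn j * sgn k) * X + (sgn j′ * sgn k′) * (M′ (suc zero) (punchIn j′ k′) * (M′ zero j′ * E M′ j′ k′))
        ≈⟨ +-congˡ (*-congˡ (*-cong (sym y₀) (*-cong (sym y₁) (sym y)))) ⟩
      (sgn j * sgn k) * X + (sgn j′ * sgn k′) * X
        ≈⟨ distribʳ X _ _ ⟨
      (sgn j * sgn k + sgn j′ * sgn k′) * X
        ≈⟨ *-congʳ (swap-sgn s) ⟩
      0# * X
        ≈⟨ zeroˡ X ⟩
      0# ∎
      where
      X = M zero j * (M (suc zero) (punchIn j k) * E M j k)
      y₀ : M zero j ≈ M′ (suc zero) (punchIn j′ k′)
      y₀ = trans (e₀ j) (reflexive (≡.cong (M′ (suc zero)) (≡.sym (swap-snd s))))
      y₁ : M (suc zero) (punchIn j k) ≈ M′ zero j′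
      y₁ = trans (e₁ _) (reflexive (≡.cong (M′ zero) (swap-fst s)))
      y : E M j k ≈ E M′ j′ k′
      y = det-cong (λ i l → trans (e i _) (reflexive (≡.cong (M′ (suc (suc i))) (swap-rest s l))))

  det-swap : ∀ {n} (M M′ : Matrix (suc (suc n))) →
             (∀ j → M zero j ≈ M′ (suc zero) j) → (∀ j → M (suc zero) j ≈ M′ zero j) →
             (∀ i j → M (suc (suc i)) j ≈ M′ (suc (suc i)) j) → det M + det M′ ≈ 0#
  det-swap {n} M M′ e₀ e₁ e = begin
    det M + det M′
      ≈⟨ +-cong (expand M) (expand M′) ⟩
    ∑′[ j < suc (suc n) ] ∑′[ k < suc n ] T M j k + ∑′[ j < suc (suc n) ] ∑′[ k < suc n ] T M′ j k
      ≈⟨ Sum-+ _ _ ⟨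
    ∑′[ j < suc (suc n) ] (∑′[ k < suc n ] T M j k + ∑′[ k < suc n ] T M′ j k)
      ≈⟨ Sum-cong (λ j → Sum-+ (T M j) (T M′ j)) ⟨
    ∑′[ j < suc (suc n) ] ∑′[ k < suc n ] (T M j k + T M′ j k)
      ≈⟨ antisym-sum (λ j k → T M j k + T M′ j k) anti ⟩
    0# ∎
    where
    anti : ∀ {j k j′ k′} → Swap j k j′ k′ → (T M j k + T M′ j k) + (T M j′ k′ + T M′ j′ k′) ≈ 0#
    anti {j} {k} {j′} {k′} s = begin
      (T M j k + T M′ j k) + (T M j′ k′ + T M′ j′ k′)
        ≈⟨ +S.solve 4 (λ a b c d → (a +S.⊕ b) +S.⊕ (c +S.⊕ d) +S.⊜ (a +S.⊕ d) +S.⊕ (b +S.⊕ c)) refl _ _ _ _ ⟩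
      (T M j k + T M′ j′ k′) + (T M′ j k + T M j′ k′)
        ≈⟨ +-cong (pair M M′ e₀ e₁ e s)
                  (pair M′ M (λ j → sym (e₁ j)) (λ j → sym (e₀ j)) (λ i j → sym (e i j)) s) ⟩
      0# + 0#
        ≈⟨ +-identityˡ 0# ⟩
      0# ∎
      where import Algebra.Solver.CommutativeMonoid +-commutativeMonoid as +S

  det-repeat : ∀ {n} (M : Matrix (suc n)) k → (∀ j → M zero j ≈ M (suc k) j) → det M ≈ 0#
  det-repeat {suc n} M zero e =
    trans (expand M) (antisym-sum (T M) (pair M M e (λ j → sym (e j)) (λ i j → refl)))
  det-repeat {suc (suc n)} M (suc k) e = begin
    det M           ≈⟨ +-identityʳ _ ⟨
    det M + 0#      ≈⟨ +-congˡ det-M′ ⟨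
    det M + det M′  ≈⟨ det-swap M M′ (λ _ → refl) (λ _ → refl) (λ _ _ → refl) ⟩
    0#              ∎
    where
    M′ : Matrix (suc (suc (suc n)))
    M′ = M (suc zero) ∷ M zero ∷ λ i → M (suc (suc i))
    det-M′ : det M′ ≈ 0#
    det-M′ = trans (reflexive (det-suc M′)) (Sum-zero (λ j → trans (*-congˡ (trans (*-congˡ
      (det-repeat (minor (M′ ∘ suc) j) k (λ l → e (punchIn j l)))) (zeroʳ _))) (zeroʳ _)))

  det-U· : ∀ {n} {u : Matrix n} → Unipotent u → ∀ A → det (u · A) ≈ det A
  det-U· {zero}  _ A = refl
  det-U· {suc n} {u} hu@(d , z) A = begin
    det (u · A)
      ≡⟨ det-suc (u · A) ⟩
    ∑′[ j < suc n ] (sgn j * ((u · A) zero j * det (minor ((u · A) ∘ suc) j)))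
      ≈⟨ Sum-cong (λ j → *-congˡ (*-cong (trans (reflexive (·-suc u A zero j)) (+-congʳ (trans (*-congʳ (d zero)) (*-identityˡ _)))) (minors j))) ⟩
    ∑′[ j < suc n ] (sgn j * ((A zero j + ∑′[ k < n ] (u zero (suc k) * A (suc k) j)) * δ j))
      ≈⟨ Sum-cong (λ j → trans (*-congˡ (distribʳ _ _ _)) (distribˡ _ _ _)) ⟩
    ∑′[ j < suc n ] (sgn j * (A zero j * δ j) + sgn j * (∑′[ k < n ] (u zero (suc k) * A (suc k) j) * δ j))
      ≈⟨ trans (Sum-+ _ _) (+-congʳ (reflexive (≡.sym (det-suc A)))) ⟩
    det A + ∑′[ j < suc n ] (sgn j * (∑′[ k < n ] (u zero (suc k) * A (suc k) j) * δ j))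
      ≈⟨ +-congˡ (trans (Sum-cong (λ j → trans (*-congˡ (*-distribʳ-Sum _ _)) (*-distribˡ-Sum _ _)))
                        (Sum-comm _)) ⟩
    det A + ∑′[ k < n ] ∑′[ j < suc n ] (sgn j * (u zero (suc k) * A (suc k) j * δ j))
      ≈⟨ +-congˡ (Sum-zero repeated) ⟩
    det A + 0#
      ≈⟨ +-identityʳ _ ⟩
    det A ∎
    where
    δ : Fin (suc n) → Carrier
    δ j = det (minor (A ∘ suc) j)
    minors : ∀ j → det (minor ((u · A) ∘ suc) j) ≈ δ j
    minors j = trans
      (det-cong (λ i l → trans (+-congʳ (trans (*-congʳ (z (suc i) zero (s≤s z≤n))) (zeroˡ _))) (+-identityˡ _)))
      (det-U· (U-tail hu) (minor (A ∘ suc) j))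
    repeated : ∀ k → ∑′[ j < suc n ] (sgn j * (u zero (suc k) * A (suc k) j * δ j)) ≈ 0#
    repeated k = begin
      ∑′[ j < suc n ] (sgn j * (u zero (suc k) * A (suc k) j * δ j))
        ≈⟨ Sum-cong (λ j → solve 4 (λ a b c e → a ⊕ ((b ⊕ c) ⊕ e) ⊜ b ⊕ (a ⊕ (c ⊕ e))) refl _ _ _ _) ⟩
      ∑′[ j < suc n ] (u zero (suc k) * (sgn j * (A (suc k) j * δ j)))
        ≈⟨ trans (*-congˡ (reflexive (det-suc (A (suc k) ∷ (A ∘ suc))))) (*-distribˡ-Sum _ _) ⟨
      u zero (suc k) * det (A (suc k) ∷ (A ∘ suc))
        ≈⟨ *-congˡ (det-repeat (A (suc k) ∷ (A ∘ suc)) k (λ _ → refl)) ⟩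
      u zero (suc k) * 0#
        ≈⟨ zeroʳ _ ⟩
      0# ∎

  punchIn-fromℕ : ∀ {n} (k : Fin n) → punchIn (fromℕ n) k ≡ inject₁ k
  punchIn-fromℕ zero    = ≡.refl
  punchIn-fromℕ (suc k) = ≡.cong suc (punchIn-fromℕ k)

  det-anti : ∀ {n} (M : Matrix n) (f : Vector Carrier (suc n)) →
             (∀ i j → j < opposite i → M i j ≈ 0#) →
             (∀ i → M i (opposite i) * f (inject₁ (opposite i)) ≈ sgn (opposite i) * f (suc (opposite i))) →
             det M * f zero ≈ f (fromℕ n)
  det-anti {zero}  M f _ _ = *-identityˡ _
  det-anti {suc n} M f z e = begin
    det M * f zero
      ≈⟨ *-congʳ (trans (reflexive (det-suc M)) (Sum-single (fromℕ n) (λ j j≢ → trans (*-congˡ (trans (*-congʳ (z zero j (j<last j≢))) (zeroˡ _))) (zeroʳ _)))) ⟩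
    (s * (M zero last * det (minor (M ∘ suc) last))) * f zero
      ≈⟨ *-congʳ (*-congˡ (*-congˡ (det-cong (λ i k → reflexive (≡.cong (M (suc i)) (punchIn-fromℕ k)))))) ⟩
    (s * (M zero last * det N)) * f zero
      ≈⟨ solve 4 (λ a b c d → (a ⊕ (b ⊕ c)) ⊕ d ⊜ a ⊕ (b ⊕ (c ⊕ d))) refl _ _ _ _ ⟩
    s * (M zero last * (det N * f zero))
      ≈⟨ *-congˡ (*-congˡ (det-anti N (f ∘ inject₁) zN (λ i → trans (e (suc i)) (*-congʳ (reflexive (≡.cong ((- 1#) ^_) (FP.toℕ-inject₁ (opposite i)))))))) ⟩
    s * (M zero last * f (inject₁ last))
      ≈⟨ *-congˡ (e zero) ⟩
    s * (s * f (suc last))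
      ≈⟨ *-assoc _ _ _ ⟨
    (s * s) * f (suc last)
      ≈⟨ trans (*-congʳ (sgn² (toℕ last))) (*-identityˡ _) ⟩
    f (suc last) ∎
    where
    last = fromℕ n
    s = sgn last
    N : Matrix n
    N i k = M (suc i) (inject₁ k)
    j<last : ∀ {j} → j ≢ last → j < last
    j<last {j} j≢ = ℕ.≤∧≢⇒< (FP.≤fromℕ j) (λ eq → j≢ (FP.toℕ-injective eq))
    zN : ∀ i j → j < opposite i → N i j ≈ 0#
    zN i j j< = z (suc i) (inject₁ j)
      (≡.subst₂ ℕ._<_ (≡.sym (FP.toℕ-inject₁ j)) (≡.sym (FP.toℕ-inject₁ (opposite i))) j<)

module DoubleCosets {a ℓ} (R : CommutativeRing a ℓ) where
  open MatrixProperties R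

  ∼-refl : ∀ {n} {A : Matrix n} → A ∼ A
  ∼-refl = 1ₘ , 1ₘ , U-1 , U-1 , ≋-trans (·-identityʳ _) (·-identityˡ _)

  ∼-sym : ∀ {n} {A B : Matrix n} → A ∼ B → B ∼ A
  ∼-sym {n} {A} {B} (u , v , hu , hv , e) = inv u , inv v , U-inv hu , U-inv hv , go
    where
    open SetoidReasoning (≋-setoid n)
    go : inv u · B · inv v ≋ A
    go = begin
      inv u · B · inv v              ≈⟨ ·-congʳ (·-congˡ e) ⟨
      inv u · (u · A · v) · inv v    ≈⟨ ·-congʳ (·-congˡ (·-assoc u A v)) ⟩
      inv u · (u · (A · v)) · inv v  ≈⟨ ·-congʳ (cancelˡ hu (A · v)) ⟩
      A · v · inv v                  ≈⟨ cancelʳ hv A ⟩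
      A                              ∎

  ∼-trans : ∀ {n} {A B C : Matrix n} → A ∼ B → B ∼ C → A ∼ C
  ∼-trans {n} {A} {B} {C} (u , v , hu , hv , e) (u′ , v′ , hu′ , hv′ , e′) =
    u′ · u , v · v′ , U-· hu′ hu , U-· hv hv′ , go
    where
    open SetoidReasoning (≋-setoid n)
    go : u′ · u · A · (v · v′) ≋ C
    go = begin
      u′ · u · A · (v · v′)    ≈⟨ ·-assoc _ v v′ ⟨
      u′ · u · A · v · v′      ≈⟨ ·-congʳ (·-congʳ (·-assoc u′ u A)) ⟩
      u′ · (u · A) · v · v′    ≈⟨ ·-congʳ (·-assoc u′ _ v) ⟩
      u′ · (u · A · v) · v′    ≈⟨ ·-congʳ (·-congˡ e) ⟩
      u′ · B · v′              ≈⟨ e′ ⟩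
      C                        ∎

  ∼-setoid : ℕ → Setoid a (a ⊔ ℓ)
  ∼-setoid n = record
    { Carrier       = Matrix n
    ; _≈_           = _∼_
    ; isEquivalence = record { refl = ∼-refl ; sym = ∼-sym ; trans = ∼-trans }
    }

module ℤP = MatrixProperties ℤ.+-*-commutativeRing
module ℚP = MatrixProperties ℚ.+-*-commutativeRing

opposite-< : ∀ {n} {i j : Fin n} → i < j → opposite j < opposite i
opposite-< {n} {i} {j} i<j = ≡.subst₂ ℕ._<_ (≡.sym (opposite-prop j)) (≡.sym (opposite-prop i))
  (ℕ.∸-monoʳ-< (s<s i<j) (FP.toℕ<n j))

------------------------------------------------------------------------
-- Integral elements, and matrices of the form b₁ W b₂, over a ring of
-- fractions of ℤ

record Fractions {a ℓ} (R : CommutativeRing a ℓ) : Set (a ⊔ ℓ) where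
  open CommutativeRing R
  field
    φ           : ℤ → Carrier
    φ-+         : ∀ x y → φ (x ℤ.+ y) ≈ φ x + φ y
    φ-*         : ∀ x y → φ (x ℤ.* y) ≈ φ x * φ y
    φ-0         : φ (+ 0) ≈ 0#
    φ-1         : φ 1ℤ ≈ 1#
    φ-injective : ∀ {x y} → φ x ≈ φ y → x ≡ y
    _≈?_        : ∀ x y → Dec (x ≈ y)
    integral?   : ∀ x → Dec (∃ λ z → x ≈ φ z)
    denominator : ∀ x → ∃ λ m → NonZero m × ∃ λ z → x * φ (+ m) ≈ φ z
    1/_         : ℕ → Carrier
    1/-inverse  : ∀ m .{{_ : NonZero m}} → φ (+ m) * 1/ m ≈ 1#

module Lattice {a ℓ} (R : CommutativeRing a ℓ) (H : Fractions R) where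
  open CommutativeRing R hiding (zero)
  open Fractions H
  open MatrixProperties R
  open import Algebra.Properties.Semiring.Sum semiring using (sum; sum-remove; sum-cong-≋)
  open import Algebra.Properties.Ring ring using (-1*x≈-x; +-cancelˡ)
  open SetoidReasoning setoid
  open import Algebra.Solver.CommutativeMonoid *-commutativeMonoid using (solve; _⊕_; _⊜_)
  import Algebra.Properties.Semiring.Sum (CommutativeRing.semiring ℤ.+-*-commutativeRing) as ℤΣ

  φₘ : ∀ {n} → ℤP.Matrix n → Matrix n
  φₘ A i j = φ (A i j)

  φ-neg1 : φ (ℤ.- 1ℤ) ≈ - 1#
  φ-neg1 = +-cancelˡ 1# _ _ (begin
    1# + φ (ℤ.- 1ℤ)      ≈⟨ +-congʳ φ-1 ⟨
    φ 1ℤ + φ (ℤ.- 1ℤ)    ≈⟨ φ-+ 1ℤ (ℤ.- 1ℤ) ⟨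
    φ (+ 0)              ≈⟨ φ-0 ⟩
    0#                   ≈⟨ -‿inverseʳ 1# ⟨
    1# + - 1#            ∎)

  φ-sum : ∀ {n} (f : Vector ℤ n) → φ (ℤΣ.sum f) ≈ sum (φ ∘ f)
  φ-sum {zero}  f = φ-0
  φ-sum {suc n} f = trans (φ-+ (f zero) _) (+-congˡ (φ-sum (f ∘ suc)))

  φ-· : ∀ {n} (A B : ℤP.Matrix n) → φₘ (A ℤP.· B) ≋ φₘ A · φₘ B
  φ-· {n} A B i j = trans (φ-sum {n} (λ k → A i k ℤ.* B k j)) (sum-cong-≋ {n} (λ k → φ-* (A i k) (B k j)))

  φ-sgn : ∀ {n} (j : Fin n) → φ (ℤP.sgn j) ≈ sgn j
  φ-sgn zero    = φ-1
  φ-sgn (suc j) = trans (φ-* (ℤ.- 1ℤ) (ℤP.sgn j)) (*-cong φ-neg1 (φ-sgn j))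

  φ-det : ∀ {n} (A : ℤP.Matrix n) → φ (ℤP.det A) ≈ det (φₘ A)
  φ-det {zero}  A = φ-1
  φ-det {suc n} A = trans
    (φ-sum {suc n} (λ j → ℤP.sgn j ℤ.* (A zero j ℤ.* ℤP.det (ℤP.minor (A ∘ suc) j))))
    (sum-cong-≋ {suc n} (λ j → trans (φ-* (ℤP.sgn j) (A zero j ℤ.* ℤP.det (ℤP.minor (A ∘ suc) j)))
      (*-cong (φ-sgn j) (trans (φ-* (A zero j) (ℤP.det (ℤP.minor (A ∘ suc) j))) (*-congˡ (φ-det (ℤP.minor (A ∘ suc) j)))))))

  φ-U : ∀ {n} {A : ℤP.Matrix n} → ℤP.Unipotent A → Unipotent (φₘ A)
  φ-U (d , z) = (λ i → trans (reflexive (≡.cong φ (d i))) φ-1)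
              , (λ i j j<i → trans (reflexive (≡.cong φ (z i j j<i))) φ-0)

  ----------------------------------------------------------------------

  Integral : Carrier → Set ℓ
  Integral q = ∃ λ z → q ≈ φ z

  -- q ∈ (1/m)ℤ.
  Div : ℕ → Carrier → Set ℓ
  Div m q = Integral (q * φ (+ m))

  Integral-resp : ∀ {p q} → p ≈ q → Integral p → Integral q
  Integral-resp e (z , h) = z , trans (sym e) h

  Div-resp : ∀ {m p q} → p ≈ q → Div m p → Div m q
  Div-resp e = Integral-resp (*-congʳ e)

  Integral-+ : ∀ {p q} → Integral p → Integral q → Integral (p + q)
  Integral-+ (x , e) (y , f) = x ℤ.+ y , trans (+-cong e f) (sym (φ-+ x y))

  Integral-* : ∀ {p q} → Integral p → Integral q → Integral (p * q)
  Integral-* (x , e) (y , f) = x ℤ.* y , trans (*-cong e f) (sym (φ-* x y))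

  Integral-φ : ∀ z → Integral (φ z)
  Integral-φ z = z , refl

  Integral-1 : Integral 1#
  Integral-1 = 1ℤ , sym φ-1

  Integral-neg : ∀ {q} → Integral q → Integral (- q)
  Integral-neg {q} x = Integral-resp (trans (*-congʳ φ-neg1) (-1*x≈-x q)) (Integral-* (Integral-φ (ℤ.- 1ℤ)) x)

  Integral-sum : ∀ {n} {f : Vector Carrier n} → (∀ i → Integral (f i)) → Integral (sum f)
  Integral-sum {zero}  h = + 0 , sym φ-0
  Integral-sum {suc n} h = Integral-+ (h zero) (Integral-sum (h ∘ suc))

  Integralₘ : ∀ {n} → Matrix n → Set ℓ
  Integralₘ A = ∀ i j → Integral (A i j)

  Integral-· : ∀ {n} {A B : Matrix n} → Integralₘ A → Integralₘ B → Integralₘ (A · B)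
  Integral-· {n} x y i j = Integral-sum {n} (λ k → Integral-* (x i k) (y k j))

  Div-* : ∀ {m n p q} → Div m p → Div n q → Div (m ℕ.* n) (p * q)
  Div-* {m} {n} {p} {q} x y = Integral-resp
    (trans (solve 4 (λ a b c d → (a ⊕ b) ⊕ (c ⊕ d) ⊜ (a ⊕ c) ⊕ (b ⊕ d)) refl p (φ (+ m)) q (φ (+ n)))
           (*-congˡ (sym (trans (reflexive (≡.cong φ (ℤ.pos-* m n))) (φ-* (+ m) (+ n))))))
    (Integral-* x y)

  Div-+ : ∀ {m p q} → Div m p → Div m q → Div m (p + q)
  Div-+ x y = Integral-resp (sym (distribʳ _ _ _)) (Integral-+ x y)

  Div-integral : ∀ m {q} → Integral q → Div m q
  Div-integral m x = Integral-* x (Integral-φ (+ m))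

  Div-int* : ∀ {m p q} → Integral p → Div m q → Div m (p * q)
  Div-int* x y = Integral-resp (sym (*-assoc _ _ _)) (Integral-* x y)

  Div-*int : ∀ {m p q} → Div m p → Integral q → Div m (p * q)
  Div-*int x y = Div-resp (*-comm _ _) (Div-int* y x)

  Div-zero : ∀ m {q} → q ≈ 0# → Div m q
  Div-zero m e = Div-integral m (+ 0 , trans e (sym φ-0))

  Div-weaken : ∀ {m} n {q} → Div m q → Div (m ℕ.* n) q
  Div-weaken n x = Div-resp (*-identityʳ _) (Div-* x (Div-integral n Integral-1))

  Div-neg : ∀ {m q} → Div m q → Div m (- q)
  Div-neg x = Div-resp (trans (*-congʳ φ-neg1) (-1*x≈-x _)) (Div-int* (Integral-φ (ℤ.- 1ℤ)) x)

  Div-sum : ∀ {m n} {f : Vector Carrier n} → (∀ i → Div m (f i)) → Div m (sum f)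
  Div-sum {m} {zero}  h = Div-zero m refl
  Div-sum {m} {suc n} h = Div-+ (h zero) (Div-sum (h ∘ suc))

  Div-term : ∀ {m n} {f : Vector Carrier n} k → Div m (sum f) → (∀ i → i ≢ k → Div m (f i)) → Div m (f k)
  Div-term {m} {suc n} {f} k s h =
    Div-resp eq (Div-+ s (Div-neg (Div-sum (λ i → h (punchIn k i) (punchInᵢ≢i k i)))))
    where
    rest = sum (removeAt f k)
    eq : sum f + - rest ≈ f k
    eq = begin
      sum f + - rest          ≈⟨ +-congʳ (sum-remove {i = k} f) ⟩
      f k + rest + - rest     ≈⟨ +-assoc _ _ _ ⟩
      f k + (rest + - rest)   ≈⟨ +-congˡ (-‿inverseʳ rest) ⟩
      f k + 0#                ≈⟨ +-identityʳ _ ⟩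
      f k                     ∎

  common-denominator : ∀ {n} (f : Vector Carrier n) → ∃ λ d → NonZero d × (∀ i → Div d (f i))
  common-denominator {zero}  f = 1 , _ , λ ()
  common-denominator {suc n} f with denominator (f zero) | common-denominator (f ∘ suc)
  ... | d₀ , nz₀ , h₀ | d , nz , h = d₀ ℕ.* d , ℕ.m*n≢0 d₀ d {{nz₀}} {{nz}} , λ where
    zero    → Div-weaken d h₀
    (suc i) → ≡.subst (λ m → Div m (f (suc i))) (ℕ.*-comm d d₀) (Div-weaken d₀ (h i))

  unipotent? : ∀ {n} (A : Matrix n) → Dec (Unipotent A)
  unipotent? A = all? (λ i → A i i ≈? 1#) ×-dec
    all? (λ i → all? (λ j → (j <? i) →-dec (A i j ≈? 0#)))

  integralₘ? : ∀ {n} (A : Matrix n) → Dec (Integralₘ A)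
  integralₘ? A = all? (λ i → all? (λ j → integral? (A i j)))

  integer : ∀ {n} {A : Matrix n} → Integralₘ A → ℤP.Matrix n
  integer h i j = proj₁ (h i j)

  integer-≋ : ∀ {n} {A : Matrix n} (h : Integralₘ A) → A ≋ φₘ (integer h)
  integer-≋ h i j = proj₂ (h i j)

  φ-U⁻ : ∀ {n} {A : ℤP.Matrix n} → Unipotent (φₘ A) → ℤP.Unipotent A
  φ-U⁻ (d , z) = (λ i → φ-injective (trans (d i) (sym φ-1)))
               , (λ i j j<i → φ-injective (trans (z i j j<i) (sym φ-0)))

  ----------------------------------------------------------------------

  module Reduce (Q : ℕ) {{_ : NonZero Q}} where

    -- q ∈ {0 , 1/Q , … , Q/Q}, a fundamental domain for (1/Q)ℤ modulo ℤ
    -- together with its upper end point.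
    Small : Carrier → Set ℓ
    Small q = ∃ λ (a : Fin (suc Q)) → q * φ (+ Q) ≈ φ (+ toℕ a)

    small-resp : ∀ {p q} → p ≈ q → Small p → Small q
    small-resp e (a , h) = a , trans (*-congʳ (sym e)) h

    small-0 : ∀ {q} → q ≈ 0# → Small q
    small-0 e = zero , trans (*-congʳ e) (trans (zeroˡ _) (sym φ-0))

    small-1 : ∀ {q} → q ≈ 1# → Small q
    small-1 e = fromℕ Q , trans (*-congʳ e) (trans (*-identityˡ _) (reflexive (≡.cong (φ ∘ +_) (≡.sym (FP.toℕ-fromℕ Q)))))

    shift : ∀ {q} → Div Q q → ∃ λ s → Small (φ s + q)
    shift {q} (z , e) = s , fromℕ< {r} r<1+Q , eq
      where
      r = z ℤ.%ℕ Q
      t = z ℤ./ℕ Q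
      s = ℤ.- t
      r<1+Q = ℕ.m<n⇒m<1+n (ℤ.n%ℕd<d z Q)
      cancel : s ℤ.* + Q ℤ.+ z ≡ + r
      cancel = E.begin
        s ℤ.* + Q ℤ.+ z                          E.≡⟨ ≡.cong₂ ℤ._+_ (≡.sym (ℤ.neg-distribˡ-* t (+ Q))) (ℤ.a≡a%ℕn+[a/ℕn]*n z Q) ⟩
        ℤ.- (t ℤ.* + Q) ℤ.+ (+ r ℤ.+ t ℤ.* + Q)  E.≡⟨ ≡.cong (λ q → ℤ.- (t ℤ.* + Q) ℤ.+ q) (ℤ.+-comm (+ r) (t ℤ.* + Q)) ⟩
        ℤ.- (t ℤ.* + Q) ℤ.+ (t ℤ.* + Q ℤ.+ + r)  E.≡⟨ ℤ.+-assoc (ℤ.- (t ℤ.* + Q)) (t ℤ.* + Q) (+ r) ⟨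
        ℤ.- (t ℤ.* + Q) ℤ.+ t ℤ.* + Q ℤ.+ + r    E.≡⟨ ≡.cong (ℤ._+ + r) (ℤ.+-inverseˡ (t ℤ.* + Q)) ⟩
        + 0 ℤ.+ + r                              E.≡⟨ ℤ.+-identityˡ (+ r) ⟩
        + r                                      E.∎
        where module E = ≡.≡-Reasoning
      eq : (φ s + q) * φ (+ Q) ≈ φ (+ toℕ (fromℕ< r<1+Q))
      eq = begin
        (φ s + q) * φ (+ Q)            ≈⟨ distribʳ _ _ _ ⟩
        φ s * φ (+ Q) + q * φ (+ Q)    ≈⟨ +-cong (sym (φ-* s (+ Q))) e ⟩
        φ (s ℤ.* + Q) + φ z            ≈⟨ φ-+ (s ℤ.* + Q) z ⟨
        φ (s ℤ.* + Q ℤ.+ z)            ≡⟨ ≡.cong φ cancel ⟩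
        φ (+ r)                        ≡⟨ ≡.cong (φ ∘ +_) (FP.toℕ-fromℕ< r<1+Q) ⟨
        φ (+ toℕ (fromℕ< r<1+Q))       ∎

    reduceʳ : ∀ {n} {b : Matrix n} → Unipotent b → (∀ i j → Div Q (b i j)) →
              ∃ λ v → ℤP.Unipotent v × (∀ i j → Small ((b · φₘ v) i j))
    reduceʳ {zero}  {b} hb db = (λ ()) , ((λ ()) , λ ()) , λ ()
    reduceʳ {suc n} {b} hb@(d , z) db with reduceʳ (U-tail hb) (λ i j → db (suc i) (suc j))
    ... | v′ , hv′ , sv′ = v , ℤP.U-block s hv′ , small
      where
      x : Vector Carrier n
      x j = sum {n} (λ k → b zero (suc k) * φ (v′ k j))
      shifted : ∀ j → ∃ λ s → Small (φ s + x j)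
      shifted j = shift (Div-sum {n = n} (λ k → Div-*int (db zero (suc k)) (Integral-φ (v′ k j))))
      s : Vector ℤ n
      s = proj₁ ∘ shifted
      v = ℤP.block s v′
      first : ∀ i → (b · φₘ v) i zero ≈ b i zero
      first i = trans (+-cong (trans (*-congˡ φ-1) (*-identityʳ _))
                              (sum-zero {n} (λ k → trans (*-congˡ φ-0) (zeroʳ _)))) (+-identityʳ _)
      small : ∀ i j → Small ((b · φₘ v) i j)
      small zero zero = small-1 (trans (first zero) (d zero))
      small zero (suc j) = small-resp (+-congʳ (sym (trans (*-congʳ (d zero)) (*-identityˡ _)))) (proj₂ (shifted j))
      small (suc i) zero = small-0 (trans (first (suc i)) (z (suc i) zero (s≤s z≤n)))
      small (suc i) (suc j) = small-resp
        (sym (trans (+-congʳ (trans (*-congʳ (z (suc i) zero (s≤s z≤n))) (zeroˡ _))) (+-identityˡ _))) (sv′ i j)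

    reduce-row : ∀ {n} {b : Matrix n} → Unipotent b → (∀ i j → Div Q (b i j)) →
                 (x : Vector Carrier n) → (∀ j → Div Q (x j)) →
                 ∃ λ (s : Vector ℤ n) → ∀ j → Small (x j + sum (λ k → φ (s k) * b k j))
    reduce-row {zero}  hb db x dx = (λ ()) , λ ()
    reduce-row {suc n} {b} hb@(d , z) db x dx = s , small
      where
      s₀ = proj₁ (shift (dx zero))
      x′ : Vector Carrier n
      x′ j = x (suc j) + φ s₀ * b zero (suc j)
      IH = reduce-row (U-tail hb) (λ i j → db (suc i) (suc j)) x′
             (λ j → Div-+ (dx (suc j)) (Div-int* (Integral-φ s₀) (db zero (suc j))))
      s : Vector ℤ (suc n)
      s = s₀ ∷ proj₁ IH
      small : ∀ j → Small (x j + sum (λ k → φ (s k) * b k j))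
      small zero = small-resp (begin
        φ s₀ + x zero                            ≈⟨ +-comm _ _ ⟩
        x zero + φ s₀                            ≈⟨ +-congˡ (trans (*-congˡ (d zero)) (*-identityʳ _)) ⟨
        x zero + φ s₀ * b zero zero              ≈⟨ +-congˡ (trans (+-congˡ (sum-zero {n} (λ k → trans (*-congˡ (z (suc k) zero (s≤s z≤n))) (zeroʳ _)))) (+-identityʳ _)) ⟨
        x zero + sum (λ k → φ (s k) * b k zero)  ∎) (proj₂ (shift (dx zero)))
      small (suc j) = small-resp (+-assoc _ _ _) (proj₂ IH j)

    reduceˡ : ∀ {n} {b : Matrix n} → Unipotent b → (∀ i j → Div Q (b i j)) →
              ∃ λ u → ℤP.Unipotent u × (∀ i j → Small ((φₘ u · b) i j))
    reduceˡ {zero}  {b} hb db = (λ ()) , ((λ ()) , λ ()) , λ ()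
    reduceˡ {suc n} {b} hb@(d , z) db with reduceˡ (U-tail hb) (λ i j → db (suc i) (suc j))
    ... | u′ , hu′ , su′ = u , ℤP.U-block s hu′ , small
      where
      IH = reduce-row (U-tail hb) (λ i j → db (suc i) (suc j)) (λ j → b zero (suc j)) (λ j → db zero (suc j))
      s = proj₁ IH
      u = ℤP.block s u′
      zeros : ∀ (f : Vector ℤ n) → sum {n} (λ k → φ (f k) * b (suc k) zero) ≈ 0#
      zeros f = sum-zero {n} (λ k → trans (*-congˡ (z (suc k) zero (s≤s z≤n))) (zeroʳ _))
      small : ∀ i j → Small ((φₘ u · b) i j)
      small zero zero = small-1 (trans (+-cong (trans (*-cong φ-1 (d zero)) (*-identityˡ _)) (zeros s)) (+-identityʳ _))
      small zero (suc j) = small-resp (+-congʳ (sym (trans (*-congʳ φ-1) (*-identityˡ _)))) (proj₂ IH j)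
      small (suc i) zero = small-0 (trans (+-cong (trans (*-congʳ φ-0) (zeroˡ _)) (zeros (u′ i))) (+-identityʳ _))
      small (suc i) (suc j) = small-resp
        (sym (trans (+-congʳ (trans (*-congʳ φ-0) (zeroˡ _))) (+-identityˡ _))) (su′ i j)

  ----------------------------------------------------------------------
  -- W is supported on the antidiagonal, with invertible entries there

  module Antidiagonal {n} (W : Matrix n) (off : ∀ i j → i ≢ opposite j → W i j ≈ 0#)
    (ω⁻ : Vector Carrier n) (ω-inv : ∀ i → W i (opposite i) * ω⁻ i ≈ 1#) where

    ω : Vector Carrier n
    ω i = W i (opposite i)

    W· : ∀ A i j → (W · A) i j ≈ ω i * A (opposite i) j
    W· A i j = sum-single (opposite i) (λ k k≢ → trans
      (*-congʳ (off i k (λ e → k≢ (≡.trans (≡.sym (opposite-involutive k)) (≡.cong opposite (≡.sym e)))))) (zeroˡ _))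

    ·W : ∀ A i k → (A · W) i (opposite k) ≈ A i k * ω k
    ·W A i k = sum-single k (λ l l≢ → trans
      (*-congˡ (off l (opposite k) (λ e → l≢ (≡.trans e (opposite-involutive k))))) (zeroʳ _))

    cancel-ω : ∀ k {x y} → x * ω k ≈ y * ω k → x ≈ y
    cancel-ω k {x} {y} e = begin
      x                 ≈⟨ un x ⟨
      x * ω k * ω⁻ k    ≈⟨ *-congʳ e ⟩
      y * ω k * ω⁻ k    ≈⟨ un y ⟩
      y                 ∎
      where
      un : ∀ z → z * ω k * ω⁻ k ≈ z
      un z = trans (*-assoc _ _ _) (trans (*-congˡ (ω-inv k)) (*-identityʳ _))

    bruhat-unique : ∀ {A B A′ B′ : Matrix n} → Unipotent A → Unipotent B → Unipotent A′ → Unipotent B′ →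
                    A · (W · B) ≋ A′ · (W · B′) → A ≋ A′ × B ≋ B′
    bruhat-unique {A} {B} {A′} {B′} hA hB hA′ hB′ e = A≋A′ , B≋B′
      where
      P = inv A′ · A
      S = B′ · inv B
      hP = U-· (U-inv hA′) hA
      hS = U-· hB′ (U-inv hB)
      PW≋WS : P · W ≋ W · S
      PW≋WS = M.begin
        P · W                             M.≈⟨ cancelʳ hB (P · W) ⟨
        P · W · B · inv B                 M.≈⟨ ·-congʳ (·-assoc P W B) ⟩
        P · (W · B) · inv B               M.≈⟨ ·-congʳ (·-assoc (inv A′) A (W · B)) ⟩
        inv A′ · (A · (W · B)) · inv B    M.≈⟨ ·-congʳ (·-congˡ e) ⟩
        inv A′ · (A′ · (W · B′)) · inv B  M.≈⟨ ·-congʳ (cancelˡ hA′ (W · B′)) ⟩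
        W · B′ · inv B                    M.≈⟨ ·-assoc W B′ (inv B) ⟩
        W · S                             M.∎
        where module M = SetoidReasoning (≋-setoid n)
      P≋1 : P ≋ 1ₘ
      P≋1 i k with <-cmp i k
      ... | tri≈ _ ≡.refl _ = trans (proj₁ hP i) (sym (proj₁ U-1 i))
      ... | tri> _ _ k<i = trans (proj₂ hP i k k<i) (sym (proj₂ U-1 i k k<i))
      ... | tri< i<k i≢k _ = trans (cancel-ω k (begin
        P i k * ω k                            ≈⟨ ·W P i k ⟨
        (P · W) i (opposite k)                 ≈⟨ PW≋WS i (opposite k) ⟩
        (W · S) i (opposite k)                 ≈⟨ W· S i (opposite k) ⟩
        ω i * S (opposite i) (opposite k)      ≈⟨ *-congˡ (proj₂ hS _ _ (opposite-< i<k)) ⟩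
        ω i * 0#                               ≈⟨ trans (zeroʳ _) (sym (zeroˡ _)) ⟩
        0# * ω k                               ∎)) (sym (reflexive (diag-≢ (λ _ → 1#) i≢k)))
      A≋A′ : A ≋ A′
      A≋A′ = M.begin
        A                  M.≈⟨ ·-identityˡ A ⟨
        1ₘ · A             M.≈⟨ ·-congʳ (inverseʳ hA′) ⟨
        A′ · inv A′ · A    M.≈⟨ ·-assoc A′ (inv A′) A ⟩
        A′ · P             M.≈⟨ ·-congˡ P≋1 ⟩
        A′ · 1ₘ            M.≈⟨ ·-identityʳ A′ ⟩
        A′                 M.∎
        where module M = SetoidReasoning (≋-setoid n)
      WB≋WB′ : W · B ≋ W · B′
      WB≋WB′ = M.begin
        W · B                       M.≈⟨ cancelˡ hA (W · B) ⟨
        inv A · (A · (W · B))       M.≈⟨ ·-congˡ e ⟩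
        inv A · (A′ · (W · B′))     M.≈⟨ ·-congˡ (·-congʳ (≋-sym A≋A′)) ⟩
        inv A · (A · (W · B′))      M.≈⟨ cancelˡ hA (W · B′) ⟩
        W · B′                      M.∎
        where module M = SetoidReasoning (≋-setoid n)
      row : ∀ i j → B (opposite i) j ≈ B′ (opposite i) j
      row i j = cancel-ω i (begin
        B (opposite i) j * ω i   ≈⟨ *-comm _ _ ⟩
        ω i * B (opposite i) j   ≈⟨ W· B i j ⟨
        (W · B) i j              ≈⟨ WB≋WB′ i j ⟩
        (W · B′) i j             ≈⟨ W· B′ i j ⟩
        ω i * B′ (opposite i) j  ≈⟨ *-comm _ _ ⟩
        B′ (opposite i) j * ω i  ∎)
      B≋B′ : B ≋ B′
      B≋B′ i j = ≡.subst (λ k → B k j ≈ B′ k j) (opposite-involutive i) (row (opposite i) j)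

    module Bound (d : ℕ) (d≢0 : NonZero d) (ω-div : ∀ i → Div d (ω i)) (ω⁻-div : ∀ i → Div d (ω⁻ i)) where

      Bounded : ℕ → ℕ → Set (a ⊔ ℓ)
      Bounded m Q = ∀ {A B : Matrix n} → Unipotent A → Unipotent B → Integralₘ (A · (W · B)) →
        ∀ k → toℕ (opposite k) ℕ.< m → (∀ i → Div Q (A i k)) × (∀ j → Div Q (B (opposite k) j))

      bound : ∀ m → ∃ λ Q → NonZero Q × Bounded m Q
      bound zero = 1 , _ , λ _ _ _ _ ()
      bound (suc m) with bound m
      ... | Q , nz , IH = Q₁ ℕ.* d , ℕ.m*n≢0 Q₁ d {{ℕ.m*n≢0 Q (d ℕ.* Q) {{nz}} {{ℕ.m*n≢0 d Q {{d≢0}} {{nz}}}}}} {{d≢0}} , step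
        where
        Q₁ = Q ℕ.* (d ℕ.* Q)
        step : Bounded (suc m) (Q₁ ℕ.* d)
        step {A} {B} hA hB int k (s≤s k≤m) = column , row
          where
          term : Fin n → Fin n → Fin n → Carrier
          term i j l = A i l * (ω l * B (opposite l) j)
          total : ∀ i j → Div Q₁ (sum (term i j))
          total i j = Div-integral Q₁ (Integral-resp (sum-cong-≋ {n} (λ l → *-congˡ (W· B l j))) (int i j))
          later : ∀ i j l → k < l → Div Q₁ (term i j l)
          later i j l k<l = Div-* (proj₁ h i) (Div-* (ω-div l) (proj₂ h j))
            where h = IH hA hB int l (ℕ.<-≤-trans (opposite-< k<l) k≤m)
          column : ∀ i → Div (Q₁ ℕ.* d) (A i k)
          column i = Div-resp eq (Div-* (Div-term k (total i (opposite k)) others) (ω⁻-div k))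
            where
            others : ∀ l → l ≢ k → Div Q₁ (term i (opposite k) l)
            others l l≢k with <-cmp l k
            ... | tri< l<k _ _ = Div-zero Q₁ (trans (*-congˡ (trans (*-congˡ (proj₂ hB _ _ (opposite-< l<k))) (zeroʳ _))) (zeroʳ _))
            ... | tri≈ _ l≡k _ = ⊥-elim (l≢k l≡k)
            ... | tri> _ _ k<l = later i (opposite k) l k<l
            eq : term i (opposite k) k * ω⁻ k ≈ A i k
            eq = begin
              A i k * (ω k * B (opposite k) (opposite k)) * ω⁻ k  ≈⟨ *-congʳ (*-congˡ (trans (*-congˡ (proj₁ hB _)) (*-identityʳ _))) ⟩
              A i k * ω k * ω⁻ k                                  ≈⟨ *-assoc _ _ _ ⟩
              A i k * (ω k * ω⁻ k)                                ≈⟨ *-congˡ (ω-inv k) ⟩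
              A i k * 1#                                          ≈⟨ *-identityʳ _ ⟩
              A i k                                               ∎
          row : ∀ j → Div (Q₁ ℕ.* d) (B (opposite k) j)
          row j = Div-resp eq (Div-* (Div-term k (total k j) others) (ω⁻-div k))
            where
            others : ∀ l → l ≢ k → Div Q₁ (term k j l)
            others l l≢k with <-cmp l k
            ... | tri< l<k _ _ = Div-zero Q₁ (trans (*-congʳ (proj₂ hA k l l<k)) (zeroˡ _))
            ... | tri≈ _ l≡k _ = ⊥-elim (l≢k l≡k)
            ... | tri> _ _ k<l = later k j l k<l
            eq : term k j k * ω⁻ k ≈ B (opposite k) j
            eq = begin
              A k k * (ω k * B (opposite k) j) * ω⁻ k  ≈⟨ *-congʳ (trans (*-congʳ (proj₁ hA k)) (*-identityˡ _)) ⟩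
              ω k * B (opposite k) j * ω⁻ k            ≈⟨ solve 3 (λ x y z → (x ⊕ y) ⊕ z ⊜ y ⊕ (x ⊕ z)) refl _ _ _ ⟩
              B (opposite k) j * (ω k * ω⁻ k)          ≈⟨ *-congˡ (ω-inv k) ⟩
              B (opposite k) j * 1#                    ≈⟨ *-identityʳ _ ⟩
              B (opposite k) j                         ∎

      entries : ∃ λ Q → NonZero Q × (∀ {A B : Matrix n} → Unipotent A → Unipotent B →
        Integralₘ (A · (W · B)) → (∀ i j → Div Q (A i j)) × (∀ i j → Div Q (B i j)))
      entries with bound n
      ... | Q , nz , h = Q , nz , λ {A} {B} hA hB int →
        (λ i j → proj₁ (h hA hB int j (FP.toℕ<n (opposite j))) i) ,
        (λ i j → ≡.subst (λ k → Div Q (B k j)) (opposite-involutive i)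
                   (proj₂ (h hA hB int (opposite i) (FP.toℕ<n (opposite (opposite i)))) j))

    entries : ∃ λ Q → NonZero Q × (∀ {A B : Matrix n} → Unipotent A → Unipotent B →
              Integralₘ (A · (W · B)) → (∀ i j → Div Q (A i j)) × (∀ i j → Div Q (B i j)))
    entries with common-denominator ω | common-denominator ω⁻
    ... | d , nz , h | d′ , nz′ , h′ = Bound.entries (d ℕ.* d′) (ℕ.m*n≢0 d d′ {{nz}} {{nz′}})
      (λ i → Div-weaken d′ (h i))
      (λ i → ≡.subst (λ m → Div m (ω⁻ i)) (ℕ.*-comm d′ d) (Div-weaken d (h′ i)))

    record Cell : Set (a ⊔ ℓ) where
      field
        γ      : ℤP.Matrix n
        b₁ b₂  : Matrix n
        unip₁  : Unipotent b₁
        unip₂  : Unipotent b₂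
        bruhat : φₘ γ ≋ b₁ · (W · b₂)

    infix 4 _≈ᶜ_

    _≈ᶜ_ : Cell → Cell → Set
    x ≈ᶜ y = Cell.γ x ℤP.∼ Cell.γ y

    translate : ∀ (u v : ℤP.Matrix n) (x : Cell) →
                φₘ (u ℤP.· Cell.γ x ℤP.· v) ≋ (φₘ u · Cell.b₁ x) · (W · (Cell.b₂ x · φₘ v))
    translate u v x = M.begin
      φₘ (u ℤP.· γ ℤP.· v)             M.≈⟨ φ-· (u ℤP.· γ) v ⟩
      φₘ (u ℤP.· γ) · φₘ v             M.≈⟨ ·-congʳ (φ-· u γ) ⟩
      φₘ u · φₘ γ · φₘ v               M.≈⟨ ·-congʳ (·-congˡ bruhat) ⟩
      φₘ u · (b₁ · (W · b₂)) · φₘ v    M.≈⟨ ·-congʳ (·-assoc (φₘ u) b₁ (W · b₂)) ⟨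
      φₘ u · b₁ · (W · b₂) · φₘ v      M.≈⟨ ·-assoc (φₘ u · b₁) (W · b₂) (φₘ v) ⟩
      φₘ u · b₁ · (W · b₂ · φₘ v)      M.≈⟨ ·-congˡ (·-assoc W b₂ (φₘ v)) ⟩
      φₘ u · b₁ · (W · (b₂ · φₘ v))    M.∎
      where
      open Cell x
      module M = SetoidReasoning (≋-setoid n)

    -- x and y lie in the same double coset iff b₁ y · (b₁ x)⁻¹ and
    -- (b₂ x)⁻¹ · b₂ y are integral.
    ≈ᶜ-dec : ∀ x y → Dec (x ≈ᶜ y)
    ≈ᶜ-dec x y = map′ to from (integralₘ? P ×-dec integralₘ? S)
      where
      module x = Cell x
      module y = Cell y
      P = y.b₁ · inv x.b₁
      S = inv x.b₂ · y.b₂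
      hP = U-· y.unip₁ (U-inv x.unip₁)
      hS = U-· (U-inv x.unip₂) y.unip₂
      to : Integralₘ P × Integralₘ S → x ≈ᶜ y
      to (p , s) = u , v , φ-U⁻ (U-resp (integer-≋ p) hP) , φ-U⁻ (U-resp (integer-≋ s) hS) ,
        λ i j → φ-injective (eq i j)
        where
        u = integer p
        v = integer s
        left : φₘ u · x.b₁ ≋ y.b₁
        left = M.begin
          φₘ u · x.b₁               M.≈⟨ ·-congʳ (integer-≋ p) ⟨
          y.b₁ · inv x.b₁ · x.b₁    M.≈⟨ ·-assoc y.b₁ (inv x.b₁) x.b₁ ⟩
          y.b₁ · (inv x.b₁ · x.b₁)  M.≈⟨ ·-congˡ (inverseˡ x.unip₁) ⟩
          y.b₁ · 1ₘ                 M.≈⟨ ·-identityʳ y.b₁ ⟩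
          y.b₁                      M.∎
          where module M = SetoidReasoning (≋-setoid n)
        right : x.b₂ · φₘ v ≋ y.b₂
        right = M.begin
          x.b₂ · φₘ v               M.≈⟨ ·-congˡ (integer-≋ s) ⟨
          x.b₂ · (inv x.b₂ · y.b₂)  M.≈⟨ ·-assoc x.b₂ (inv x.b₂) y.b₂ ⟨
          x.b₂ · inv x.b₂ · y.b₂    M.≈⟨ ·-congʳ (inverseʳ x.unip₂) ⟩
          1ₘ · y.b₂                 M.≈⟨ ·-identityˡ y.b₂ ⟩
          y.b₂                      M.∎
          where module M = SetoidReasoning (≋-setoid n)
        eq : φₘ (u ℤP.· x.γ ℤP.· v) ≋ φₘ y.γ
        eq = ≋-trans (translate u v x) (≋-trans (·-cong left (·-congˡ right)) (≋-sym y.bruhat))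
      from : x ≈ᶜ y → Integralₘ P × Integralₘ S
      from (u , v , hu , hv , e) =
        (λ i j → u i j , ≋-trans (·-congʳ (≋-sym left)) (cancelʳ x.unip₁ (φₘ u)) i j) ,
        (λ i j → v i j , ≋-trans (·-congˡ (≋-sym right)) (cancelˡ x.unip₂ (φₘ v)) i j)
        where
        same : φₘ u · x.b₁ ≋ y.b₁ × x.b₂ · φₘ v ≋ y.b₂
        same = bruhat-unique (U-· (φ-U hu) x.unip₁) (U-· x.unip₂ (φ-U hv)) y.unip₁ y.unip₂
          (≋-trans (≋-sym (translate u v x)) (≋-trans (λ i j → reflexive (≡.cong φ (e i j))) y.bruhat))
        left = proj₁ same
        right = proj₂ same

    private
      Q = proj₁ entries

      instance
        Q≢0 : NonZero Q
        Q≢0 = proj₁ (proj₂ entries)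

    open Reduce Q

    -- Codes for the matrices with entries in {0 , 1/Q , … , Q/Q}.
    Code : Set
    Code = Fin ((suc Q ℕ.^ n) ℕ.^ n)

    matrix : Code → Matrix n
    matrix p i j = φ (+ toℕ (finToFun (finToFun p i) j)) * 1/ Q

    code : ∀ {b : Matrix n} → (∀ i j → Small (b i j)) → Code
    code s = funToFin (λ i → funToFin (λ j → proj₁ (s i j)))

    matrix-code : ∀ {b : Matrix n} (s : ∀ i j → Small (b i j)) → matrix (code s) ≋ b
    matrix-code {b} s i j = begin
      φ (+ toℕ (finToFun (finToFun (code s) i) j)) * 1/ Q  ≡⟨ ≡.cong (λ k → φ (+ toℕ k) * 1/ Q) decoded ⟩
      φ (+ toℕ (proj₁ (s i j))) * 1/ Q                     ≈⟨ *-congʳ (proj₂ (s i j)) ⟨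
      b i j * φ (+ Q) * 1/ Q                               ≈⟨ *-assoc _ _ _ ⟩
      b i j * (φ (+ Q) * 1/ Q)                             ≈⟨ *-congˡ (1/-inverse Q) ⟩
      b i j * 1#                                           ≈⟨ *-identityʳ _ ⟩
      b i j                                                ∎
      where
      decoded : finToFun (finToFun (code s) i) j ≡ proj₁ (s i j)
      decoded = ≡.trans
        (≡.cong (λ p → finToFun p j) (finToFun-funToFin (λ i → funToFin (λ j → proj₁ (s i j))) i))
        (finToFun-funToFin (λ j → proj₁ (s i j)) j)

    Good : Code → Code → Set ℓ
    Good p q = Unipotent (matrix p) × Unipotent (matrix q) × Integralₘ (matrix p · (W · matrix q))

    good? : ∀ p q → Dec (Good p q)
    good? p q = unipotent? (matrix p) ×-dec unipotent? (matrix q) ×-dec integralₘ? (matrix p · (W · matrix q))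

    candidate : ∀ {p q} → Dec (Good p q) → List Cell
    candidate {p} {q} (yes (hA , hB , h)) = record
      { γ = integer h ; b₁ = matrix p ; b₂ = matrix q ; unip₁ = hA ; unip₂ = hB
      ; bruhat = ≋-sym (integer-≋ h) } List.∷ List.[]
    candidate (no _) = List.[]

    candidates-at : Code → List Cell
    candidates-at p = concatMap (λ q → candidate (good? p q)) (allFin _)

    candidates′ : List Cell
    candidates′ = concatMap candidates-at (allFin _)

    complete′ : ∀ x → Any (x ≈ᶜ_) candidates′
    complete′ x = Any.concatMap⁺ candidates-at (lose (∈-allFin p)
      (Any.concatMap⁺ (λ q → candidate (good? p q)) (lose (∈-allFin q) (found (good? p q)))))
      where
      module x = Cell x
      divs = proj₂ (proj₂ entries) x.unip₁ x.unip₂ (λ i j → x.γ i j , sym (x.bruhat i j))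
      left = reduceˡ x.unip₁ (proj₁ divs)
      right = reduceʳ x.unip₂ (proj₂ divs)
      u = proj₁ left
      v = proj₁ right
      hu = proj₁ (proj₂ left)
      hv = proj₁ (proj₂ right)
      p = code (proj₂ (proj₂ left))
      q = code (proj₂ (proj₂ right))
      eA : matrix p ≋ φₘ u · x.b₁
      eA = matrix-code (proj₂ (proj₂ left))
      eB : matrix q ≋ x.b₂ · φₘ v
      eB = matrix-code (proj₂ (proj₂ right))
      eG : matrix p · (W · matrix q) ≋ φₘ (u ℤP.· x.γ ℤP.· v)
      eG = ≋-trans (·-cong eA (·-congˡ eB)) (≋-sym (translate u v x))
      found : (d : Dec (Good p q)) → Any (x ≈ᶜ_) (candidate d)
      found (yes (hA , hB , h)) = here (u , v , hu , hv ,
        λ i j → φ-injective (trans (sym (eG i j)) (integer-≋ h i j)))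
      found (no ¬good) = ⊥-elim (¬good
        ( U-resp (≋-sym eA) (U-· (φ-U hu) x.unip₁)
        , U-resp (≋-sym eB) (U-· x.unip₂ (φ-U hv))
        , λ i j → (u ℤP.· x.γ ℤP.· v) i j , eG i j))

    abstract
      candidates : List Cell
      candidates = candidates′

      complete : ∀ x → Any (x ≈ᶜ_) candidates
      complete = complete′

------------------------------------------------------------------------
-- The set X(c) = U(ℤ) \ C(c) / U(ℤ)

X : ∀ {r} → Vector ℕ⁺ r → Setoid 0ℓ 0ℓ
X {r} D = On.setoid (∼-setoid (1 ℕ.+ r)) (C.γ {D = D})
  where open DoubleCosets ℤ.+-*-commutativeRing

------------------------------------------------------------------------
-- X(c) is finite.  Every double coset has a representative for which the
-- entries of b₁ and b₂ lie in {0 , 1/Q , … , Q/Q}, with Q depending on D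
-- only, and equality in X(c) is decidable.

module Finiteness where
  open import Data.Rational.Base using (_+_; _*_; -_)
  open ≡ using (refl; sym; trans; cong; cong₂; module ≡-Reasoning)
  open ℤM using (_∼_)
  open ℚP using (Matrix; _≋_; _·_; Unipotent; det; sgn)

  ι-ᵘ : ∀ z → toℚᵘ (ι z) ℚᵘ.≃ mkℚᵘ z 0
  ι-ᵘ z = ℚ.toℚᵘ-fromℚᵘ (mkℚᵘ z 0)

  ι-injective : ∀ {x y} → ι x ≡ ι y → x ≡ y
  ι-injective {x} {y} e with ℚᵘ.≃-trans (ℚᵘ.≃-sym (ι-ᵘ x)) (ℚᵘ.≃-trans (ℚᵘ.≃-reflexive (cong toℚᵘ e)) (ι-ᵘ y))
  ... | *≡* p = trans (sym (ℤ.*-identityʳ x)) (trans p (ℤ.*-identityʳ y))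

  ι-* : ∀ x y → ι (x ℤ.* y) ≡ ι x * ι y
  ι-* x y = ℚ.toℚᵘ-injective (ℚᵘ.≃-trans (ι-ᵘ (x ℤ.* y)) (ℚᵘ.≃-sym
    (ℚᵘ.≃-trans (ℚ.toℚᵘ-homo-* (ι x) (ι y)) (ℚᵘ.≃-trans (ℚᵘ.*-cong (ι-ᵘ x) (ι-ᵘ y)) (*≡* refl)))))

  ι-+ : ∀ x y → ι (x ℤ.+ y) ≡ ι x + ι y
  ι-+ x y = ℚ.toℚᵘ-injective (ℚᵘ.≃-trans (ι-ᵘ (x ℤ.+ y)) (ℚᵘ.≃-sym
    (ℚᵘ.≃-trans (ℚ.toℚᵘ-homo-+ (ι x) (ι y)) (ℚᵘ.≃-trans (ℚᵘ.+-cong (ι-ᵘ x) (ι-ᵘ y))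
      (*≡* (cong (ℤ._* 1ℤ) (cong₂ ℤ._+_ (ℤ.*-identityʳ x) (ℤ.*-identityʳ y))))))))

  ι-numerator : ∀ z → ↥ (ι z) ≡ z
  ι-numerator (+ n)    = cong ↥_ (ℚ.normalize-coprime (Coprimality.sym (Coprimality.1-coprimeTo n)))
  ι-numerator -[1+ n ] = cong (λ q → ↥ (- q)) (ℚ.normalize-coprime (Coprimality.sym (Coprimality.1-coprimeTo (suc n))))

  /-* : ∀ z m .{{_ : NonZero m}} → (z / m) * ι (+ m) ≡ ι z
  /-* z (suc m) = ℚ.toℚᵘ-injective (ℚᵘ.≃-trans (ℚ.toℚᵘ-homo-* (z / suc m) (ι (+ suc m)))
    (ℚᵘ.≃-trans (ℚᵘ.*-cong (ℚ.toℚᵘ-fromℚᵘ (mkℚᵘ z m)) (ι-ᵘ (+ suc m)))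
    (ℚᵘ.≃-trans (*≡* (ℤ.*-assoc z (+ suc m) 1ℤ)) (ℚᵘ.≃-sym (ι-ᵘ z)))))

  integral? : ∀ q → Dec (∃ λ z → q ≡ ι z)
  integral? q = map′ (λ e → ↥ q , e) (λ { (z , refl) → cong ι (sym (ι-numerator z)) }) (q ℚ.≟ ι (↥ q))

  1/′ : ℕ → ℚ
  1/′ zero    = 0ℚ
  1/′ (suc m) = 1ℤ / suc m

  1/′-inverse : ∀ m .{{_ : NonZero m}} → ι (+ m) * 1/′ m ≡ 1ℚ
  1/′-inverse (suc m) = trans (ℚ.*-comm (ι (+ suc m)) (1/′ (suc m))) (/-* 1ℤ (suc m))

  ℚ-fractions : Fractions ℚ.+-*-commutativeRing
  ℚ-fractions = record
    { φ = ι ; φ-+ = ι-+ ; φ-* = ι-* ; φ-0 = refl ; φ-1 = refl ; φ-injective = ι-injective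
    ; _≈?_ = ℚ._≟_ ; integral? = integral?
    ; denominator = λ q → ↧ₙ q , _ , ↥ q , trans (cong (_* ι (↧ q)) (sym (ℚ.↥p/↧p≡p q))) (/-* (↥ q) (↧ₙ q))
    ; 1/_ = 1/′ ; 1/-inverse = 1/′-inverse }

  open Lattice ℚ.+-*-commutativeRing ℚ-fractions using (module Antidiagonal; φₘ; φ-det)


  module Enumeration {r} (D : Vector ℕ⁺ r) where

    n = suc r

    f : Vector ℕ⁺ (suc n)
    f = extend D

    F : Vector ℚ (suc n)
    F k = ι (+ value (f k))

    t : Vector ℚ n
    t i = f (suc (opposite i)) ÷ f (inject₁ (opposite i))

    W : Matrix n
    W = c D · w₀

    w₀-off : ∀ (i j : Fin n) → i ≢ opposite j → w₀ i j ≡ 0ℚ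
    w₀-off i j i≢ with i ≟ opposite j
    ... | yes i≡ = ⊥-elim (i≢ i≡)
    ... | no _   = refl

    w₀-on : ∀ (i : Fin n) → w₀ i (opposite i) ≡ sgn (opposite i)
    w₀-on i with i ≟ opposite (opposite i)
    ... | yes _  = refl
    ... | no i≢  = ⊥-elim (i≢ (sym (opposite-involutive i)))

    off : ∀ i j → i ≢ opposite j → W i j ≡ 0ℚ
    off i j i≢ = trans (ℚP.diag-· t w₀ i j) (trans (cong (t i *_) (w₀-off i j i≢)) (ℚ.*-zeroʳ (t i)))

    t-F : ∀ i → t i * F (inject₁ (opposite i)) ≡ F (suc (opposite i))
    t-F i = /-* (+ value (f (suc (opposite i)))) (value m) ⦃ ℕ⁺.nonZero m ⦄
      where m = f (inject₁ (opposite i))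

    1/F : Vector ℚ (suc n)
    1/F k = 1⁺ ÷ f k

    F-1/F : ∀ k → F k * 1/F k ≡ 1ℚ
    F-1/F k = trans (ℚ.*-comm (F k) (1/F k)) (/-* 1ℤ (value (f k)) ⦃ ℕ⁺.nonZero (f k) ⦄)

    W-on : ∀ i → W i (opposite i) * F (inject₁ (opposite i)) ≡ sgn (opposite i) * F (suc (opposite i))
    W-on i = begin
      W i (opposite i) * x       ≡⟨ cong (_* x) (trans (ℚP.diag-· t w₀ i (opposite i)) (cong (t i *_) (w₀-on i))) ⟩
      t i * s * x                ≡⟨ cong (_* x) (ℚ.*-comm (t i) s) ⟩
      s * t i * x                ≡⟨ ℚ.*-assoc s (t i) x ⟩
      s * (t i * x)              ≡⟨ cong (s *_) (t-F i) ⟩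
      s * F (suc (opposite i)) ∎
      where
      open ≡-Reasoning
      s = sgn (opposite i)
      x = F (inject₁ (opposite i))

    ω⁻ : Vector ℚ n
    ω⁻ i = F (inject₁ (opposite i)) * (1/F (suc (opposite i)) * sgn (opposite i))

    ω-inv : ∀ i → W i (opposite i) * ω⁻ i ≡ 1ℚ
    ω-inv i = begin
      W i (opposite i) * (x * (y * s))  ≡⟨ ℚ.*-assoc (W i (opposite i)) x (y * s) ⟨
      W i (opposite i) * x * (y * s)    ≡⟨ cong (_* (y * s)) (W-on i) ⟩
      s * z * (y * s)                   ≡⟨ ℚ.*-assoc s z (y * s) ⟩
      s * (z * (y * s))                 ≡⟨ cong (s *_) (ℚ.*-assoc z y s) ⟨
      s * (z * y * s)                   ≡⟨ cong (λ q → s * (q * s)) (F-1/F (suc (opposite i))) ⟩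
      s * (1ℚ * s)                      ≡⟨ cong (s *_) (ℚ.*-identityˡ s) ⟩
      s * s                             ≡⟨ ℚP.sgn² (toℕ (opposite i)) ⟩
      1ℚ                                ∎
      where
      open ≡-Reasoning
      s = sgn (opposite i)
      x = F (inject₁ (opposite i))
      y = 1/F (suc (opposite i))
      z = F (suc (opposite i))

    open Antidiagonal W off ω⁻ ω-inv

    regroup : ∀ A B → A · c D · w₀ · B ≋ A · (W · B)
    regroup A B = ℚP.≋-trans (ℚP.·-congʳ {B = B} (ℚP.·-assoc A (c D) w₀)) (ℚP.·-assoc A W B)

    det-1 : ∀ {A B} → Unipotent A → Unipotent B → ∀ G → φₘ G ≋ A · (W · B) → ℤP.det G ≡ 1ℤ
    det-1 {A} {B} hA hB G e = ι-injective (begin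
      ι (ℤP.det G)           ≡⟨ φ-det G ⟩
      det (φₘ G)             ≡⟨ ℚP.det-cong e ⟩
      det (A · (W · B))      ≡⟨ ℚP.det-U· hA (W · B) ⟩
      det (W · B)            ≡⟨ ℚ.*-identityʳ _ ⟨
      det (W · B) * F zero   ≡⟨ ℚP.det-anti (W · B) F zeros diagonal ⟩
      F (fromℕ n)            ≡⟨ cong (λ d → ι (+ value d)) (insertAt-lookup D (fromℕ r) 1⁺) ⟩
      1ℚ                     ∎)
      where
      open ≡-Reasoning
      zeros : ∀ i j → j < opposite i → (W · B) i j ≡ 0ℚ
      zeros i j j< = trans (W· B i j) (trans (cong (ω i *_) (proj₂ hB (opposite i) j j<)) (ℚ.*-zeroʳ (ω i)))
      diagonal : ∀ i → (W · B) i (opposite i) * F (inject₁ (opposite i)) ≡ sgn (opposite i) * F (suc (opposite i))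
      diagonal i = trans (cong (_* F (inject₁ (opposite i)))
        (trans (W· B i (opposite i)) (trans (cong (ω i *_) (proj₁ hB (opposite i))) (ℚ.*-identityʳ (ω i))))) (W-on i)

    to : C D → Cell
    to x = record
      { γ = C.γ x ; b₁ = C.b₁ x ; b₂ = C.b₂ x ; unip₁ = C.unip₁ x ; unip₂ = C.unip₂ x
      ; bruhat = ℚP.≋-trans (C.bruhat x) (regroup (C.b₁ x) (C.b₂ x)) }

    from : Cell → C D
    from x = record
      { γ = γ ; det-γ = det-1 unip₁ unip₂ γ bruhat
      ; b₁ = b₁ ; b₂ = b₂ ; unip₁ = unip₁ ; unip₂ = unip₂
      ; bruhat = ℚP.≋-trans bruhat (ℚP.≋-sym (regroup b₁ b₂)) }
      where open Cell x

    decSetoid : DecSetoid 0ℓ 0ℓ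
    decSetoid = record
      { Carrier = C D
      ; _≈_ = Setoid._≈_ (X D)
      ; isDecEquivalence = record
        { isEquivalence = Setoid.isEquivalence (X D)
        ; _≟_ = λ x y → ≈ᶜ-dec (to x) (to y) } }

    elements : List (C D)
    elements = deduplicate (DecSetoid._≟_ decSetoid) (List.map from candidates)

    from-complete : IsEnumeration (X D) (List.map from candidates)
    from-complete x = Any.map⁺ {f = from} {P = Setoid._≈_ (X D) x} (complete (to x))

    elements-complete : IsEnumeration (X D) elements
    elements-complete = Enumerates.deduplicate⁺ decSetoid {xs = List.map from candidates} from-complete

    elements-unique : Unique (X D) elements
    elements-unique = Unique.deduplicate-! decSetoid (List.map from candidates)

abstract
  elements : ∀ {r} (D : Vector ℕ⁺ r) → List (C D)
  elements D = Finiteness.Enumeration.elements D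

  elements-complete : ∀ {r} (D : Vector ℕ⁺ r) → IsEnumeration (X D) (elements D)
  elements-complete D = Finiteness.Enumeration.elements-complete D

  elements-unique : ∀ {r} (D : Vector ℕ⁺ r) → Unique (X D) (elements D)
  elements-unique D = Finiteness.Enumeration.elements-unique D

------------------------------------------------------------------------

-- The values of Kloosterman sums are taken in a commutative ring R with a
-- homomorphism e from (ℚ , +) to the units of R that is trivial on ℤ.  The
-- classical sums are the case R = ℂ and e z = exp (2πiz).
record Exponential {a ℓ} (R : CommutativeRing a ℓ) : Set (a ⊔ ℓ) where
  open CommutativeRing R
  field
    e   : ℚ → Carrier
    e-+ : ∀ p q → e (p ℚ.+ q) ≈ e p * e q
    e-1 : e 1ℚ ≈ 1#

module Kloosterman {a ℓ} (R : CommutativeRing a ℓ) (E : Exponential R) where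
  open CommutativeRing R
  open Exponential E
  open import Algebra.Properties.Semiring.Sum
    (CommutativeRing.semiring ℚ.+-*-commutativeRing) using (sum-syntax)

  ψ : ∀ {r} → Vector ℤ r → ℚM.Matrix (1 ℕ.+ r) → Carrier
  ψ {r} N u = e (∑[ i < r ] (ι (N i) ℚ.* u (inject₁ i) (suc i)))

  -- S M N D is Sₙ(M,N;D) with n = 1 + r, summed over representatives of the
  -- elements of X(c), each taken once; μ and μ′ are C.b₁ and C.b₂.
  S : ∀ {r} → Vector ℤ r → Vector ℤ r → Vector ℕ⁺ r → Carrier
  S M N D = List.foldr (λ x s → ψ (reverse M) (C.b₁ x) * ψ N (C.b₂ x) + s) 0# (elements D)

{-# OPTIONS --safe #-}

-- Write q = Dₙ₋₁ and δ = Dₙ₋₂.  Since δ is prime to q, every γ ∈ C(c) is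
-- equivalent to a matrix P with rows
--   (a Γ₀ | s) , (q Γ₀ | t) , (Γᵢ | 0) for i ≥ 1,
-- where Γ ∈ SL(n-1,ℤ) lies in the cell of (D₁ , … , Dₙ₋₂) and
-- q s - a t = ± 1: the cofactors of the lower left block A of γ, which has
-- determinant q, combine the rows of A to a vector divisible by q, and
-- afterwards the last column and the first row are cleared with Γ⁻¹.  The
-- class of P determines that of Γ, and a mod q; as q s - a t = ± 1, the
-- classes of P correspond to pairs of classes in Xₙ₋₁ and X₂.  From the
-- Bruhat decomposition b₁ c′ w₀ b₂ of Γ one reads off that of P: the
-- superdiagonal of its first factor is a / q , q (b₁)₀₁ , (b₁)₁₂ , … and
-- that of the second one is (b₂)₀₁ , … , ± δ t / q.  Taking a = δ a′ and
-- t = ± δ⁻¹ d′ mod q, where a′ and d′ are the diagonal entries of an element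
-- of SL(2,ℤ) with lower left entry q, both characters factor as claimed.

module Submission where

open import Defs
open import Algebra.Bundles using (CommutativeRing)
open import Data.Empty using (⊥-elim)
open import Data.Fin.Base using (Fin; zero; suc; toℕ; _<_; punchOut; inject₁; fromℕ; opposite)
import Data.Fin.Properties as Fin
open import Data.Fin.Properties using (_≟_; opposite-involutive)
open import Data.Fin.Relation.Unary.Top using (view; ‵fromℕ; ‵inject₁)
open import Data.Integer.Base as ℤ using (ℤ; +_)
import Data.Integer.Properties as ℤ
import Data.Integer.Tactic.RingSolver as ℤ
open import Data.List.Base as List using (List; cartesianProductWith)
open import Data.List.Membership.Propositional using (find)
import Data.List.Membership.Setoid as Membership
import Data.List.Membership.Setoid.Properties as Membershipₚ
import Data.List.Properties as List
import Data.List.Relation.Binary.Permutation.Setoid as Permutation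
import Data.List.Relation.Binary.Permutation.Setoid.Properties as Permutationₚ
open import Data.List.Relation.Unary.All.Properties using (All¬⇒¬Any)
import Data.List.Relation.Unary.AllPairs as AllPairs
open import Data.List.Relation.Unary.Any as Any using (here; there)
import Data.List.Relation.Unary.Any.Properties as Any
open import Data.List.Relation.Unary.Enumerates.Setoid using (IsEnumeration)
open import Data.List.Relation.Unary.Unique.Setoid using (Unique)
import Data.List.Relation.Unary.Unique.Setoid.Properties as Unique
open import Data.Nat.Base as ℕ using (ℕ; zero; suc; s≤s; z≤n)
import Data.Nat.Coprimality as Coprimality
open import Data.Nat.Divisibility using (_∣_; ∣-trans; m∣m*n; ∣n⇒∣m*n)
open import Data.Nat.GCD using (gcd; module Bézout)
import Data.Nat.Properties as ℕ
open import Data.Product.Base using (_×_; _,_; proj₁; proj₂; ∃; ∃₂)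
open import Data.Vec.Functional using (Vector; []; _∷_; tail; init; last; map; foldr; reverse; removeAt; insertAt; updateAt)
open import Data.Vec.Functional.Properties using (insertAt-lookup; removeAt-punchOut; updateAt-updates; updateAt-minimal)
open import Function.Base using (_∘_)
open import Relation.Binary.Bundles using (Setoid)
open import Relation.Binary.PropositionalEquality as ≡ using (_≡_)
import Relation.Binary.Reasoning.Setoid as SetoidReasoning
open import Relation.Nullary using (¬_; yes; no; does)

-- The twists by δ and q have a common origin. In P the numerators a and ± δ t of the two new
-- superdiagonal entries have a product congruent to δ mod q, while the numerators a′ and d′ for an
-- element of SL(2,ℤ) have a product congruent to 1. One of the two has to absorb δ, and giving it
-- to a places Dₙ₋₂ at Mₙ₋₁. The factor Dₙ₋₁ at Mₙ₋₂ appears because the lower left block of P is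
-- Diag (q , 1 , ... , 1) Γ, and conjugation by this diagonal matrix multiplies (b₁)₀₁ by q. The sum
-- over X(c) runs through a list whose representatives are not under control. The correspondence of
-- classes is therefore a map on elements which reflects equivalence and which meets every class
-- whichever representatives are inserted; the list of its values is then a permutation, up to
-- equivalence, of the list for D.

-- Cofactors and the adjugate matrix.

module Adjugate {a ℓ} (R : CommutativeRing a ℓ) where
  open CommutativeRing R hiding (zero)
  open MatrixProperties R
  open import Algebra.Properties.Ring ring using (-1*x≈-x; +-cancelʳ)
  open import Algebra.Solver.CommutativeMonoid *-commutativeMonoid using (solve; _⊕_; _⊜_)
  open import Relation.Binary.Reasoning.Setoid setoid

  -- Induction on the row: expanding along row 0 moves row `suc i` to the second place inside the
  -- minors, and one transposition of the first two rows, which costs the sign, brings it to the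
  -- front.
  det-front : ∀ {n} (A : Matrix (suc n)) i → det (A i ∷ removeAt A i) ≈ sgn i * det A
  det-front A zero = trans
    (det-cong {A = A zero ∷ removeAt A zero} {B = A} λ { zero _ → refl ; (suc _) _ → refl })
    (sym (*-identityˡ _))
  det-front {suc n} A (suc i) = begin
    det M
      ≈⟨ +-cancelʳ (det M′) _ _ (trans swapped (sym (trans (+-congʳ (-1*x≈-x _)) (-‿inverseˡ _)))) ⟩
    - 1# * det M′          ≈⟨ *-congˡ expanded ⟩
    - 1# * (sgn i * det A) ≈⟨ *-assoc _ _ _ ⟨
    - 1# * sgn i * det A   ∎
    where
    M M′ : Matrix (suc (suc n))
    M  = A (suc i) ∷ removeAt A (suc i)
    M′ = A zero ∷ A (suc i) ∷ removeAt (tail A) i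
    swapped : det M + det M′ ≈ 0#
    swapped = det-swap M M′ (λ _ → refl) (λ _ → refl) (λ _ _ → refl)
    minors : ∀ j → det (minor (tail M′) j) ≈ sgn i * det (minor (tail A) j)
    minors j = trans
      (det-cong {A = minor (tail M′) j} {B = minor (tail A) j i ∷ removeAt (minor (tail A) j) i} λ { zero _ → refl ; (suc _) _ → refl })
      (det-front (minor (tail A) j) i)
    expanded : det M′ ≈ sgn i * det A
    expanded = begin
      det M′
        ≡⟨ det-suc M′ ⟩
      ∑′[ j < suc (suc n) ] (sgn j * (A zero j * det (minor (tail M′) j)))
        ≈⟨ Sum-cong (λ j → trans (*-congˡ (*-congˡ (minors j)))
             (solve 4 (λ a b c d → a ⊕ (b ⊕ (c ⊕ d)) ⊜ c ⊕ (a ⊕ (b ⊕ d))) refl _ _ _ _)) ⟩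
      ∑′[ j < suc (suc n) ] (sgn i * (sgn j * (A zero j * det (minor (tail A) j))))
        ≈⟨ *-distribˡ-Sum _ _ ⟨
      sgn i * ∑′[ j < suc (suc n) ] (sgn j * (A zero j * det (minor (tail A) j)))
        ≡⟨ ≡.cong (sgn i *_) (det-suc A) ⟨
      sgn i * det A ∎

  adj : ∀ {n} → Matrix n → Matrix n
  adj {suc n} A k i = sgn i * (sgn k * det (minor (removeAt A i) k))

  -- Up to sign, entry (i , j) is the first-row expansion of the matrix obtained by deleting row `j`
  -- and putting row `i` in front. For i ≠ j this matrix has a repeated row.
  ·-adj : ∀ {n} (A : Matrix n) → A · adj A ≋ diag (λ _ → det A)
  ·-adj {suc n} A i j = trans expand go
    where
    expand : (A · adj A) i j ≈ sgn j * det (A i ∷ removeAt A j)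
    expand = begin
      (A · adj A) i j
        ≡⟨ ·-Sum A (adj A) i j ⟩
      ∑′[ k < suc n ] (A i k * (sgn j * (sgn k * det (minor (removeAt A j) k))))
        ≈⟨ Sum-cong (λ k → solve 4 (λ a b c d → a ⊕ (b ⊕ (c ⊕ d)) ⊜ b ⊕ (c ⊕ (a ⊕ d))) refl _ _ _ _) ⟩
      ∑′[ k < suc n ] (sgn j * (sgn k * (A i k * det (minor (removeAt A j) k))))
        ≈⟨ *-distribˡ-Sum _ _ ⟨
      sgn j * ∑′[ k < suc n ] (sgn k * (A i k * det (minor (removeAt A j) k)))
        ≡⟨ ≡.cong (sgn j *_) (det-suc (A i ∷ removeAt A j)) ⟨
      sgn j * det (A i ∷ removeAt A j) ∎
    go : sgn j * det (A i ∷ removeAt A j) ≈ diag (λ _ → det A) i j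
    go with i ≟ j
    ... | yes ≡.refl = begin
      sgn i * det (A i ∷ removeAt A i)  ≈⟨ *-congˡ (det-front A i) ⟩
      sgn i * (sgn i * det A)           ≈⟨ *-assoc _ _ _ ⟨
      sgn i * sgn i * det A             ≈⟨ *-congʳ (sgn² (toℕ i)) ⟩
      1# * det A                        ≈⟨ *-identityˡ _ ⟩
      det A                             ∎
    ... | no i≢j = trans (*-congˡ (det-repeat (A i ∷ removeAt A j) (punchOut (i≢j ∘ ≡.sym))
                     (λ l → reflexive (≡.sym (≡.cong (λ (r : Vector Carrier (suc n)) → r l) (removeAt-punchOut A (i≢j ∘ ≡.sym)))))))
                   (zeroʳ _)

  det-scale : ∀ {n} q (A : Matrix (suc n)) → det ((λ j → q * A zero j) ∷ tail A) ≈ q * det A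
  det-scale {n} q A = begin
    det ((λ j → q * A zero j) ∷ tail A)
      ≡⟨ det-suc ((λ j → q * A zero j) ∷ tail A) ⟩
    ∑′[ j < suc n ] (sgn j * (q * A zero j * det (minor (tail A) j)))
      ≈⟨ Sum-cong (λ j → solve 4 (λ a b c d → a ⊕ ((b ⊕ c) ⊕ d) ⊜ b ⊕ (a ⊕ (c ⊕ d))) refl _ _ _ _) ⟩
    ∑′[ j < suc n ] (q * (sgn j * (A zero j * det (minor (tail A) j))))
      ≈⟨ *-distribˡ-Sum _ _ ⟨
    q * ∑′[ j < suc n ] (sgn j * (A zero j * det (minor (tail A) j)))
      ≡⟨ ≡.cong (q *_) (det-suc A) ⟨
    q * det A ∎

-- Matrices cut along the first row and the last column.

infixl 5 _∷ʳ_

_∷ʳ_ : ∀ {a} {A : Set a} {n} → Vector A n → A → Vector A (suc n)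
xs ∷ʳ x = insertAt xs (fromℕ _) x

∷ʳ-last : ∀ {a} {A : Set a} {n} (xs : Vector A n) x → last (xs ∷ʳ x) ≡ x
∷ʳ-last xs x = insertAt-lookup xs (fromℕ _) x

∷ʳ-init : ∀ {a} {A : Set a} {n} (xs : Vector A n) x i → init (xs ∷ʳ x) i ≡ xs i
∷ʳ-init {n = suc n} xs x zero    = ≡.refl
∷ʳ-init {n = suc n} xs x (suc i) = ∷ʳ-init (tail xs) x i

∀-last : ∀ {p n} {P : Fin (suc n) → Set p} → (∀ i → P (inject₁ i)) → P (fromℕ n) → ∀ i → P i
∀-last h l i with view i
... | ‵fromℕ     = l
... | ‵inject₁ j = h j

module Blocks {a ℓ} (R : CommutativeRing a ℓ) where
  open CommutativeRing R hiding (zero)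
  open MatrixProperties R
  open import Algebra.Properties.Semiring.Sum semiring
    using (sum; sum-cong-≋; sum-init-last; *-distribˡ-sum)
  open import Algebra.Properties.CommutativeSemigroup *-commutativeSemigroup using (x∙yz≈y∙xz)
  open import Relation.Binary.Reasoning.Setoid setoid

  infixl 7 _⊙_ _⊡_
  infix  7 _∙_
  infix  4 _≈ᵥ_
  infixl 6 _+ᵥ_
  infixr 7 _*ᵥ_

  _≈ᵥ_ : ∀ {n} → Vector Carrier n → Vector Carrier n → Set ℓ
  x ≈ᵥ y = ∀ i → x i ≈ y i

  _+ᵥ_ : ∀ {n} → Vector Carrier n → Vector Carrier n → Vector Carrier n
  (x +ᵥ y) i = x i + y i

  _*ᵥ_ : ∀ {n} → Carrier → Vector Carrier n → Vector Carrier n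
  (q *ᵥ y) i = q * y i

  0ᵥ : ∀ {n} → Vector Carrier n
  0ᵥ _ = 0#

  _∙_ : ∀ {n} → Vector Carrier n → Vector Carrier n → Carrier
  x ∙ y = sum (λ k → x k * y k)

  _⊙_ : ∀ {n} → Vector Carrier n → Matrix n → Vector Carrier n
  (x ⊙ A) j = x ∙ λ k → A k j

  _⊡_ : ∀ {n} → Matrix n → Vector Carrier n → Vector Carrier n
  (A ⊡ z) i = A i ∙ z

  ∙-cong : ∀ {n} {x x′ y y′ : Vector Carrier n} → x ≈ᵥ x′ → y ≈ᵥ y′ → x ∙ y ≈ x′ ∙ y′
  ∙-cong {n} e f = sum-cong-≋ {n} λ k → *-cong (e k) (f k)

  ⊙-cong : ∀ {n} {x x′ : Vector Carrier n} {A A′ : Matrix n} → x ≈ᵥ x′ → A ≋ A′ → x ⊙ A ≈ᵥ x′ ⊙ A′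
  ⊙-cong e f j = ∙-cong e (λ k → f k j)

  ∙-zeroˡ : ∀ {n} {x : Vector Carrier n} (y : Vector Carrier n) → x ≈ᵥ 0ᵥ → x ∙ y ≈ 0#
  ∙-zeroˡ {n} y e = sum-zero {n} λ k → trans (*-congʳ (e k)) (zeroˡ _)

  ∙-zeroʳ : ∀ {n} (x : Vector Carrier n) {y : Vector Carrier n} → y ≈ᵥ 0ᵥ → x ∙ y ≈ 0#
  ∙-zeroʳ {n} x e = sum-zero {n} λ k → trans (*-congˡ (e k)) (zeroʳ _)

  ∙-comm : ∀ {n} (x y : Vector Carrier n) → x ∙ y ≈ y ∙ x
  ∙-comm {n} x y = sum-cong-≋ {n} λ k → *-comm _ _

  *-∙ : ∀ {n} q (x y : Vector Carrier n) → (q *ᵥ x) ∙ y ≈ q * (x ∙ y)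
  *-∙ {n} q x y = trans (sum-cong-≋ {n} λ k → *-assoc _ _ _) (sym (*-distribˡ-sum {n} q _))

  ∙-* : ∀ {n} q (x y : Vector Carrier n) → x ∙ (q *ᵥ y) ≈ q * (x ∙ y)
  ∙-* {n} q x y = trans (sum-cong-≋ {n} λ k → x∙yz≈y∙xz _ _ _) (sym (*-distribˡ-sum {n} q _))

  ⊙-assoc : ∀ {n} (x : Vector Carrier n) (A B : Matrix n) → x ⊙ A ⊙ B ≈ᵥ x ⊙ (A · B)
  ⊙-assoc x A B j = ·-assoc (λ _ → x) A B j j

  ⊡-assoc : ∀ {n} (A B : Matrix n) (z : Vector Carrier n) → A · B ⊡ z ≈ᵥ A ⊡ (B ⊡ z)
  ⊡-assoc A B z i = ·-assoc A B (λ k _ → z k) i i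

  ⊙-identityʳ : ∀ {n} (x : Vector Carrier n) → x ⊙ 1ₘ ≈ᵥ x
  ⊙-identityʳ x j = ·-identityʳ (λ _ → x) j j

  ⊡-identityˡ : ∀ {n} (z : Vector Carrier n) → 1ₘ ⊡ z ≈ᵥ z
  ⊡-identityˡ z i = ·-identityˡ (λ k _ → z k) i i

  ∷ʳ-cong : ∀ {n} {x y : Vector Carrier n} {s t} → x ≈ᵥ y → s ≈ t → (x ∷ʳ s) ≈ᵥ (y ∷ʳ t)
  ∷ʳ-cong {zero}  e f zero    = f
  ∷ʳ-cong {suc n} e f zero    = e zero
  ∷ʳ-cong {suc n} e f (suc i) = ∷ʳ-cong (e ∘ suc) f i

  -- This cut fits the antidiagonal shape of the long element: a left unipotent factor is split as
  -- `block`, along its first row and column, a right one as `cap`, along its last row and column,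
  -- and both act on the lower left block `A` by a smaller unipotent matrix.
  quad : ∀ {n} → Vector Carrier n → Carrier → Matrix n → Vector Carrier n → Matrix (suc n)
  quad r s A v = (r ∷ʳ s) ∷ λ i → A i ∷ʳ v i

  cap : ∀ {n} → Matrix n → Vector Carrier n → Matrix (suc n)
  cap B z = (λ i → B i ∷ʳ z i) ∷ʳ (0ᵥ ∷ʳ 1#)

  bl ul : ∀ {n} → Matrix (suc n) → Matrix n
  bl A i = init (A (suc i))
  ul A i = init (A (inject₁ i))

  quad-cong : ∀ {n} {r r′ : Vector Carrier n} {s s′ A A′ v v′} → r ≈ᵥ r′ → s ≈ s′ → A ≋ A′ → v ≈ᵥ v′ →
              quad r s A v ≋ quad r′ s′ A′ v′
  quad-cong e f g h zero    = ∷ʳ-cong e f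
  quad-cong e f g h (suc i) = ∷ʳ-cong (g i) (h i)

  ∷ʳ-injective : ∀ {n} {x y : Vector Carrier n} {s t} → (x ∷ʳ s) ≈ᵥ (y ∷ʳ t) → x ≈ᵥ y × s ≈ t
  ∷ʳ-injective {x = x} {y} {s} {t} e =
    (λ i → trans (reflexive (≡.sym (∷ʳ-init x s i))) (trans (e (inject₁ i)) (reflexive (∷ʳ-init y t i)))) ,
    trans (reflexive (≡.sym (∷ʳ-last x s))) (trans (e (fromℕ _)) (reflexive (∷ʳ-last y t)))

  quad-injective : ∀ {n} {r r′ : Vector Carrier n} {s s′ A A′ v v′} → quad r s A v ≋ quad r′ s′ A′ v′ →
                   (r ≈ᵥ r′ × s ≈ s′) × (A ≋ A′ × v ≈ᵥ v′)
  quad-injective e = ∷ʳ-injective (e zero) ,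
    (λ i → proj₁ (∷ʳ-injective (e (suc i)))) , (λ i → proj₂ (∷ʳ-injective (e (suc i))))

  init-last : ∀ {n} (x : Vector Carrier (suc n)) → x ≈ᵥ (init x ∷ʳ last x)
  init-last x = ∀-last (λ i → reflexive (≡.sym (∷ʳ-init (init x) (last x) i))) (reflexive (≡.sym (∷ʳ-last (init x) (last x))))

  as-quad : ∀ {n} (A : Matrix (suc n)) →
            A ≋ quad (init (A zero)) (last (A zero)) (bl A) (λ i → last (A (suc i)))
  as-quad A zero    = init-last (A zero)
  as-quad A (suc i) = init-last (A (suc i))

  U-≋-block : ∀ {n} {u : Matrix (suc n)} → Unipotent u → u ≋ block (tail (u zero)) (lower-right u)
  U-≋-block (d , z) zero    zero    = d zero
  U-≋-block (d , z) zero    (suc j) = refl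
  U-≋-block (d , z) (suc i) zero    = z (suc i) zero (s≤s z≤n)
  U-≋-block (d , z) (suc i) (suc j) = refl

  cap-≋ : ∀ {n} {A : Matrix (suc n)} {B z} → (∀ i → A (inject₁ i) ≈ᵥ (B i ∷ʳ z i)) →
          A (fromℕ n) ≈ᵥ (0ᵥ ∷ʳ 1#) → A ≋ cap B z
  cap-≋ {n} {A} {B} {z} e f = ∀-last
    (λ i j → trans (e i j) (reflexive (≡.sym (≡.cong (λ (r : Vector Carrier (suc n)) → r j) (∷ʳ-init (λ i → B i ∷ʳ z i) _ i)))))
    (λ j → trans (f j) (reflexive (≡.sym (≡.cong (λ (r : Vector Carrier (suc n)) → r j) (∷ʳ-last (λ i → B i ∷ʳ z i) _)))))

  inject₁<fromℕ : ∀ {n} (i : Fin n) → inject₁ i < fromℕ n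
  inject₁<fromℕ {n} i = ≡.subst₂ ℕ._<_ (≡.sym (Fin.toℕ-inject₁ i)) (≡.sym (Fin.toℕ-fromℕ n)) (Fin.toℕ<n i)

  U-last : ∀ {n} {v : Matrix (suc n)} → Unipotent v → v (fromℕ n) ≈ᵥ (0ᵥ ∷ʳ 1#)
  U-last {n} {v} (d , z) j = trans (init-last (v (fromℕ n)) j)
    (∷ʳ-cong {y = 0ᵥ} (λ i → z (fromℕ n) (inject₁ i) (inject₁<fromℕ i)) (d (fromℕ n)) j)

  U-≋-cap : ∀ {n} {v : Matrix (suc n)} → Unipotent v → v ≋ cap (ul v) (λ i → last (v (inject₁ i)))
  U-≋-cap {v = v} hv = cap-≋ (λ i → init-last (v (inject₁ i))) (U-last hv)

  cap-init : ∀ {n} (B : Matrix n) z i j → cap B z (inject₁ i) j ≡ (B i ∷ʳ z i) j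
  cap-init B z i j = ≡.cong (λ r → r j) (∷ʳ-init (λ i → B i ∷ʳ z i) (0ᵥ ∷ʳ 1#) i)

  cap-last : ∀ {n} (B : Matrix n) z j → cap B z (fromℕ n) j ≡ (0ᵥ ∷ʳ 1#) j
  cap-last B z j = ≡.cong (λ r → r j) (∷ʳ-last (λ i → B i ∷ʳ z i) (0ᵥ ∷ʳ 1#))

  cap-ul : ∀ {n} (B : Matrix n) z i j → cap B z (inject₁ i) (inject₁ j) ≡ B i j
  cap-ul B z i j = ≡.trans (cap-init B z i (inject₁ j)) (∷ʳ-init (B i) (z i) j)

  cap-corner : ∀ {n} (B : Matrix n) z i → cap B z (inject₁ i) (fromℕ n) ≡ z i
  cap-corner B z i = ≡.trans (cap-init B z i (fromℕ _)) (∷ʳ-last (B i) (z i))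

  U-ul : ∀ {n} {A : Matrix (suc n)} → Unipotent A → Unipotent (ul A)
  U-ul (d , z) = (d ∘ inject₁) , λ i j j<i →
    z (inject₁ i) (inject₁ j) (≡.subst₂ ℕ._<_ (≡.sym (Fin.toℕ-inject₁ j)) (≡.sym (Fin.toℕ-inject₁ i)) j<i)

  U-cap : ∀ {n} {B : Matrix n} z → Unipotent B → Unipotent (cap B z)
  U-cap {n} {B} z (d , l) =
    ∀-last (λ i → trans (reflexive (cap-ul B z i i)) (d i))
           (reflexive (≡.trans (cap-last B z (fromℕ n)) (∷ʳ-last {n = n} 0ᵥ 1#))) ,
    ∀-last (λ i → ∀-last
              (λ j j<i → trans (reflexive (cap-ul B z i j))
                (l i j (≡.subst₂ ℕ._<_ (Fin.toℕ-inject₁ j) (Fin.toℕ-inject₁ i) j<i)))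
              (λ n<i → ⊥-elim (ℕ.<-asym n<i (inject₁<fromℕ i))))
           (∀-last
              (λ j _ → reflexive (≡.trans (cap-last B z (inject₁ j)) (∷ʳ-init {n = n} 0ᵥ 1# j)))
              (λ n<n → ⊥-elim (ℕ.<-irrefl ≡.refl n<n)))

  block-quad : ∀ {n} x (u : Matrix n) r s A v →
               block x u · quad r s A v ≋ quad (r +ᵥ x ⊙ A) (s + x ∙ v) (u · A) (u ⊡ v)
  block-quad {n} x u r s A v = λ where
      zero j    → trans (+-cong (*-identityˡ _) (columns x j)) (add j)
      (suc i) j → trans (+-congʳ (zeroˡ _)) (trans (+-identityˡ _) (columns (u i) j))
    where
    columns : ∀ (y : Vector Carrier n) j → y ∙ (λ k → (A k ∷ʳ v k) j) ≈ ((y ⊙ A) ∷ʳ (y ∙ v)) j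
    columns y = ∀-last
      (λ j → trans (∙-cong {x = y} (λ _ → refl) (λ k → reflexive (∷ʳ-init (A k) (v k) j)))
                   (reflexive (≡.sym (∷ʳ-init (y ⊙ A) _ j))))
      (trans (∙-cong {x = y} (λ _ → refl) (λ k → reflexive (∷ʳ-last (A k) (v k))))
             (reflexive (≡.sym (∷ʳ-last (y ⊙ A) _))))
    add : ∀ j → (r ∷ʳ s) j + ((x ⊙ A) ∷ʳ (x ∙ v)) j ≈ ((r +ᵥ x ⊙ A) ∷ʳ (s + x ∙ v)) j
    add = ∀-last
      (λ j → trans (+-cong (reflexive (∷ʳ-init r s j)) (reflexive (∷ʳ-init (x ⊙ A) _ j)))
                   (reflexive (≡.sym (∷ʳ-init (r +ᵥ x ⊙ A) _ j))))
      (trans (+-cong (reflexive (∷ʳ-last r s)) (reflexive (∷ʳ-last (x ⊙ A) _)))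
             (reflexive (≡.sym (∷ʳ-last (r +ᵥ x ⊙ A) _))))

  quad-cap : ∀ {n} r s A v (B : Matrix n) z →
             quad r s A v · cap B z ≋ quad (r ⊙ B) (r ∙ z + s) (A · B) (A ⊡ z +ᵥ v)
  quad-cap {n} r s A v B z = λ where
      zero    → row r s
      (suc i) → row (A i) (v i)
    where
    row : ∀ (y : Vector Carrier n) t j →
          sum (λ k → (y ∷ʳ t) k * cap B z k j) ≈ ((y ⊙ B) ∷ʳ (y ∙ z + t)) j
    row y t j = trans (sum-init-last {n} (λ k → (y ∷ʳ t) k * cap B z k j)) (trans (+-cong
        (∙-cong (λ k → reflexive (∷ʳ-init y t k)) (λ k → reflexive (cap-init B z k j)))
        (*-cong (reflexive (∷ʳ-last y t)) (reflexive (cap-last B z j)))) (column j))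
      where
      column : ∀ j → y ∙ (λ k → (B k ∷ʳ z k) j) + t * (0ᵥ ∷ʳ 1#) j ≈ ((y ⊙ B) ∷ʳ (y ∙ z + t)) j
      column = ∀-last
        (λ j → trans (+-cong (∙-cong {x = y} (λ _ → refl) (λ k → reflexive (∷ʳ-init (B k) (z k) j)))
                             (trans (*-congˡ (reflexive (∷ʳ-init {n = n} 0ᵥ 1# j))) (zeroʳ t)))
               (trans (+-identityʳ _) (reflexive (≡.sym (∷ʳ-init (y ⊙ B) _ j)))))
        (trans (+-cong (∙-cong {x = y} (λ _ → refl) (λ k → reflexive (∷ʳ-last (B k) (z k))))
                       (trans (*-congˡ (reflexive (∷ʳ-last {n = n} 0ᵥ 1#))) (*-identityʳ t)))
               (reflexive (≡.sym (∷ʳ-last (y ⊙ B) _))))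

  scale : ∀ {n} → Carrier → Matrix (suc n) → Matrix (suc n)
  scale q A = (q *ᵥ A zero) ∷ tail A

  scale-cong : ∀ {n} {p q} {A B : Matrix (suc n)} → p ≈ q → A ≋ B → scale p A ≋ scale q B
  scale-cong e f zero    j = *-cong e (f zero j)
  scale-cong e f (suc i) j = f (suc i) j

  scale-· : ∀ {n} q (A B : Matrix (suc n)) → scale q A · B ≋ scale q (A · B)
  scale-· q A B zero    j = *-∙ q (A zero) (λ k → B k j)
  scale-· q A B (suc i) j = refl

  -- Stands in for invertibility of `q`, which in general fails over ℤ.
  Cancellable : Carrier → Set _
  Cancellable q = ∀ {x y} → q * x ≈ q * y → x ≈ y

  scale-cancel : ∀ {n q} {A B : Matrix (suc n)} → Cancellable q → scale q A ≋ scale q B → A ≋ B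
  scale-cancel c e zero    j = c (e zero j)
  scale-cancel c e (suc i) j = e (suc i) j

  -- Conjugation by Diag (q , 1 , … , 1).
  conj : ∀ {n} → Carrier → Matrix (suc n) → Matrix (suc n)
  conj q u = block (q *ᵥ tail (u zero)) (lower-right u)

  U-conj : ∀ {n} q {u : Matrix (suc n)} → Unipotent u → Unipotent (conj q u)
  U-conj q hu = U-block _ (U-tail hu)

  -- With T = Diag (q , 1 , ... , 1) this is (T u T⁻¹) (T A) = T (u A), in a form that makes sense
  -- over ℤ as well.
  conj-scale : ∀ {n} q {u : Matrix (suc n)} → Unipotent u → ∀ A → conj q u · scale q A ≋ scale q (u · A)
  conj-scale {n} q {u} (d , z) A zero j = begin
    1# * (q * A zero j) + (q *ᵥ tail (u zero)) ∙ (λ k → A (suc k) j)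
      ≈⟨ +-cong (*-congʳ (sym (d zero))) (*-∙ q (tail (u zero)) (λ k → A (suc k) j)) ⟩
    u zero zero * (q * A zero j) + q * (tail (u zero) ∙ (λ k → A (suc k) j))
      ≈⟨ +-congʳ (x∙yz≈y∙xz _ _ _) ⟩
    q * (u zero zero * A zero j) + q * (tail (u zero) ∙ (λ k → A (suc k) j))
      ≈⟨ distribˡ _ _ _ ⟨
    q * (u · A) zero j ∎
  conj-scale q {u} (d , z) A (suc i) j =
    +-congʳ (trans (zeroˡ _) (sym (trans (*-congʳ (z (suc i) zero (s≤s z≤n))) (zeroˡ _))))

  conj-conj : ∀ {n} {p q} {u : Matrix (suc n)} → p * q ≈ 1# → Unipotent u → conj p (conj q u) ≋ u
  conj-conj e hu@(d , z) zero    zero    = sym (d zero)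
  conj-conj e hu@(d , z) zero    (suc j) = trans (sym (*-assoc _ _ _)) (trans (*-congʳ e) (*-identityˡ _))
  conj-conj e hu@(d , z) (suc i) zero    = sym (z (suc i) zero (s≤s z≤n))
  conj-conj e hu@(d , z) (suc i) (suc j) = refl

  -- Just above the diagonal only two terms of the matrix product survive. This additivity is what
  -- makes `ψ` multiplicative on unipotent matrices.
  superdiagonal-· : ∀ {n} {A B : Matrix (suc n)} → Unipotent A → Unipotent B → ∀ i →
                    (A · B) (inject₁ i) (suc i) ≈ A (inject₁ i) (suc i) + B (inject₁ i) (suc i)
  superdiagonal-· {suc n} {A} {B} (dA , zA) (dB , zB) zero = begin
    A zero zero * B zero (suc zero) + (A zero (suc zero) * B (suc zero) (suc zero) + sum {n} _)
      ≈⟨ +-cong (trans (*-congʳ (dA zero)) (*-identityˡ _)) (+-cong (trans (*-congˡ (dB (suc zero))) (*-identityʳ _))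
           (∙-zeroʳ (λ k → A zero (suc (suc k))) λ k → zB (suc (suc k)) (suc zero) (s≤s (s≤s z≤n)))) ⟩
    B zero (suc zero) + (A zero (suc zero) + 0#)
      ≈⟨ +-congˡ (+-identityʳ _) ⟩
    B zero (suc zero) + A zero (suc zero)
      ≈⟨ +-comm _ _ ⟩
    A zero (suc zero) + B zero (suc zero) ∎
  superdiagonal-· {suc n} {A} {B} hA@(dA , zA) hB (suc i) = begin
    (A · B) (suc (inject₁ i)) (suc (suc i))
      ≈⟨ trans (+-congʳ (trans (*-congʳ (zA (suc (inject₁ i)) zero (s≤s z≤n))) (zeroˡ _))) (+-identityˡ _) ⟩
    (lower-right A · lower-right B) (inject₁ i) (suc i)
      ≈⟨ superdiagonal-· (U-tail hA) (U-tail hB) i ⟩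
    A (suc (inject₁ i)) (suc (suc i)) + B (suc (inject₁ i)) (suc (suc i)) ∎

-- The normal form `P`: reduction, invariants and Bruhat decomposition.

module NormalForm {a ℓ} (R : CommutativeRing a ℓ) where
  open CommutativeRing R hiding (zero)
  open MatrixProperties R
  open Blocks R
  open import Algebra.Properties.Semiring.Sum semiring
    using (sum; sum-cong-≋; sum-init-last; *-distribˡ-sum; ∑-distrib-+)

  ∙-distribʳ : ∀ {n} (x y z : Vector Carrier n) → (x +ᵥ y) ∙ z ≈ x ∙ z + y ∙ z
  ∙-distribʳ {n} x y z = trans (sum-cong-≋ {n} λ k → distribʳ _ _ _) (∑-distrib-+ {n} _ _)

  ∙-assoc : ∀ {n} (x : Vector Carrier n) A z → (x ⊙ A) ∙ z ≈ x ∙ (A ⊡ z)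
  ∙-assoc {zero}  x A z = refl
  ∙-assoc {suc n} x A z = ⊙-assoc x A (λ k _ → z k) zero

  ∙-head : ∀ {n} (x : Vector Carrier (suc n)) t → x ∙ (t ∷ 0ᵥ) ≈ x zero * t
  ∙-head x t = trans (+-congˡ (∙-zeroʳ (tail x) (λ _ → refl))) (+-identityʳ _)

  ∙-last : ∀ {n} (x : Vector Carrier (suc n)) β → x ∙ (0ᵥ ∷ʳ β) ≈ last x * β
  ∙-last {n} x β = trans (sum-init-last {n} (λ k → x k * (0ᵥ ∷ʳ β) k))
    (trans (+-cong (∙-zeroʳ (init x) (λ k → reflexive (∷ʳ-init {n = n} 0ᵥ β k)))
                   (*-congˡ (reflexive (∷ʳ-last {n = n} 0ᵥ β))))
           (+-identityˡ _))

  ·-diag : ∀ {n} (A : Matrix n) d i j → (A · diag d) i j ≈ A i j * d j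
  ·-diag A d i j = trans
    (sum-single j (λ k k≢j → trans (*-congˡ (reflexive (diag-≢ d k≢j))) (zeroʳ _)))
    (*-congˡ (reflexive (diag-≡ d j)))

  scale-1ₘ : ∀ {n} q → scale q (1ₘ {suc n}) ≋ diag (q ∷ λ _ → 1#)
  scale-1ₘ q zero    zero    = *-identityʳ q
  scale-1ₘ q zero    (suc j) = zeroʳ q
  scale-1ₘ q (suc i) zero    = refl
  scale-1ₘ q (suc i) (suc j) with i ≟ j
  ... | yes _ = refl
  ... | no _  = refl

  column₀ : ∀ {n} → Matrix (suc n) → Vector Carrier (suc n)
  column₀ Z k = Z k zero

  quad-∼ : ∀ {n} {u w : Matrix n} → Unipotent u → Unipotent w → ∀ x z r s A v →
           quad r s A v ∼ quad ((r +ᵥ x ⊙ A) ⊙ w) ((r +ᵥ x ⊙ A) ∙ z + (s + x ∙ v))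
                               (u · A · w) (u · A ⊡ z +ᵥ u ⊡ v)
  quad-∼ {u = u} {w} hu hw x z r s A v = block x u , cap w z , U-block x hu , U-cap z hw ,
    ≋-trans (·-congʳ {B = cap w z} (block-quad x u r s A v)) (quad-cap _ _ _ _ w z)

  quad-∼₁ : ∀ {n} (x z r : Vector Carrier n) s A v →
            quad r s A v ∼ quad (r +ᵥ x ⊙ A) ((r +ᵥ x ⊙ A) ∙ z + (s + x ∙ v)) A (A ⊡ z +ᵥ v)
  quad-∼₁ x z r s A v with quad-∼ U-1 U-1 x z r s A v
  ... | _ , _ , hu , hw , e = _ , _ , hu , hw , ≋-trans e (quad-cong
    (⊙-identityʳ _) refl (≋-trans (·-identityʳ _) (·-identityˡ A))
    (λ i → +-cong (∙-cong {x = (1ₘ · A) i} (·-identityˡ A i) (λ _ → refl)) (⊡-identityˡ v i)))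

  P : ∀ {n} → Carrier → Carrier → Carrier → Carrier → Matrix (suc n) → Matrix (suc (suc n))
  P q a s t Γ = quad (a *ᵥ Γ zero) s (scale q Γ) (t ∷ 0ᵥ)

  P-cong : ∀ {n q a a′ s s′ t t′} {Γ Γ′ : Matrix (suc n)} → a ≈ a′ → s ≈ s′ → t ≈ t′ → Γ ≋ Γ′ →
           P q a s t Γ ≋ P q a′ s′ t′ Γ′
  P-cong e f g h = quad-cong (λ j → *-cong e (h zero j)) f (scale-cong refl h)
    λ { zero → g ; (suc _) → refl }

  -- The first column of Γ⁻¹ is orthogonal to all rows of Γ but the first, so pairing with it reads
  -- off the coefficient of Γ₀.
  ⊙-column₀ : ∀ {n} q a (x : Vector Carrier (suc n)) {Γ Z} → Γ · Z ≋ 1ₘ →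
              (a *ᵥ Γ zero +ᵥ x ⊙ scale q Γ) ∙ column₀ Z ≈ a + x zero * q
  ⊙-column₀ q a x {Γ} {Z} e = begin
    (a *ᵥ Γ zero +ᵥ x ⊙ scale q Γ) ∙ z
      ≈⟨ ∙-distribʳ (a *ᵥ Γ zero) (x ⊙ scale q Γ) z ⟩
    (a *ᵥ Γ zero) ∙ z + (x ⊙ scale q Γ) ∙ z
      ≈⟨ +-cong (trans (*-∙ a (Γ zero) z) (*-congˡ (e zero zero))) (∙-assoc x (scale q Γ) z) ⟩
    a * 1# + x ∙ (scale q Γ ⊡ z)
      ≈⟨ +-cong (*-identityʳ a) (∙-cong {x = x} {x′ = x} {y = scale q Γ ⊡ z} {y′ = q ∷ 0ᵥ} (λ _ → refl) λ where
           zero    → trans (*-∙ q (Γ zero) z) (trans (*-congˡ (e zero zero)) (*-identityʳ q))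
           (suc i) → e (suc i) zero) ⟩
    a + x ∙ (q ∷ 0ᵥ)
      ≈⟨ +-congˡ (∙-head x q) ⟩
    a + x zero * q ∎
    where
    open SetoidReasoning setoid
    z = column₀ Z

  -- Adding σ times the second row to the first changes `a`. Adding to the last column the
  -- combination of the others with coefficients τ Γ⁻¹ e₀ changes `t` and none of the zeros under
  -- it. The new corner is left open, as the relation between `q`, `a`, `s` and `t` recovers it
  -- later.
  shift : ∀ {n} {Γ Z : Matrix (suc n)} → Γ · Z ≋ 1ₘ → ∀ q a s t σ τ →
          ∃ λ s′ → P q a s t Γ ∼ P q (a + σ * q) s′ (t + τ * q) Γ
  shift {Γ = Γ} {Z} e q a s t σ τ with quad-∼₁ (σ ∷ 0ᵥ) (τ *ᵥ column₀ Z) (a *ᵥ Γ zero) s (scale q Γ) (t ∷ 0ᵥ)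
  ... | _ , _ , hu , hw , f = _ , _ , _ , hu , hw , ≋-trans f (quad-cong
    (λ j → trans (+-congˡ (trans (+-cong (sym (*-assoc _ _ _)) (∙-zeroˡ (λ k → Γ (suc k) j) (λ _ → refl))) (+-identityʳ _)))
                 (sym (distribʳ _ _ _)))
    refl ≋-refl
    (λ where
      zero    → trans (+-comm _ _) (+-congˡ (trans (∙-* τ (q *ᵥ Γ zero) (column₀ Z))
                  (*-congˡ (trans (*-∙ q (Γ zero) (column₀ Z)) (trans (*-congˡ (e zero zero)) (*-identityʳ q))))))
      (suc i) → trans (+-identityʳ _) (trans (∙-* τ (Γ (suc i)) (column₀ Z)) (trans (*-congˡ (e (suc i) zero)) (zeroʳ τ)))))

  -- Expand `r` in the rows of Γ. The rows Γᵢ with i ≥ 1 occur in the matrix and clear their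
  -- coefficients, but Γ₀ occurs only as q Γ₀, so its coefficient stays and becomes `a`. For the
  -- last column, solve Γ z = (0 , - v₁ , - v₂ , ...): this clears all entries but the first and
  -- leaves that one unchanged.
  normal-form : ∀ {n} {Γ Z : Matrix (suc n)} → Γ · Z ≋ 1ₘ → Z · Γ ≋ 1ₘ → ∀ q r s v →
                ∃₂ λ a s′ → quad r s (scale q Γ) v ∼ P q a s′ (v zero) Γ
  normal-form {n} {Γ} {Z} e e′ q r s v with quad-∼₁ x z r s (scale q Γ) v
    where
    x z : Vector Carrier (suc n)
    x = 0# ∷ λ i → - (r ⊙ Z) (suc i)
    z = Z ⊡ (0# ∷ λ i → - v (suc i))
  ... | _ , _ , hu , hw , f = (r ⊙ Z) zero , _ , _ , _ , hu , hw , ≋-trans f (quad-cong row refl ≋-refl column)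
    where
    open SetoidReasoning setoid
    ρ = r ⊙ Z
    y = 0# ∷ λ i → - v (suc i)
    row : ∀ j → r j + (0# * (q * Γ zero j) + (λ i → - ρ (suc i)) ∙ (λ k → Γ (suc k) j)) ≈ ρ zero * Γ zero j
    row j = begin
      r j + (0# * (q * Γ zero j) + (λ i → - ρ (suc i)) ∙ g)
        ≈⟨ +-cong (trans (sym (⊙-identityʳ r j)) (trans (⊙-cong {x = r} (λ _ → refl) (≋-sym e′) j) (sym (⊙-assoc r Z Γ j))))
                  (trans (+-congʳ (zeroˡ _)) (+-identityˡ _)) ⟩
      ρ zero * Γ zero j + tail ρ ∙ g + (λ i → - ρ (suc i)) ∙ g
        ≈⟨ +-assoc _ _ _ ⟩
      ρ zero * Γ zero j + (tail ρ ∙ g + (λ i → - ρ (suc i)) ∙ g)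
        ≈⟨ +-congˡ (trans (sym (∙-distribʳ (tail ρ) (λ i → - ρ (suc i)) g)) (∙-zeroˡ g (λ i → -‿inverseʳ _))) ⟩
      ρ zero * Γ zero j + 0#
        ≈⟨ +-identityʳ _ ⟩
      ρ zero * Γ zero j ∎
      where g = λ k → Γ (suc k) j
    solved : ∀ i → (Γ ⊡ (Z ⊡ y)) i ≈ y i
    solved i = trans (sym (⊡-assoc Γ Z y i)) (trans (∙-cong {y = y} (e i) (λ _ → refl)) (⊡-identityˡ y i))
    column : (scale q Γ ⊡ (Z ⊡ y) +ᵥ v) ≈ᵥ (v zero ∷ 0ᵥ)
    column zero    = trans (+-congʳ (trans (*-∙ q (Γ zero) (Z ⊡ y)) (trans (*-congˡ (solved zero)) (zeroʳ q)))) (+-identityˡ _)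
    column (suc i) = trans (+-congʳ (solved (suc i))) (-‿inverseˡ _)

  -- Let T = Diag (q , 1 , ... , 1). Comparison of the lower left blocks gives û T Γ₁ w = T Γ₂, so
  -- T⁻¹ û T and w carry Γ₁ to Γ₂. Pairing the first rows with the first column of w⁻¹ Γ₁⁻¹ then
  -- compares a₁ and a₂.
  P-injective : ∀ {n q} {Γ₁ Γ₂ Z : Matrix (suc n)} → Cancellable q → Γ₁ · Z ≋ 1ₘ → ∀ {a₁ s₁ t₁ a₂ s₂ t₂} →
                P q a₁ s₁ t₁ Γ₁ ∼ P q a₂ s₂ t₂ Γ₂ → Γ₁ ∼ Γ₂ × ∃ λ σ → a₁ + σ * q ≈ a₂
  P-injective {n} {q} {Γ₁} {Γ₂} {Z} cancel ΓZ {a₁} {s₁} {t₁} {a₂} {s₂} {t₂} (u , v , hu , hv , e) =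
    (ρ , w , U-ρ , hw , ≋-trans (·-assoc ρ Γ₁ w) (scale-cancel cancel conclusion)) , x zero , a-eq
    where
    x = tail (u zero)
    û = lower-right u
    w = ul v
    hw = U-ul hv
    Y = inv w · Z
    -- This is T⁻¹ û T, written as Γ₂ w⁻¹ Γ₁⁻¹ so that nothing has to be divided by `q`; that it is
    -- unipotent is seen afterwards from `scaled` by cancelling `q`.
    ρ = Γ₂ · Y
    S₁ = scale q Γ₁
    parts = quad-injective (≋-trans (≋-sym (≋-trans
      (·-cong (≋-trans (·-congʳ {B = P q a₁ s₁ t₁ Γ₁} (U-≋-block hu)) (block-quad x û (a₁ *ᵥ Γ₁ zero) s₁ S₁ (t₁ ∷ 0ᵥ))) (U-≋-cap hv))
      (quad-cap _ _ _ _ w (λ i → last (v (inject₁ i)))))) e)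
    E₁ : (a₁ *ᵥ Γ₁ zero +ᵥ x ⊙ S₁) ⊙ w ≈ᵥ a₂ *ᵥ Γ₂ zero
    E₁ = proj₁ (proj₁ parts)
    E₂ : û · S₁ · w ≋ scale q Γ₂
    E₂ = proj₁ (proj₂ parts)
    wY : w · Y ≋ Z
    wY = ≋-trans (≋-sym (·-assoc w (inv w) Z)) (≋-trans (·-congʳ {B = Z} (inverseʳ hw)) (·-identityˡ Z))
    module M = SetoidReasoning (≋-setoid (suc n))
    D = diag (q ∷ λ _ → 1#)
    scaled : scale q ρ ≋ û · D
    scaled = M.begin
      scale q ρ                  M.≈⟨ scale-· q Γ₂ Y ⟨
      scale q Γ₂ · Y             M.≈⟨ ·-congʳ {A = û · S₁ · w} {A′ = scale q Γ₂} {B = Y} E₂ ⟨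
      û · S₁ · w · Y             M.≈⟨ ·-assoc (û · S₁) w Y ⟩
      û · S₁ · (w · Y)           M.≈⟨ ·-congˡ {A = û · S₁} {B = w · Y} {B′ = Z} wY ⟩
      û · S₁ · Z                 M.≈⟨ ·-assoc û S₁ Z ⟩
      û · (S₁ · Z)               M.≈⟨ ·-congˡ {A = û} {B = S₁ · Z} {B′ = scale q (Γ₁ · Z)} (scale-· q Γ₁ Z) ⟩
      û · scale q (Γ₁ · Z)
        M.≈⟨ ·-congˡ {A = û} {B = scale q (Γ₁ · Z)} {B′ = scale q 1ₘ} (scale-cong refl ΓZ) ⟩
      û · scale q 1ₘ             M.≈⟨ ·-congˡ {A = û} {B = scale q 1ₘ} {B′ = D} (scale-1ₘ q) ⟩
      û · D                      M.∎
    entry : ∀ i j → scale q ρ i j ≈ û i j * (q ∷ λ _ → 1#) j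
    entry i j = trans (scaled i j) (·-diag û (q ∷ λ _ → 1#) i j)
    hû = U-tail hu
    U-ρ : Unipotent ρ
    U-ρ = diagonal , lower
      where
      diagonal : ∀ i → ρ i i ≈ 1#
      diagonal zero    = cancel (trans (entry zero zero) (trans (*-comm _ _) (*-congˡ (proj₁ hû zero))))
      diagonal (suc i) = trans (entry (suc i) (suc i)) (trans (*-identityʳ _) (proj₁ hû (suc i)))
      lower : ∀ i j → j < i → ρ i j ≈ 0#
      lower (suc i) zero    j<i = trans (entry (suc i) zero) (trans (*-congʳ (proj₂ hû (suc i) zero j<i)) (zeroˡ _))
      lower (suc i) (suc j) j<i = trans (entry (suc i) (suc j)) (trans (*-congʳ (proj₂ hû (suc i) (suc j) j<i)) (zeroˡ _))
    conclusion : scale q (ρ · (Γ₁ · w)) ≋ scale q Γ₂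
    conclusion = M.begin
      scale q (ρ · (Γ₁ · w))            M.≈⟨ scale-· q ρ (Γ₁ · w) ⟨
      scale q ρ · (Γ₁ · w)              M.≈⟨ ·-congʳ {A = scale q ρ} {A′ = û · scale q 1ₘ} {B = Γ₁ · w} (≋-trans scaled
                                              (·-congˡ {A = û} {B = D} {B′ = scale q 1ₘ} (≋-sym (scale-1ₘ q)))) ⟩
      û · scale q 1ₘ · (Γ₁ · w)         M.≈⟨ ·-assoc û (scale q 1ₘ) (Γ₁ · w) ⟩
      û · (scale q 1ₘ · (Γ₁ · w))
        M.≈⟨ ·-congˡ {A = û} {B = scale q 1ₘ · (Γ₁ · w)} {B′ = scale q (Γ₁ · w)} (≋-trans (scale-· q 1ₘ (Γ₁ · w)) (scale-cong refl (·-identityˡ (Γ₁ · w)))) ⟩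
      û · scale q (Γ₁ · w)
        M.≈⟨ ·-congˡ {A = û} {B = S₁ · w} {B′ = scale q (Γ₁ · w)} (scale-· q Γ₁ w) ⟨
      û · (S₁ · w)                      M.≈⟨ ·-assoc û S₁ w ⟨
      û · S₁ · w                        M.≈⟨ E₂ ⟩
      scale q Γ₂                        M.∎
    open SetoidReasoning setoid
    a-eq : a₁ + x zero * q ≈ a₂
    a-eq = begin
      a₁ + x zero * q
        ≈⟨ ⊙-column₀ q a₁ x {Γ₁} {Z} ΓZ ⟨
      (a₁ *ᵥ Γ₁ zero +ᵥ x ⊙ S₁) ∙ column₀ Z
        ≈⟨ ∙-cong {x = a₁ *ᵥ Γ₁ zero +ᵥ x ⊙ S₁} (λ _ → refl) (λ k → wY k zero) ⟨
      (a₁ *ᵥ Γ₁ zero +ᵥ x ⊙ S₁) ∙ (w ⊡ column₀ Y)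
        ≈⟨ ∙-assoc (a₁ *ᵥ Γ₁ zero +ᵥ x ⊙ S₁) w (column₀ Y) ⟨
      ((a₁ *ᵥ Γ₁ zero +ᵥ x ⊙ S₁) ⊙ w) ∙ column₀ Y
        ≈⟨ ∙-cong {y = column₀ Y} E₁ (λ _ → refl) ⟩
      (a₂ *ᵥ Γ₂ zero) ∙ column₀ Y
        ≈⟨ *-∙ a₂ (Γ₂ zero) (column₀ Y) ⟩
      a₂ * ρ zero zero
        ≈⟨ trans (*-congˡ (proj₁ U-ρ zero)) (*-identityʳ a₂) ⟩
      a₂ ∎

  module _ {n} (ε q q⁻ : Carrier) (W : Matrix (suc n)) where

    -- The matrix c w₀ of `D` when `W` is that of `init D`, `q` is the last entry of `D` and ε the
    -- sign in the corner; see `W-quad`.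
    Ŵ : Matrix (suc (suc n))
    Ŵ = quad 0ᵥ (ε * q⁻) (scale q W) 0ᵥ

    -- The second row of the lower part of P is q Γ₀, so a / q times it is a Γ₀; this fixes the
    -- first row of the left factor. On the right, the last column of `W` has only its top entry, so
    -- a single entry β suffices to produce (t , 0 , ... , 0). The corner comes out as (ε + a t) /
    -- q.
    bruhat-P : q * q⁻ ≈ 1# → ∀ {b₁ b₂ Γ} → Unipotent b₁ → Γ ≋ b₁ · (W · b₂) →
               (∀ i → last (W (suc i)) ≈ 0#) → ∀ {a s t β} →
               last (W zero) * β * q ≈ t → q * s ≈ ε + a * t →
               P q a s t Γ ≋ block ((a * q⁻) *ᵥ conj q b₁ zero) (conj q b₁) · (Ŵ · cap b₂ (0ᵥ ∷ʳ β))
    bruhat-P qq⁻ {b₁} {b₂} {Γ} h₁ Γ-eq W-last {a} {s} {t} {β} t-eq s-eq = ≋-sym (M.begin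
      block x u · (Ŵ · cap b₂ z)
        M.≈⟨ ·-congˡ {A = block x u} (quad-cap 0ᵥ (ε * q⁻) (scale q W) 0ᵥ b₂ z) ⟩
      block x u · quad (0ᵥ ⊙ b₂) (0ᵥ ∙ z + ε * q⁻) (scale q W · b₂) (scale q W ⊡ z +ᵥ 0ᵥ)
        M.≈⟨ ·-congˡ {A = block x u} (quad-cong {r = 0ᵥ ⊙ b₂} {r′ = 0ᵥ} {A = scale q W · b₂} (λ j → ∙-zeroˡ (λ k → b₂ k j) (λ _ → refl))
               (trans (+-congʳ (∙-zeroˡ z (λ _ → refl))) (+-identityˡ _)) (scale-· q W b₂) column) ⟩
      block x u · quad 0ᵥ (ε * q⁻) (scale q (W · b₂)) (t ∷ 0ᵥ)
        M.≈⟨ block-quad x u 0ᵥ (ε * q⁻) (scale q (W · b₂)) (t ∷ 0ᵥ) ⟩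
      quad (0ᵥ +ᵥ x ⊙ scale q (W · b₂)) (ε * q⁻ + x ∙ (t ∷ 0ᵥ)) (u · scale q (W · b₂)) (u ⊡ (t ∷ 0ᵥ))
        M.≈⟨ quad-cong row corner (≋-trans (conj-scale q h₁ (W · b₂)) (scale-cong refl (≋-sym Γ-eq)))
               (λ { zero → trans (∙-head (u zero) t) (*-identityˡ t)
                  ; (suc i) → trans (∙-head (u (suc i)) t) (zeroˡ t) }) ⟩
      P q a s t Γ M.∎)
      where
      module M = SetoidReasoning (≋-setoid (suc (suc n)))
      open SetoidReasoning setoid
      u = conj q b₁
      x = (a * q⁻) *ᵥ u zero
      z = 0ᵥ ∷ʳ β
      column : (scale q W ⊡ z +ᵥ 0ᵥ) ≈ᵥ (t ∷ 0ᵥ)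
      column zero = trans (+-identityʳ _) (trans (*-∙ q (W zero) z)
        (trans (*-congˡ (∙-last (W zero) β)) (trans (*-comm _ _) t-eq)))
      column (suc i) = trans (+-identityʳ _) (trans (∙-last (W (suc i)) β) (trans (*-congʳ (W-last i)) (zeroˡ β)))
      aq⁻q : a * q⁻ * q ≈ a
      aq⁻q = trans (*-assoc _ _ _) (trans (*-congˡ (trans (*-comm _ _) qq⁻)) (*-identityʳ a))
      row : (0ᵥ +ᵥ x ⊙ scale q (W · b₂)) ≈ᵥ (a *ᵥ Γ zero)
      row j = begin
        0# + (x ⊙ scale q (W · b₂)) j
          ≈⟨ trans (+-identityˡ _) (*-∙ (a * q⁻) (u zero) (λ k → scale q (W · b₂) k j)) ⟩
        a * q⁻ * (u · scale q (W · b₂)) zero j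
          ≈⟨ *-congˡ (conj-scale q h₁ (W · b₂) zero j) ⟩
        a * q⁻ * (q * (b₁ · (W · b₂)) zero j)
          ≈⟨ trans (sym (*-assoc _ _ _)) (*-cong aq⁻q (sym (Γ-eq zero j))) ⟩
        a * Γ zero j ∎
      corner : ε * q⁻ + x ∙ (t ∷ 0ᵥ) ≈ s
      corner = begin
        ε * q⁻ + x ∙ (t ∷ 0ᵥ)    ≈⟨ +-congˡ (trans (∙-head x t) (*-congʳ (*-identityʳ _))) ⟩
        ε * q⁻ + a * q⁻ * t
          ≈⟨ +-congˡ (trans (*-assoc _ _ _) (trans (*-congˡ (*-comm _ _)) (sym (*-assoc _ _ _)))) ⟩
        ε * q⁻ + a * t * q⁻      ≈⟨ distribʳ _ _ _ ⟨
        (ε + a * t) * q⁻         ≈⟨ *-congʳ s-eq ⟨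
        q * s * q⁻               ≈⟨ trans (*-congʳ (*-comm q s)) (*-assoc _ _ _) ⟩
        s * (q * q⁻)             ≈⟨ trans (*-congˡ qq⁻) (*-identityʳ s) ⟩
        s                        ∎

    -- The first row of b₁⁻¹ · P q a s t Γ is that of Ŵ · b₂, and the column
    -- Γ⁻¹ e₀ reads off the entry (b₁⁻¹)₀₁ = - a / q.
    P-relation : q * q⁻ ≈ 1# → ∀ {b₁ b₂ Γ Z a s t} → Unipotent b₁ → Unipotent b₂ → Γ · Z ≋ 1ₘ →
                 P q a s t Γ ≋ b₁ · (Ŵ · b₂) → q * s ≈ ε + a * t
    P-relation qq⁻ {b₁} {b₂} {Γ} {Z} {a} {s} {t} h₁ h₂ ΓZ e = begin
      q * s                          ≈⟨ +-identityʳ _ ⟨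
      q * s + 0#
        ≈⟨ +-congˡ (trans (sym (zeroˡ t)) (*-congʳ (trans (sym y-eq) (+-comm _ _)))) ⟩
      q * s + (y zero * q + a) * t
        ≈⟨ +-congˡ (trans (distribʳ _ _ _) (+-congʳ (trans (*-congʳ (*-comm _ _)) (*-assoc _ _ _)))) ⟩
      q * s + (q * (y zero * t) + a * t) ≈⟨ +-assoc _ _ _ ⟨
      q * s + q * (y zero * t) + a * t   ≈⟨ +-congʳ (distribˡ _ _ _) ⟨
      q * (s + y zero * t) + a * t   ≈⟨ +-congʳ (*-congˡ s-eq) ⟩
      q * (ε * q⁻) + a * t
        ≈⟨ +-congʳ (trans (*-comm _ _) (trans (*-assoc _ _ _) (trans (*-congˡ (trans (*-comm _ _) qq⁻)) (*-identityʳ ε)))) ⟩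
      ε + a * t                      ∎
      where
      open SetoidReasoning setoid
      B = inv b₁
      y = tail (B zero)
      Ŵb₂ : Ŵ · b₂ ≋ quad 0ᵥ (ε * q⁻) (scale q W · ul b₂) (scale q W ⊡ (λ i → last (b₂ (inject₁ i))) +ᵥ 0ᵥ)
      Ŵb₂ = ≋-trans (·-congˡ {A = Ŵ} (U-≋-cap h₂)) (≋-trans (quad-cap 0ᵥ (ε * q⁻) (scale q W) 0ᵥ (ul b₂) (λ i → last (b₂ (inject₁ i))))
        (quad-cong {r = 0ᵥ ⊙ ul b₂} {r′ = 0ᵥ} {A = scale q W · ul b₂} (λ j → ∙-zeroˡ (λ k → ul b₂ k j) (λ _ → refl))
          (trans (+-congʳ (∙-zeroˡ (λ i → last (b₂ (inject₁ i))) (λ _ → refl))) (+-identityˡ _)) ≋-refl (λ _ → refl)))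
      BP : B · P q a s t Γ ≋ Ŵ · b₂
      BP = ≋-trans (·-congˡ {A = B} e) (cancelˡ h₁ (Ŵ · b₂))
      parts = quad-injective (≋-trans (≋-sym (≋-trans (·-congʳ {B = P q a s t Γ} (U-≋-block (U-inv h₁)))
        (block-quad y (lower-right B) (a *ᵥ Γ zero) s (scale q Γ) (t ∷ 0ᵥ)))) (≋-trans BP Ŵb₂))
      y-eq : a + y zero * q ≈ 0#
      y-eq = trans (sym (⊙-column₀ q a y {Γ} {Z} ΓZ))
        (∙-zeroˡ (column₀ Z) (proj₁ (proj₁ parts)))
      s-eq : s + y zero * t ≈ ε * q⁻
      s-eq = trans (+-congˡ (sym (∙-head y t))) (proj₂ (proj₁ parts))

-- Inverses modulo q, and sums over lists of representatives.

last-∣-product : ∀ {n} (f : Vector ℕ (suc n)) → last f ∣ foldr ℕ._*_ 1 f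
last-∣-product {zero}  f = m∣m*n 1
last-∣-product {suc n} f = ∣n⇒∣m*n (f zero) (last-∣-product (tail f))

-- The quotient `κ` is kept because the matrices constructed later are explicit polynomials in it.
coprime-inverse : ∀ {m n} → Coprimality.Coprime m n →
                  ∃₂ λ m̄ κ → + m ℤ.* m̄ ≡ ℤ.1ℤ ℤ.+ κ ℤ.* + n
coprime-inverse {m} {n} coprime with Coprimality.coprime-Bézout coprime
... | Bézout.+- x y eq = + x , + y , (begin
  + m ℤ.* + x                ≡⟨ ℤ.*-comm (+ m) (+ x) ⟩
  + x ℤ.* + m                ≡⟨ ℤ.pos-* x m ⟨
  + (x ℕ.* m)                ≡⟨ ≡.cong +_ eq ⟨
  ℤ.1ℤ ℤ.+ + (y ℕ.* n)       ≡⟨ ≡.cong (ℤ._+_ ℤ.1ℤ) (ℤ.pos-* y n) ⟩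
  ℤ.1ℤ ℤ.+ + y ℤ.* + n       ∎)
  where open ≡.≡-Reasoning
... | Bézout.-+ x y eq = ℤ.- + x , ℤ.- + y , (begin
  + m ℤ.* ℤ.- + x                                 ≡⟨ rearrange₁ (+ m) (+ x) ⟩
  ℤ.1ℤ ℤ.- (ℤ.1ℤ ℤ.+ + x ℤ.* + m)                 ≡⟨ ≡.cong (λ z → ℤ.1ℤ ℤ.- (ℤ.1ℤ ℤ.+ z)) (ℤ.pos-* x m) ⟨
  ℤ.1ℤ ℤ.- + (1 ℕ.+ x ℕ.* m)                      ≡⟨ ≡.cong (λ z → ℤ.1ℤ ℤ.- + z) eq ⟩
  ℤ.1ℤ ℤ.- + (y ℕ.* n)                            ≡⟨ ≡.cong (ℤ._-_ ℤ.1ℤ) (ℤ.pos-* y n) ⟩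
  ℤ.1ℤ ℤ.- + y ℤ.* + n                            ≡⟨ rearrange₂ (+ y) (+ n) ⟩
  ℤ.1ℤ ℤ.+ ℤ.- + y ℤ.* + n                        ∎)
  where
  open ≡.≡-Reasoning
  rearrange₁ : ∀ m x → m ℤ.* ℤ.- x ≡ ℤ.1ℤ ℤ.- (ℤ.1ℤ ℤ.+ x ℤ.* m)
  rearrange₁ = ℤ.solve-∀
  rearrange₂ : ∀ y n → ℤ.1ℤ ℤ.- y ℤ.* n ≡ ℤ.1ℤ ℤ.+ ℤ.- y ℤ.* n
  rearrange₂ = ℤ.solve-∀

module _ {c ℓ} (S : Setoid c ℓ) where
  open Setoid S using (Carrier; _≈_) renaming (sym to ≈-sym; trans to ≈-trans)
  open Membership S using (_∈_)
  open Permutation S using (_↭_; ↭-refl; ↭-sym; ↭-trans; ↭-reflexive-≋; prep)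

  -- The head of `xs` occurs in `ys` up to equivalence and is moved to the front there. As neither
  -- list repeats a class, the two remainders again have the same members.
  Unique-⊆-↭ : ∀ {xs ys} → Unique S xs → Unique S ys →
               (∀ {z} → z ∈ xs → z ∈ ys) → (∀ {z} → z ∈ ys → z ∈ xs) → xs ↭ ys
  Unique-⊆-↭ {List.[]} {List.[]} _ _ _ _ = ↭-refl
  Unique-⊆-↭ {List.[]} {y List.∷ ys} _ _ _ ys⊆ with ys⊆ (here (Setoid.refl S))
  ... | ()
  Unique-⊆-↭ {x List.∷ xs} {ys} (x∉xs AllPairs.∷ xs!) ys! xs⊆ ys⊆ with Membershipₚ.∈-∃++ S (xs⊆ (here (Setoid.refl S)))
  ... | as , bs , w , x≈w , ys≋ = ↭-trans (prep x≈w (Unique-⊆-↭ xs! (proj₂ split) sub₁ sub₂)) (↭-sym ys↭)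
    where
    ys↭ : ys ↭ w List.∷ as List.++ bs
    ys↭ = ↭-trans (↭-reflexive-≋ ys≋) (Permutationₚ.↭-shift S as bs)
    split : ¬ (w ∈ as List.++ bs) × Unique S (as List.++ bs)
    split with Permutationₚ.Unique-resp-↭ S ys↭ ys!
    ... | w∉ AllPairs.∷ rest! = All¬⇒¬Any w∉ , rest!
    sub₁ : ∀ {z} → z ∈ xs → z ∈ as List.++ bs
    sub₁ z∈ with Permutationₚ.∈-resp-↭ S ys↭ (xs⊆ (there z∈))
    ... | here z≈w = ⊥-elim (All¬⇒¬Any x∉xs (Membershipₚ.∈-resp-≈ S (≈-trans z≈w (≈-sym x≈w)) z∈))
    ... | there z∈′ = z∈′
    sub₂ : ∀ {z} → z ∈ as List.++ bs → z ∈ xs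
    sub₂ z∈ with ys⊆ (Permutationₚ.∈-resp-↭ S (↭-sym ys↭) (there z∈))
    ... | here z≈x = ⊥-elim (proj₁ split (Membershipₚ.∈-resp-≈ S (≈-trans z≈x x≈w) z∈))
    ... | there z∈′ = z∈′

module ListSum {a ℓ} (R : CommutativeRing a ℓ) where
  open CommutativeRing R hiding (zero)
  open SetoidReasoning setoid

  Σ : ∀ {b} {A : Set b} → (A → Carrier) → List A → Carrier
  Σ w = List.foldr (λ x s → w x + s) 0#

  Σ-↭ : ∀ {c ℓ′} (S : Setoid c ℓ′) {w : Setoid.Carrier S → Carrier} →
        (∀ {x y} → Setoid._≈_ S x y → w x ≈ w y) →
        ∀ {xs ys} → Permutation._↭_ S xs ys → Σ w xs ≈ Σ w ys
  Σ-↭ S {w} w-cong {xs} {ys} p = begin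
    Σ w xs                                ≡⟨ List.foldr-map _+_ w 0# xs ⟨
    List.foldr _+_ 0# (List.map w xs)
      ≈⟨ Permutationₚ.foldr-commMonoid setoid +-isCommutativeMonoid (Permutationₚ.map⁺ S setoid w-cong p) ⟩
    List.foldr _+_ 0# (List.map w ys)     ≡⟨ List.foldr-map _+_ w 0# ys ⟩
    Σ w ys                                ∎

  Σ-++ : ∀ {b} {A : Set b} (w : A → Carrier) xs ys → Σ w (xs List.++ ys) ≈ Σ w xs + Σ w ys
  Σ-++ w List.[]       ys = sym (+-identityˡ _)
  Σ-++ w (x List.∷ xs) ys = trans (+-congˡ (Σ-++ w xs ys)) (sym (+-assoc _ _ _))

  Σ-cartesianProductWith : ∀ {b c d} {A : Set b} {B : Set c} {C : Set d} (f : A → B → C)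
    {w : C → Carrier} {g : A → Carrier} {h : B → Carrier} → (∀ x y → w (f x y) ≈ g x * h y) →
    ∀ xs ys → Σ w (cartesianProductWith f xs ys) ≈ Σ g xs * Σ h ys
  Σ-cartesianProductWith f e List.[] ys = sym (zeroˡ _)
  Σ-cartesianProductWith f {w} {g} {h} e (x List.∷ xs) ys = begin
    Σ w (List.map (f x) ys List.++ cartesianProductWith f xs ys)
      ≈⟨ Σ-++ w (List.map (f x) ys) _ ⟩
    Σ w (List.map (f x) ys) + Σ w (cartesianProductWith f xs ys)
      ≈⟨ +-cong (row ys) (Σ-cartesianProductWith f e xs ys) ⟩
    g x * Σ h ys + Σ g xs * Σ h ys
      ≈⟨ distribʳ _ _ _ ⟨
    (g x + Σ g xs) * Σ h ys ∎
    where
    row : ∀ ys → Σ w (List.map (f x) ys) ≈ g x * Σ h ys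
    row List.[]       = sym (zeroʳ _)
    row (y List.∷ ys) = trans (+-cong (e x y) (row ys)) (sym (distribˡ _ _ _))

-- The matrix c w₀ of `D` in terms of that of `init D`.

module Factors where
  open import Data.Bool.Base using (if_then_else_)
  open import Data.Rational.Base as ℚ using (ℚ; 0ℚ; 1ℚ; _*_; _+_; -_)
  import Data.Rational.Properties as ℚ
  import Data.Rational.Solver as ℚ
  open ≡ using (refl; sym; trans; cong; cong₂; module ≡-Reasoning)

  opposite-inject₁ : ∀ {n} (j : Fin n) → opposite (inject₁ j) ≡ suc (opposite j)
  opposite-inject₁ zero    = refl
  opposite-inject₁ (suc j) = cong inject₁ (opposite-inject₁ j)

  opposite-fromℕ : ∀ n → opposite (fromℕ n) ≡ zero
  opposite-fromℕ n = opposite-involutive {suc n} zero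

  module ℤB = Blocks ℤ.+-*-commutativeRing
  module ℤN = NormalForm ℤ.+-*-commutativeRing
  module ℚB = Blocks ℚ.+-*-commutativeRing
  module ℚN = NormalForm ℚ.+-*-commutativeRing

  open Finiteness using (ι-injective; ι-*; ι-+; /-*; module Enumeration)
  open Lattice ℚ.+-*-commutativeRing Finiteness.ℚ-fractions using (φₘ; φ-U; φ-·; φ-sgn; φ-det)

  module Bruhat {r} (D : Vector ℕ⁺ r) where
    open Enumeration D public using (W; off; ω⁻; ω-inv; t; F; W-on; w₀-off; w₀-on; regroup; to; from)
    open Lattice.Antidiagonal ℚ.+-*-commutativeRing Finiteness.ℚ-fractions W off ω⁻ ω-inv public
      using (ω; W·; Cell; bruhat-unique; translate; cancel-ω)

  value-ι : ℕ⁺ → ℚ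
  value-ι m = ι (+ value m)

  1÷-inverse : ∀ m → value-ι m * (1⁺ ÷ m) ≡ 1ℚ
  1÷-inverse m = trans (ℚ.*-comm (value-ι m) (1⁺ ÷ m)) (/-* (+ 1) (value m) ⦃ ℕ⁺.nonZero m ⦄)

  ÷-* : ∀ m n → m ÷ n ≡ value-ι m * (1⁺ ÷ n)
  ÷-* m n = begin
    m ÷ n                                ≡⟨ ℚ.*-identityʳ (m ÷ n) ⟨
    m ÷ n * 1ℚ                           ≡⟨ cong (m ÷ n *_) (1÷-inverse n) ⟨
    m ÷ n * (value-ι n * (1⁺ ÷ n))       ≡⟨ ℚ.*-assoc (m ÷ n) (value-ι n) (1⁺ ÷ n) ⟨
    m ÷ n * value-ι n * (1⁺ ÷ n)         ≡⟨ cong (_* (1⁺ ÷ n)) (/-* (+ value m) (value n) ⦃ ℕ⁺.nonZero n ⦄) ⟩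
    value-ι m * (1⁺ ÷ n)                 ∎
    where open ≡-Reasoning

  extend-inject₁ : ∀ {r} (D : Vector ℕ⁺ r) i → extend D (inject₁ i) ≡ (1⁺ ∷ D) i
  extend-inject₁ D zero    = refl
  extend-inject₁ D (suc i) = ∷ʳ-init D 1⁺ i

  t-zero : ∀ {r} (D : Vector ℕ⁺ r) → Bruhat.t D zero ≡ 1⁺ ÷ (1⁺ ∷ D) (fromℕ r)
  t-zero {r} D = cong₂ _÷_ (∷ʳ-last D 1⁺) (extend-inject₁ D (fromℕ r))

  t-suc : ∀ {r} (D : Vector ℕ⁺ r) i → Bruhat.t D (suc i) ≡ D (opposite i) ÷ (1⁺ ∷ D) (inject₁ (opposite i))
  t-suc D i = cong₂ _÷_ (∷ʳ-init D 1⁺ (opposite i)) (extend-inject₁ D (inject₁ (opposite i)))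

  ∷-inject₁ : ∀ {k} (D : Vector ℕ⁺ (suc k)) i → (1⁺ ∷ D) (inject₁ i) ≡ (1⁺ ∷ init D) i
  ∷-inject₁ D zero    = refl
  ∷-inject₁ D (suc i) = refl

  -- The sign in `w₀` depends on the column alone, and deleting the first row and the last column
  -- does not renumber the columns.
  w₀-suc : ∀ {n} (i j : Fin n) → w₀ (suc i) (inject₁ j) ≡ w₀ i j
  w₀-suc i j rewrite opposite-inject₁ j =
    cong (λ s → if does (i ≟ opposite j) then s else 0ℚ) (cong ((- 1ℚ) ^_) (Fin.toℕ-inject₁ j))
    where
    open import Algebra.Properties.Semiring.Exp (CommutativeRing.semiring ℚ.+-*-commutativeRing) using (_^_)

  module _ {k} (D : Vector ℕ⁺ (suc k)) where
    private
      module B = Bruhat D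
      module B′ = Bruhat (init D)
      q = value-ι (last D)
      q⁻ = 1⁺ ÷ last D

    -- Dropping Dₙ₋₁ turns the second diagonal entry Dₙ₋₁/Dₙ₋₂ of `c` into 1/Dₙ₋₂ and keeps the
    -- later ones, hence a factor `q` in the first row only.
    t-suc-init : ∀ i j → B.t (suc i) * w₀ i j ≡ ℚB.scale q B′.W i j
    t-suc-init zero j = begin
      B.t (suc zero) * w₀ zero j
        ≡⟨ cong (_* w₀ zero j) (trans (t-suc D zero) (cong (last D ÷_) (∷-inject₁ D (fromℕ k)))) ⟩
      last D ÷ (1⁺ ∷ init D) (fromℕ k) * w₀ zero j
        ≡⟨ cong (_* w₀ zero j) (trans (÷-* (last D) ((1⁺ ∷ init D) (fromℕ k))) (cong (q *_) (sym (t-zero (init D))))) ⟩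
      q * B′.t zero * w₀ zero j                               ≡⟨ ℚ.*-assoc q _ _ ⟩
      q * (B′.t zero * w₀ zero j)                             ≡⟨ cong (q *_) (ℚP.diag-· B′.t w₀ zero j) ⟨
      q * B′.W zero j                                         ∎
      where open ≡-Reasoning
    t-suc-init (suc i) j = begin
      B.t (suc (suc i)) * w₀ (suc i) j
        ≡⟨ cong (_* w₀ (suc i) j) (trans (t-suc D (suc i)) (trans (cong (D (opposite (suc i)) ÷_) (∷-inject₁ D (inject₁ (opposite i)))) (sym (t-suc (init D) i)))) ⟩
      B′.t (suc i) * w₀ (suc i) j      ≡⟨ ℚP.diag-· B′.t w₀ (suc i) j ⟨
      B′.W (suc i) j                   ∎
      where open ≡-Reasoning

    W-quad : B.W ℚP.≋ ℚN.Ŵ (ℚP.sgn (fromℕ (suc k))) q q⁻ B′.W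
    W-quad zero = ∀-last
      (λ j → trans (ℚP.diag-· B.t w₀ zero (inject₁ j)) (trans (cong (B.t zero *_) (B.w₀-off zero (inject₁ j)
               (λ e → Fin.0≢1+n (trans e (opposite-inject₁ j))))) (trans (ℚ.*-zeroʳ (B.t zero)) (sym (∷ʳ-init {n = suc k} ℚB.0ᵥ _ j)))))
      (trans (ℚP.diag-· B.t w₀ zero (fromℕ (suc k))) (trans (cong₂ _*_ (t-zero D) (B.w₀-on zero))
        (trans (ℚ.*-comm q⁻ _) (sym (∷ʳ-last {n = suc k} ℚB.0ᵥ _)))))
    W-quad (suc i) = ∀-last
      (λ j → trans (ℚP.diag-· B.t w₀ (suc i) (inject₁ j)) (trans (cong (B.t (suc i) *_) (w₀-suc i j))
        (trans (t-suc-init i j) (sym (∷ʳ-init (ℚB.scale q B′.W i) 0ℚ j)))))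
      (trans (ℚP.diag-· B.t w₀ (suc i) (fromℕ (suc k))) (trans (cong (B.t (suc i) *_) (B.w₀-off (suc i) (fromℕ (suc k))
               (λ e → Fin.0≢1+n (trans (sym (opposite-fromℕ (suc k))) (sym e))))) (trans (ℚ.*-zeroʳ (B.t (suc i)))
               (sym (∷ʳ-last (ℚB.scale q B′.W i) 0ℚ)))))

  module _ {k} (D : Vector ℕ⁺ k) where
    private
      module B = Bruhat D

    -- The last column of c w₀ consists of ± 1 over the last entry of `D`, followed by zeros. The
    -- prefix `1⁺` supplies D₀ = 1 when `D` is empty, the case from which the cells of SL(2,ℤ) are
    -- built.
    W-last : ∀ i → last (B.W i) * value-ι ((1⁺ ∷ D) (fromℕ k)) ≡ (ℚP.sgn (fromℕ k) ∷ ℚB.0ᵥ) i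
    W-last zero    = trans (cong (λ d → B.W zero (fromℕ k) * value-ι d) (sym (extend-inject₁ D (fromℕ k))))
      (trans (B.W-on zero) (trans (cong (λ d → ℚP.sgn (fromℕ k) * value-ι d) (∷ʳ-last D 1⁺)) (ℚ.*-identityʳ _)))
    W-last (suc i) = trans (cong (_* value-ι ((1⁺ ∷ D) (fromℕ k))) (B.off (suc i) (fromℕ k)
        (λ e → Fin.0≢1+n (trans (sym (opposite-fromℕ k)) (sym e))))) (ℚ.*-zeroˡ (value-ι ((1⁺ ∷ D) (fromℕ k))))

  φ-∷ʳ : ∀ {n} (x : Vector ℤ n) s j → ι ((x ∷ʳ s) j) ≡ ((λ i → ι (x i)) ∷ʳ ι s) j
  φ-∷ʳ x s = ∀-last
    (λ j → trans (cong ι (∷ʳ-init x s j)) (sym (∷ʳ-init (λ i → ι (x i)) (ι s) j)))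
    (trans (cong ι (∷ʳ-last x s)) (sym (∷ʳ-last (λ i → ι (x i)) (ι s))))

  φ-scale : ∀ {n} q (A : ℤM.Matrix (suc n)) → φₘ (ℤB.scale q A) ℚP.≋ ℚB.scale (ι q) (φₘ A)
  φ-scale q A zero    j = ι-* q (A zero j)
  φ-scale q A (suc i) j = refl

  φ-P : ∀ {n} q a s t (Γ : ℤM.Matrix (suc n)) →
        φₘ (ℤN.P q a s t Γ) ℚP.≋ ℚN.P (ι q) (ι a) (ι s) (ι t) (φₘ Γ)
  φ-P q a s t Γ zero    j = trans (φ-∷ʳ (a ℤB.*ᵥ Γ zero) s j) (ℚB.∷ʳ-cong (λ i → ι-* a (Γ zero i)) refl j)
  φ-P q a s t Γ (suc i) j = trans (φ-∷ʳ (ℤB.scale q Γ i) ((t ∷ ℤB.0ᵥ) i) j)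
    (ℚB.∷ʳ-cong (φ-scale q Γ i) (last-column i) j)
    where
    last-column : ∀ i → ι ((t ∷ ℤB.0ᵥ) i) ≡ (ι t ∷ ℚB.0ᵥ) i
    last-column zero    = refl
    last-column (suc i) = refl

  φ-diag : ∀ {n} (d : Vector ℤ n) → φₘ (ℤP.diag d) ℚP.≋ ℚP.diag (λ i → ι (d i))
  φ-diag d i j with i ≟ j
  ... | yes _ = refl
  ... | no _  = refl

  φ-⊙ : ∀ {n} (x : Vector ℤ n) (A : ℤM.Matrix n) j → ι ((x ℤB.⊙ A) j) ≡ ((λ i → ι (x i)) ℚB.⊙ φₘ A) j
  φ-⊙ x A j = φ-· (λ _ → x) A j j

  *-cancel : ∀ (m : ℕ⁺) {x y} → x * value-ι m ≡ y * value-ι m → x ≡ y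
  *-cancel m {x} {y} e = begin
    x                              ≡⟨ undo x ⟨
    x * value-ι m * (1⁺ ÷ m)       ≡⟨ cong (_* (1⁺ ÷ m)) e ⟩
    y * value-ι m * (1⁺ ÷ m)       ≡⟨ undo y ⟩
    y                              ∎
    where
    open ≡-Reasoning
    undo : ∀ z → z * value-ι m * (1⁺ ÷ m) ≡ z
    undo z = trans (ℚ.*-assoc z _ _) (trans (cong (z *_) (1÷-inverse m)) (ℚ.*-identityʳ z))

  module Invertible {r} {D : Vector ℕ⁺ r} (x : C D) where
    open Bruhat D
    open Cell (to x)
    private module adj = Adjugate ℤ.+-*-commutativeRing

    -- Cofactors give an inverse of γ on the right. That it is also one on the left follows from
    -- this cancellation, where b₁ and b₂ are inverted as unipotent matrices and c w₀ is cancelled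
    -- row by row.
    γ-cancel : ∀ A B → φₘ γ ℚP.· A ℚP.≋ φₘ γ ℚP.· B → A ℚP.≋ B
    γ-cancel A B e = M.begin
      A                          M.≈⟨ ℚP.cancelˡ unip₂ A ⟨
      ℚP.inv b₂ ℚP.· (b₂ ℚP.· A)
        M.≈⟨ ℚP.·-congˡ {A = ℚP.inv b₂} (λ i j → ≡.subst (λ i → (b₂ ℚP.· A) i j ≡ (b₂ ℚP.· B) i j) (opposite-involutive i) (rows (opposite i) j)) ⟩
      ℚP.inv b₂ ℚP.· (b₂ ℚP.· B) M.≈⟨ ℚP.cancelˡ unip₂ B ⟩
      B                          M.∎
      where
      module M = SetoidReasoning (ℚP.≋-setoid (suc r))
      regrouped : ∀ X → ℚP.inv b₁ ℚP.· (φₘ γ ℚP.· X) ℚP.≋ W ℚP.· (b₂ ℚP.· X)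
      regrouped X = M.begin
        ℚP.inv b₁ ℚP.· (φₘ γ ℚP.· X)
          M.≈⟨ ℚP.·-congˡ {A = ℚP.inv b₁} (ℚP.·-congʳ {B = X} bruhat) ⟩
        ℚP.inv b₁ ℚP.· (b₁ ℚP.· (W ℚP.· b₂) ℚP.· X)
          M.≈⟨ ℚP.·-congˡ {A = ℚP.inv b₁} (ℚP.·-assoc b₁ (W ℚP.· b₂) X) ⟩
        ℚP.inv b₁ ℚP.· (b₁ ℚP.· (W ℚP.· b₂ ℚP.· X))  M.≈⟨ ℚP.cancelˡ unip₁ (W ℚP.· b₂ ℚP.· X) ⟩
        W ℚP.· b₂ ℚP.· X                             M.≈⟨ ℚP.·-assoc W b₂ X ⟩
        W ℚP.· (b₂ ℚP.· X)                           M.∎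
      rows : ∀ i j → (b₂ ℚP.· A) (opposite i) j ≡ (b₂ ℚP.· B) (opposite i) j
      rows i j = cancel-ω i (trans (ℚ.*-comm _ (ω i)) (trans (sym (W· (b₂ ℚP.· A) i j)) (trans
        (ℚP.≋-trans (ℚP.≋-sym (regrouped A)) (ℚP.≋-trans (ℚP.·-congˡ {A = ℚP.inv b₁} e) (regrouped B)) i j)
        (trans (W· (b₂ ℚP.· B) i j) (ℚ.*-comm (ω i) _)))))

    abstract
      γ⁻¹ : ℤM.Matrix (suc r)
      γ⁻¹ = adj.adj γ

      γ-inverseʳ : γ ℤP.· γ⁻¹ ℤP.≋ ℤP.1ₘ
      γ-inverseʳ i j = trans (adj.·-adj γ i j) (cong (λ d → ℤP.diag (λ _ → d) i j) (C.det-γ x))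

      γ-inverseˡ : γ⁻¹ ℤP.· γ ℤP.≋ ℤP.1ₘ
      γ-inverseˡ i j = ι-injective (γ-cancel (φₘ (γ⁻¹ ℤP.· γ)) (φₘ ℤP.1ₘ) (λ i j →
        trans (sym (φ-· γ (γ⁻¹ ℤP.· γ) i j)) (trans (cong ι (M i j)) (φ-· γ ℤP.1ₘ i j))) i j)
        where
        M : γ ℤP.· (γ⁻¹ ℤP.· γ) ℤP.≋ γ ℤP.· ℤP.1ₘ
        M = ℤP.≋-trans (ℤP.≋-sym (ℤP.·-assoc γ γ⁻¹ γ)) (ℤP.≋-trans (ℤP.·-congʳ {B = γ} γ-inverseʳ)
          (ℤP.≋-trans (ℤP.·-identityˡ γ) (ℤP.≋-sym (ℤP.·-identityʳ γ))))

  -- Elements of the cell of `D` in normal form.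

  module _ {k} (D : Vector ℕ⁺ (suc k)) where
    private
      module B = Bruhat D
      module B′ = Bruhat (init D)
      q⁺ = last D
      δ⁺ = (1⁺ ∷ init D) (fromℕ k)
      q = + value q⁺
      δ = + value δ⁺
      q⁻ = 1⁺ ÷ q⁺
      ε = ℤP.sgn (fromℕ k)
      ε′ = ℤP.sgn (fromℕ (suc k))

    assemble : ∀ (y : C (init D)) a s t → q ℤ.* s ≡ ε′ ℤ.+ a ℤ.* t → C D
    assemble y a s t e = B.from record
      { γ = ℤN.P q a s t y.γ
      ; b₁ = ℚP.block ((ι a * q⁻) ℚB.*ᵥ b₁ zero) b₁
      ; b₂ = ℚB.cap y.b₂ (ℚB.0ᵥ ∷ʳ β)
      ; unip₁ = ℚP.U-block _ (ℚB.U-conj (ι q) y.unip₁)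
      ; unip₂ = ℚB.U-cap _ y.unip₂
      ; bruhat = ℚP.≋-trans (φ-P q a s t y.γ) (ℚP.≋-trans
          (ℚN.bruhat-P (ℚP.sgn (fromℕ (suc k))) (ι q) q⁻ B′.W (1÷-inverse q⁺) {y.b₁} {y.b₂} {φₘ y.γ} y.unip₁ y.bruhat
            (λ i → *-cancel δ⁺ (trans (W-last (init D) (suc i)) (sym (ℚ.*-zeroˡ (ι δ))))) {ι a} {ι s} {ι t} {β} t-eq s-eq)
          (ℚP.·-congˡ {A = ℚP.block ((ι a * q⁻) ℚB.*ᵥ b₁ zero) b₁} (ℚP.·-congʳ {B = ℚB.cap y.b₂ (ℚB.0ᵥ ∷ʳ β)} (ℚP.≋-sym (W-quad D))))) }
      where
      module y = B′.Cell (B′.to y)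
      b₁ = ℚB.conj (ι q) y.b₁
      -- The upper right entry of c w₀ for `init D` is ε / δ, so this is the solution of (ε / δ) β q
      -- = t.
      β = ι (ε ℤ.* δ ℤ.* t) * q⁻
      w = B′.W zero (fromℕ k)
      t-eq : w * β * ι q ≡ ι t
      t-eq = begin
        w * (ι (ε ℤ.* δ ℤ.* t) * q⁻) * ι q
          ≡⟨ cong (λ x → w * (x * q⁻) * ι q) (trans (ι-* (ε ℤ.* δ) t) (cong (_* ι t) (ι-* ε δ))) ⟩
        w * (ι ε * ι δ * ι t * q⁻) * ι q
          ≡⟨ ℚ.+-*-Solver.solve 6 (λ w e d t p q → w :* (e :* d :* t :* p) :* q := (w :* d) :* e :* t :* (q :* p)) refl w (ι ε) (ι δ) (ι t) q⁻ (ι q) ⟩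
        w * ι δ * ι ε * ι t * (ι q * q⁻)
          ≡⟨ cong₂ (λ x y → x * ι ε * ι t * y) (W-last (init D) zero) (1÷-inverse q⁺) ⟩
        ℚP.sgn (fromℕ k) * ι ε * ι t * 1ℚ      ≡⟨ ℚ.*-identityʳ _ ⟩
        ℚP.sgn (fromℕ k) * ι ε * ι t           ≡⟨ cong (λ x → ℚP.sgn (fromℕ k) * x * ι t) (φ-sgn (fromℕ k)) ⟩
        ℚP.sgn (fromℕ k) * ℚP.sgn (fromℕ k) * ι t ≡⟨ cong (_* ι t) (ℚP.sgn² (toℕ (fromℕ k))) ⟩
        1ℚ * ι t                               ≡⟨ ℚ.*-identityˡ (ι t) ⟩
        ι t                                    ∎
        where
        open ≡-Reasoning
        open ℚ.+-*-Solver
      s-eq : ι q * ι s ≡ ℚP.sgn (fromℕ (suc k)) + ι a * ι t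
      s-eq = trans (sym (ι-* q s)) (trans (cong ι e) (trans (ι-+ ε′ (a ℤ.* t))
        (cong₂ _+_ (φ-sgn (fromℕ (suc k))) (ι-* a t))))

    -- Translating the Bruhat factors of `z` by `u` and `v` gives Bruhat factors of the normal form
    -- over ℚ; the relation read off from them descends to ℤ.
    P-relation : ∀ (z : C D) (y : C (init D)) a s t → C.γ z ℤM.∼ ℤN.P q a s t (C.γ y) →
                 q ℤ.* s ≡ ε′ ℤ.+ a ℤ.* t
    P-relation z y a s t (u , v , hu , hv , e) = ι-injective (trans (ι-* q s) (trans
      (ℚN.P-relation (ℚP.sgn (fromℕ (suc k))) (ι q) q⁻ B′.W (1÷-inverse q⁺) {Γ = φₘ (C.γ y)} {Z = φₘ γ⁻¹} {ι a} {ι s} {ι t}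
        (ℚP.U-· (φ-U hu) z.unip₁) (ℚP.U-· z.unip₂ (φ-U hv))
        (ℚP.≋-trans (ℚP.≋-sym (φ-· (C.γ y) γ⁻¹)) (ℚP.≋-trans (λ i j → cong ι (γ-inverseʳ i j)) (φ-diag (λ _ → ℤ.1ℤ))))
        (ℚP.≋-trans (ℚP.≋-sym (φ-P q a s t (C.γ y))) (ℚP.≋-trans (λ i j → cong ι (sym (e i j)))
          (ℚP.≋-trans (B.translate u v (B.to z))
            (ℚP.·-congˡ {A = φₘ u ℚP.· z.b₁} (ℚP.·-congʳ {B = z.b₂ ℚP.· φₘ v} (W-quad D)))))))
      (sym (trans (ι-+ ε′ (a ℤ.* t)) (cong₂ _+_ (φ-sgn (fromℕ (suc k))) (ι-* a t))))))
      where
      module z = B.Cell (B.to z)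
      open Invertible y

  -- Left of the antidiagonal all entries vanish. On it the signs of `w₀` cancel those of the
  -- expansion and the quotients Dⱼ₊₁/Dⱼ telescope to 1.
  det-WB : ∀ {r} (D : Vector ℕ⁺ r) {B} → ℚP.Unipotent B → ℚP.det (Bruhat.W D ℚP.· B) ≡ 1ℚ
  det-WB {r} D {B} hB = begin
    ℚP.det (W ℚP.· B)             ≡⟨ ℚ.*-identityʳ _ ⟨
    ℚP.det (W ℚP.· B) * F zero    ≡⟨ ℚP.det-anti (W ℚP.· B) F zeros diagonal ⟩
    F (fromℕ (suc r))             ≡⟨ cong value-ι (∷ʳ-last D 1⁺) ⟩
    1ℚ                            ∎
    where
    open ≡-Reasoning
    open Bruhat D
    zeros : ∀ i j → j < opposite i → (W ℚP.· B) i j ≡ 0ℚ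
    zeros i j j< = trans (W· B i j) (trans (cong (ω i *_) (proj₂ hB (opposite i) j j<)) (ℚ.*-zeroʳ (ω i)))
    diagonal : ∀ i → (W ℚP.· B) i (opposite i) * F (inject₁ (opposite i)) ≡ ℚP.sgn (opposite i) * F (suc (opposite i))
    diagonal i = trans (cong (_* F (inject₁ (opposite i)))
      (trans (W· B i (opposite i)) (trans (cong (ω i *_) (proj₁ hB (opposite i))) (ℚ.*-identityʳ (ω i))))) (W-on i)

  -- From an element of the cell of `D` to one of the cell of `init D`.

  module Decompose {k} (D : Vector ℕ⁺ (suc k)) (z : C D) where
    private
      module B = Bruhat D
      module B′ = Bruhat (init D)
      module z = B.Cell (B.to z)
      module adj = Adjugate ℤ.+-*-commutativeRing
      module M = SetoidReasoning (ℚP.≋-setoid (suc k))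
      q⁺ = last D
      δ⁺ = (1⁺ ∷ init D) (fromℕ k)
      q = + value q⁺
      δ = + value δ⁺
      q⁻ = 1⁺ ÷ q⁺
      ε = ℤP.sgn (fromℕ k)
      open ≡-Reasoning
      open ℚB using (_∙_; _⊙_; _*ᵥ_; 0ᵥ)
      open ℚP using (_·_; _≋_)

      A : ℤM.Matrix (suc k)
      A = ℤB.bl z.γ

      u w : ℚM.Matrix (suc k)
      u = ℚP.lower-right z.b₁
      w = ℚB.ul z.b₂

      hu : ℚP.Unipotent u
      hu = ℚP.U-tail z.unip₁

      hw : ℚP.Unipotent w
      hw = ℚB.U-ul z.unip₂

      -- Deleting the first row and the last column respects the Bruhat decomposition, because b₁
      -- and b₂ are triangular: `A` gets the c w₀ of `init D` with its first row multiplied by `q`.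
      A-bruhat : φₘ A ≋ u · ℚB.scale (ι q) (B′.W · w)
      A-bruhat = ℚP.≋-trans (proj₁ (proj₂ (ℚB.quad-injective parts)))
                            (ℚP.·-congˡ {A = u} (ℚB.scale-· (ι q) B′.W w))
        where
        s = ℚP.sgn (fromℕ (suc k)) * q⁻
        y = λ i → last (z.b₂ (inject₁ i))
        x = tail (z.b₁ zero)
        S = ℚB.scale (ι q) B′.W
        Wb : B.W · z.b₂ ≋ ℚB.quad (0ᵥ ⊙ w) (0ᵥ ∙ y + s) (S · w) (S ℚB.⊡ y ℚB.+ᵥ 0ᵥ)
        Wb = ℚP.≋-trans (ℚP.·-cong (W-quad D) (ℚB.U-≋-cap z.unip₂)) (ℚB.quad-cap 0ᵥ s S 0ᵥ w y)
        parts = ℚP.≋-trans (ℚP.≋-sym (ℚB.as-quad (φₘ z.γ))) (ℚP.≋-trans z.bruhat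
          (ℚP.≋-trans (ℚP.·-cong (ℚB.U-≋-block z.unip₁) Wb)
            (ℚB.block-quad x u (0ᵥ ⊙ w) (0ᵥ ∙ y + s) (S · w) (S ℚB.⊡ y ℚB.+ᵥ 0ᵥ))))

      det-A : ℤP.det A ≡ q
      det-A = ι-injective (begin
        ι (ℤP.det A)                              ≡⟨ φ-det A ⟩
        ℚP.det (φₘ A)                             ≡⟨ ℚP.det-cong A-bruhat ⟩
        ℚP.det (u · ℚB.scale (ι q) (B′.W · w))    ≡⟨ ℚP.det-U· hu (ℚB.scale (ι q) (B′.W · w)) ⟩
        ℚP.det (ℚB.scale (ι q) (B′.W · w))
          ≡⟨ Adjugate.det-scale ℚ.+-*-commutativeRing (ι q) (B′.W · w) ⟩
        ι q * ℚP.det (B′.W · w)                   ≡⟨ cong (ι q *_) (det-WB (init D) hw) ⟩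
        ι q * 1ℚ                                  ≡⟨ ℚ.*-identityʳ (ι q) ⟩
        ι q                                       ∎)

      p : Vector ℚ (suc k)
      p = ℚP.inv u zero

      ω₀ = B′.W zero (fromℕ k)

      e : Vector ℚ (suc k)
      e = 0ᵥ ∷ʳ 1ℚ

      -- The first row of u⁻¹ isolates the first row of `B′.W · w` times `q`. In that row only the
      -- last row of `w`, a unit vector, contributes.
      pA : ∀ j → (p ⊙ φₘ A) j ≡ ι q * (ω₀ * e j)
      pA j = begin
        (p ⊙ φₘ A) j                                            ≡⟨ ℚP.·-congˡ {A = ℚP.inv u} A-bruhat zero j ⟩
        (ℚP.inv u · (u · ℚB.scale (ι q) (B′.W · w))) zero j
          ≡⟨ ℚP.cancelˡ hu (ℚB.scale (ι q) (B′.W · w)) zero j ⟩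
        ι q * (B′.W · w) zero j
          ≡⟨ cong (ι q *_) (trans (B′.W· w zero j) (cong (ω₀ *_) (ℚB.U-last hw j))) ⟩
        ι q * (ω₀ * e j)                                        ∎

      A* : ℤM.Matrix (suc k)
      A* = adj.adj A

      -- The cofactors supply an integral vector which by `ζ-p` is δ times the first row of u⁻¹. Its
      -- first entry is therefore δ, a unit modulo `q`, while by `ζ-A` it annihilates `A` modulo
      -- `q`.
      ζ : Vector ℤ (suc k)
      ζ j = ε ℤ.* A* (fromℕ k) j

      p-adj : ∀ j → p j ≡ ω₀ * ι (A* (fromℕ k) j)
      p-adj j = *-cancel q⁺ (begin
        p j * ι q                                ≡⟨ cong (λ d → p j * ι d) det-A ⟨
        p j * ι (ℤP.det A)                       ≡⟨ ℚN.·-diag (λ _ → p) (λ _ → ι (ℤP.det A)) j j ⟨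
        (p ⊙ ℚP.diag (λ _ → ι (ℤP.det A))) j     ≡⟨ ℚB.⊙-cong {x = p} (λ _ → refl) AA* j ⟨
        (p ⊙ (φₘ A · φₘ A*)) j                   ≡⟨ ℚB.⊙-assoc p (φₘ A) (φₘ A*) j ⟨
        (p ⊙ φₘ A ⊙ φₘ A*) j
          ≡⟨ ℚB.⊙-cong {x′ = (ι q * ω₀) *ᵥ e} {A = φₘ A*} (λ j → trans (pA j) (sym (ℚ.*-assoc (ι q) ω₀ (e j)))) (λ _ _ → refl) j ⟩
        (((ι q * ω₀) *ᵥ e) ⊙ φₘ A*) j            ≡⟨ ℚB.*-∙ (ι q * ω₀) e (λ i → φₘ A* i j) ⟩
        ι q * ω₀ * (e ∙ λ i → φₘ A* i j)
          ≡⟨ cong (ι q * ω₀ *_) (trans (ℚB.∙-comm e (λ i → φₘ A* i j)) (trans (ℚN.∙-last (λ i → φₘ A* i j) 1ℚ) (ℚ.*-identityʳ (φₘ A* (fromℕ k) j)))) ⟩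
        ι q * ω₀ * φₘ A* (fromℕ k) j             ≡⟨ trans (ℚ.*-assoc (ι q) ω₀ _) (ℚ.*-comm (ι q) _) ⟩
        ω₀ * φₘ A* (fromℕ k) j * ι q             ∎)
        where
        AA* : φₘ A · φₘ A* ≋ ℚP.diag (λ _ → ι (ℤP.det A))
        AA* i j = trans (sym (φ-· A A* i j)) (trans (cong ι (adj.·-adj A i j)) (φ-diag (λ _ → ℤP.det A) i j))

      ζ-p : ∀ j → ι (ζ j) ≡ ι δ * p j
      ζ-p j = begin
        ι (ε ℤ.* A* (fromℕ k) j)                 ≡⟨ ι-* ε _ ⟩
        ι ε * φₘ A* (fromℕ k) j
          ≡⟨ cong (_* φₘ A* (fromℕ k) j) (trans (φ-sgn (fromℕ k)) (sym (W-last (init D) zero))) ⟩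
        ω₀ * ι δ * φₘ A* (fromℕ k) j
          ≡⟨ trans (cong (_* φₘ A* (fromℕ k) j) (ℚ.*-comm ω₀ (ι δ))) (ℚ.*-assoc (ι δ) ω₀ _) ⟩
        ι δ * (ω₀ * φₘ A* (fromℕ k) j)           ≡⟨ cong (ι δ *_) (p-adj j) ⟨
        ι δ * p j                                ∎

      ζ-head : ζ zero ≡ δ
      ζ-head = ι-injective (trans (ζ-p zero) (trans (cong (ι δ *_) (proj₁ (ℚP.U-inv hu) zero)) (ℚ.*-identityʳ (ι δ))))

      ζ-A : ∀ j → (ζ ℤB.⊙ A) j ≡ ε ℤ.* q ℤ.* (ℤB.0ᵥ ∷ʳ ℤ.1ℤ) j
      ζ-A j = ι-injective (begin
        ι ((ζ ℤB.⊙ A) j)                         ≡⟨ φ-⊙ ζ A j ⟩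
        ((λ j → ι (ζ j)) ⊙ φₘ A) j
          ≡⟨ ℚB.⊙-cong {x′ = ι δ *ᵥ p} {A = φₘ A} ζ-p (λ _ _ → refl) j ⟩
        ((ι δ *ᵥ p) ⊙ φₘ A) j                    ≡⟨ ℚB.*-∙ (ι δ) p (λ i → φₘ A i j) ⟩
        ι δ * (p ⊙ φₘ A) j                       ≡⟨ cong (ι δ *_) (pA j) ⟩
        ι δ * (ι q * (ω₀ * e j))
          ≡⟨ ℚ.+-*-Solver.solve 4 (λ d q w e → d :* (q :* (w :* e)) := (w :* d) :* q :* e) refl (ι δ) (ι q) ω₀ (e j) ⟩
        ω₀ * ι δ * ι q * e j
          ≡⟨ cong (λ x → x * ι q * e j) (trans (W-last (init D) zero) (sym (φ-sgn (fromℕ k)))) ⟩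
        ι ε * ι q * e j                          ≡⟨ cong₂ _*_ (ι-* ε q) (φ-∷ʳ {n = k} ℤB.0ᵥ ℤ.1ℤ j) ⟨
        ι (ε ℤ.* q) * ι ((ℤB.0ᵥ ∷ʳ ℤ.1ℤ) j)      ≡⟨ ι-* (ε ℤ.* q) _ ⟨
        ι (ε ℤ.* q ℤ.* (ℤB.0ᵥ ∷ʳ ℤ.1ℤ) j)        ∎)
        where open ℚ.+-*-Solver using (_:*_; _:=_)

    module _ (δ̄ κ : ℤ) (bézout : δ ℤ.* δ̄ ≡ ℤ.1ℤ ℤ.+ κ ℤ.* q) where
      private
        -- Multiplying the relation ζ A ≡ 0 by δ̄ makes its first coefficient congruent to 1, so
        -- adding the rows δ̄ ζᵢ Aᵢ to A₀ gives a row divisible by `q`.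
        U : ℤM.Matrix (suc k)
        U = ℤP.block (δ̄ ℤB.*ᵥ tail ζ) ℤP.1ₘ

        hU : ℤP.Unipotent U
        hU = ℤP.U-block _ ℤP.U-1

        -- The first row is the quotient by `q`: A₀ + δ̄ (ε q e - δ A₀) = q (δ̄ ε e - κ A₀), where e
        -- is the last unit vector and δ δ̄ = 1 + κ q.
        Γ : ℤM.Matrix (suc k)
        Γ = (λ j → δ̄ ℤ.* ε ℤ.* (ℤB.0ᵥ ∷ʳ ℤ.1ℤ) j ℤ.- κ ℤ.* A zero j) ∷ tail A

        UA : U ℤP.· A ℤP.≋ ℤB.scale q Γ
        UA zero j = trans (cong₂ ℤ._+_ (ℤ.*-identityˡ (A zero j)) (ℤB.*-∙ δ̄ (tail ζ) (λ i → A (suc i) j)))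
          (combine δ δ̄ κ q ε (A zero j) _ _ bézout
            (trans (cong (λ d → d ℤ.* A zero j ℤ.+ tail ζ ℤB.∙ (λ i → A (suc i) j)) (sym ζ-head)) (ζ-A j)))
          where
          combine : ∀ δ δ̄ κ q ε a s e → δ ℤ.* δ̄ ≡ ℤ.1ℤ ℤ.+ κ ℤ.* q → δ ℤ.* a ℤ.+ s ≡ ε ℤ.* q ℤ.* e →
                    a ℤ.+ δ̄ ℤ.* s ≡ q ℤ.* (δ̄ ℤ.* ε ℤ.* e ℤ.- κ ℤ.* a)
          combine δ δ̄ κ q ε a s e h₁ h₂ = begin
            a ℤ.+ δ̄ ℤ.* s
              ≡⟨ step₁ δ δ̄ a s ⟩
            a ℤ.+ δ̄ ℤ.* (δ ℤ.* a ℤ.+ s) ℤ.- δ ℤ.* δ̄ ℤ.* a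
              ≡⟨ cong₂ (λ x y → a ℤ.+ δ̄ ℤ.* x ℤ.- y ℤ.* a) h₂ h₁ ⟩
            a ℤ.+ δ̄ ℤ.* (ε ℤ.* q ℤ.* e) ℤ.- (ℤ.1ℤ ℤ.+ κ ℤ.* q) ℤ.* a
              ≡⟨ step₂ δ̄ κ q ε a e ⟩
            q ℤ.* (δ̄ ℤ.* ε ℤ.* e ℤ.- κ ℤ.* a) ∎
            where
            step₁ : ∀ δ δ̄ a s → a ℤ.+ δ̄ ℤ.* s ≡ a ℤ.+ δ̄ ℤ.* (δ ℤ.* a ℤ.+ s) ℤ.- δ ℤ.* δ̄ ℤ.* a
            step₁ = ℤ.solve-∀
            step₂ : ∀ δ̄ κ q ε a e → a ℤ.+ δ̄ ℤ.* (ε ℤ.* q ℤ.* e) ℤ.- (ℤ.1ℤ ℤ.+ κ ℤ.* q) ℤ.* a ≡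
                                    q ℤ.* (δ̄ ℤ.* ε ℤ.* e ℤ.- κ ℤ.* a)
            step₂ = ℤ.solve-∀
        UA (suc i) j = trans (cong (ℤ._+ (ℤP.1ₘ ℤB.⊡ λ i → A (suc i) j) i) (ℤ.*-zeroˡ (A zero j)))
          (trans (ℤ.+-identityˡ _) (ℤB.⊡-identityˡ (λ i → A (suc i) j) i))

      private
        cell′ : ∃ λ (y : C (init D)) → ∃ λ U → ℤP.Unipotent U × U ℤP.· ℤB.bl (C.γ z) ℤP.≋ ℤB.scale q (C.γ y)
        cell′ = B′.from record
          -- Conjugation of û by Diag (1/q , 1 , ... , 1) moves the factor `q` of the first row to
          -- the left of û, where it cancels against the one in `scale q Γ`.
          { γ = Γ ; b₁ = ℚB.conj q⁻ û ; b₂ = w ; unip₁ = ℚB.U-conj q⁻ hû ; unip₂ = hw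
          ; bruhat = ℚB.scale-cancel {q = ι q} {A = φₘ Γ} {B = b · (B′.W · w)} (λ {x} {y} e → *-cancel q⁺ (trans (ℚ.*-comm x (ι q)) (trans e (ℚ.*-comm (ι q) y)))) scaled
          } , U , hU , UA
          where
          û = φₘ U · u
          hû = ℚP.U-· (φ-U hU) hu
          b = ℚB.conj q⁻ û
          scaled : ℚB.scale (ι q) (φₘ Γ) ≋ ℚB.scale (ι q) (b · (B′.W · w))
          scaled = M.begin
            ℚB.scale (ι q) (φₘ Γ)                           M.≈⟨ φ-scale q Γ ⟨
            φₘ (ℤB.scale q Γ)                               M.≈⟨ (λ i j → cong ι (UA i j)) ⟨
            φₘ (U ℤP.· A)                                   M.≈⟨ φ-· U A ⟩
            φₘ U · φₘ A                                     M.≈⟨ ℚP.·-congˡ {A = φₘ U} A-bruhat ⟩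
            φₘ U · (u · ℚB.scale (ι q) (B′.W · w))
              M.≈⟨ ℚP.·-assoc (φₘ U) u (ℚB.scale (ι q) (B′.W · w)) ⟨
            û · ℚB.scale (ι q) (B′.W · w)
              M.≈⟨ ℚP.·-congʳ {B = ℚB.scale (ι q) (B′.W · w)} (ℚB.conj-conj {p = ι q} {q = q⁻} {u = û} (1÷-inverse q⁺) hû) ⟨
            ℚB.conj (ι q) b · ℚB.scale (ι q) (B′.W · w)
              M.≈⟨ ℚB.conj-scale (ι q) (ℚB.U-conj q⁻ hû) (B′.W · w) ⟩
            ℚB.scale (ι q) (b · (B′.W · w))                 M.∎

      abstract
        cell : ∃ λ (y : C (init D)) → ∃ λ U → ℤP.Unipotent U × U ℤP.· ℤB.bl (C.γ z) ℤP.≋ ℤB.scale q (C.γ y)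
        cell = cell′

  open DoubleCosets ℤ.+-*-commutativeRing using (∼-trans)

  ≋⇒∼ : ∀ {n} {A B : ℤM.Matrix n} → A ℤP.≋ B → A ℤM.∼ B
  ≋⇒∼ {A = A} e = ℤP.1ₘ , ℤP.1ₘ , ℤP.U-1 , ℤP.U-1 ,
    ℤP.≋-trans (ℤP.·-identityʳ (ℤP.1ₘ ℤP.· A)) (ℤP.≋-trans (ℤP.·-identityˡ A) e)

  -- The classes in SL(2,ℤ) with lower left entry q.

  module TwoByTwo (m : ℕ⁺) where
    private
      q = + value m
      D : Vector ℕ⁺ 1
      D = m ∷ []
      module B = Bruhat D
      1′ : Fin 2
      1′ = suc zero

    module Entries (x : C D) where
      open B.Cell (B.to x)
      open ≡-Reasoning
      private
        ω₁ : B.ω 1′ ≡ ι q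
        ω₁ = trans (sym (ℚ.*-identityʳ (B.ω 1′))) (trans (B.W-on 1′) (ℚ.*-identityˡ (ι q)))

        V : ℚM.Matrix 2
        V = B.W ℚP.· b₂

        V₁ : ∀ j → V 1′ j ≡ ι q * b₂ zero j
        V₁ j = trans (B.W· b₂ 1′ j) (cong (_* b₂ zero j) ω₁)

        V₀ : V zero zero ≡ 0ℚ
        V₀ = trans (B.W· b₂ zero zero) (trans (cong (B.ω zero *_) (proj₂ unip₂ 1′ zero (s≤s z≤n))) (ℚ.*-zeroʳ (B.ω zero)))

        γ₁ : ∀ j → ι (γ 1′ j) ≡ ι q * b₂ zero j
        γ₁ j = begin
          ι (γ 1′ j)                                  ≡⟨ bruhat 1′ j ⟩
          b₁ 1′ zero * V zero j + (b₁ 1′ 1′ * V 1′ j + 0ℚ)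
            ≡⟨ cong₂ (λ x y → x * V zero j + (y * V 1′ j + 0ℚ)) (proj₂ unip₁ 1′ zero (s≤s z≤n)) (proj₁ unip₁ 1′) ⟩
          0ℚ * V zero j + (1ℚ * V 1′ j + 0ℚ)
            ≡⟨ ℚ.+-*-Solver.solve 2 (λ x y → con 0ℚ :* x :+ (con 1ℚ :* y :+ con 0ℚ) := y) refl (V zero j) (V 1′ j) ⟩
          V 1′ j                                      ≡⟨ V₁ j ⟩
          ι q * b₂ zero j                             ∎
          where open ℚ.+-*-Solver

      lower-left : γ 1′ zero ≡ q
      lower-left = ι-injective (trans (γ₁ zero) (trans (cong (ι q *_) (proj₁ unip₂ zero)) (ℚ.*-identityʳ (ι q))))

      b₂-entry : b₂ zero 1′ * ι q ≡ ι (γ 1′ 1′)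
      b₂-entry = trans (ℚ.*-comm (b₂ zero 1′) (ι q)) (sym (γ₁ 1′))

      b₁-entry : b₁ zero 1′ * ι q ≡ ι (γ zero zero)
      b₁-entry = sym (begin
        ι (γ zero zero)                             ≡⟨ bruhat zero zero ⟩
        b₁ zero zero * V zero zero + (b₁ zero 1′ * V 1′ zero + 0ℚ)
          ≡⟨ cong₂ (λ x y → b₁ zero zero * x + (b₁ zero 1′ * y + 0ℚ)) V₀ (trans (V₁ zero) (cong (ι q *_) (proj₁ unip₂ zero))) ⟩
        b₁ zero zero * 0ℚ + (b₁ zero 1′ * (ι q * 1ℚ) + 0ℚ)
          ≡⟨ ℚ.+-*-Solver.solve 3 (λ x y q → x :* con 0ℚ :+ (y :* (q :* con 1ℚ) :+ con 0ℚ) := y :* q) refl (b₁ zero zero) (b₁ zero 1′) (ι q) ⟩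
        b₁ zero 1′ * ι q                            ∎)
        where open ℚ.+-*-Solver

      determinant : γ zero zero ℤ.* γ 1′ 1′ ≡ ℤ.1ℤ ℤ.+ γ zero 1′ ℤ.* q
      determinant = trans (expand (γ zero zero) (γ zero 1′) (γ 1′ zero) (γ 1′ 1′))
        (cong₂ (λ x y → x ℤ.+ γ zero 1′ ℤ.* y) (C.det-γ x) lower-left)
        where
        expand : ∀ a b c d → a ℤ.* d ≡ ℤ.1ℤ ℤ.* (a ℤ.* (ℤ.1ℤ ℤ.* (d ℤ.* ℤ.1ℤ) ℤ.+ + 0)) ℤ.+
          (ℤ.-1ℤ ℤ.* ℤ.1ℤ ℤ.* (b ℤ.* (ℤ.1ℤ ℤ.* (c ℤ.* ℤ.1ℤ) ℤ.+ + 0)) ℤ.+ + 0) ℤ.+ b ℤ.* c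
        expand = ℤ.solve-∀

    ∼-entries : ∀ {x y : C D} → C.γ x ℤM.∼ C.γ y →
                ∃₂ λ σ τ → C.γ y zero zero ≡ C.γ x zero zero ℤ.+ σ ℤ.* q ×
                           C.γ y 1′ 1′ ≡ C.γ x 1′ 1′ ℤ.+ τ ℤ.* q
    ∼-entries {x} {y} (u , v , (du , zu) , (dv , zv) , e) = u zero 1′ , v zero 1′ ,
      trans (sym (e zero zero)) (top (u zero zero) (u zero 1′) (v zero zero) (v 1′ zero) _ _ _ _ q
        (du zero) (dv zero) (zv 1′ zero (s≤s z≤n)) (Entries.lower-left x)) ,
      trans (sym (e 1′ 1′)) (bottom (u 1′ zero) (u 1′ 1′) (v zero 1′) (v 1′ 1′) _ _ _ _ q
        (du 1′) (dv 1′) (zu 1′ zero (s≤s z≤n)) (Entries.lower-left x))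
      where
      top : ∀ u₀ u₁ v₀ v₁ a b c d q → u₀ ≡ ℤ.1ℤ → v₀ ≡ ℤ.1ℤ → v₁ ≡ + 0 → c ≡ q →
            (u₀ ℤ.* a ℤ.+ (u₁ ℤ.* c ℤ.+ + 0)) ℤ.* v₀ ℤ.+ ((u₀ ℤ.* b ℤ.+ (u₁ ℤ.* d ℤ.+ + 0)) ℤ.* v₁ ℤ.+ + 0) ≡ a ℤ.+ u₁ ℤ.* q
      top u₀ u₁ v₀ v₁ a b c d q refl refl refl refl = simplify u₁ a b q d
        where
        simplify : ∀ u₁ a b c d → (ℤ.1ℤ ℤ.* a ℤ.+ (u₁ ℤ.* c ℤ.+ + 0)) ℤ.* ℤ.1ℤ ℤ.+
          ((ℤ.1ℤ ℤ.* b ℤ.+ (u₁ ℤ.* d ℤ.+ + 0)) ℤ.* + 0 ℤ.+ + 0) ≡ a ℤ.+ u₁ ℤ.* c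
        simplify = ℤ.solve-∀
      bottom : ∀ u₀ u₁ v₀ v₁ a b c d q → u₁ ≡ ℤ.1ℤ → v₁ ≡ ℤ.1ℤ → u₀ ≡ + 0 → c ≡ q →
               (u₀ ℤ.* a ℤ.+ (u₁ ℤ.* c ℤ.+ + 0)) ℤ.* v₀ ℤ.+ ((u₀ ℤ.* b ℤ.+ (u₁ ℤ.* d ℤ.+ + 0)) ℤ.* v₁ ℤ.+ + 0) ≡ d ℤ.+ v₀ ℤ.* q
      bottom u₀ u₁ v₀ v₁ a b c d q refl refl refl refl = simplify v₀ a b q d
        where
        simplify : ∀ v₀ a b c d → (+ 0 ℤ.* a ℤ.+ (ℤ.1ℤ ℤ.* c ℤ.+ + 0)) ℤ.* v₀ ℤ.+
          ((+ 0 ℤ.* b ℤ.+ (ℤ.1ℤ ℤ.* d ℤ.+ + 0)) ℤ.* ℤ.1ℤ ℤ.+ + 0) ≡ d ℤ.+ v₀ ℤ.* c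
        simplify = ℤ.solve-∀

    C-trivial : ∀ D → C {0} D
    C-trivial D = Bruhat.from D record
      { γ = ℤP.1ₘ ; b₁ = ℚP.1ₘ ; b₂ = ℚP.1ₘ ; unip₁ = ℚP.U-1 ; unip₂ = ℚP.U-1
      ; bruhat = λ { zero zero → refl } }

    -- For the one-by-one matrix Γ = (1) the normal form is the matrix with rows (a , s) and (q ,
    -- t), so `assemble` over the empty tuple already yields these cells.
    cell₂ : ∀ a b d → a ℤ.* d ≡ ℤ.1ℤ ℤ.+ b ℤ.* q →
            ∃ λ (x : C D) → C.γ x zero zero ≡ a × C.γ x 1′ 1′ ≡ d
    cell₂ a b d e = assemble D (C-trivial (init D)) a b d condition , ℤ.*-identityʳ a , refl
      where
      condition : q ℤ.* b ≡ ℤ.-1ℤ ℤ.+ a ℤ.* d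
      condition = trans (rearrange b q) (cong (ℤ._+_ ℤ.-1ℤ) (sym e))
        where
        rearrange : ∀ b q → q ℤ.* b ≡ ℤ.-1ℤ ℤ.+ (ℤ.1ℤ ℤ.+ b ℤ.* q)
        rearrange = ℤ.solve-∀

    -- In SL(2) the entries a and q determine d mod q.
    ∼-intro : ∀ {x y : C D} σ → C.γ y zero zero ≡ C.γ x zero zero ℤ.+ σ ℤ.* q → C.γ x ℤM.∼ C.γ y
    ∼-intro {x} {y} σ e = (_ , _ , ℤP.U-block (λ _ → σ) ℤP.U-1 , ℤP.U-block (λ _ → τ) ℤP.U-1 , λ where
        zero       zero       → trans (e₀₀ σ a g τ b d) (trans (cong (λ c → a ℤ.+ σ ℤ.* c) x.lower-left) (sym e))
        zero       (suc zero) → trans (e₀₁ σ a g τ b d) upper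
        (suc zero) zero       → trans (e₁₀ σ a g τ b d) (trans x.lower-left (sym y.lower-left))
        (suc zero) (suc zero) → trans (e₁₁ σ a g τ b d) τ-eq)
      where
      module x = Entries x
      module y = Entries y
      open ≡-Reasoning
      a = C.γ x zero zero
      b = C.γ x zero 1′
      g = C.γ x 1′ zero
      d = C.γ x 1′ 1′
      a′ = C.γ y zero zero
      b′ = C.γ y zero 1′
      d′ = C.γ y 1′ 1′
      -- The solution of q τ = d′ - d: write d′ - d as d′ (a d - b q) - d (a′ d′ - b′ q) and put a′
      -- = a + σ q.
      τ = b′ ℤ.* d ℤ.- σ ℤ.* d ℤ.* d′ ℤ.- b ℤ.* d′
      e₀₀ : ∀ σ a c τ b d → (ℤ.1ℤ ℤ.* a ℤ.+ (σ ℤ.* c ℤ.+ + 0)) ℤ.* ℤ.1ℤ ℤ.+ ((ℤ.1ℤ ℤ.* b ℤ.+ (σ ℤ.* d ℤ.+ + 0)) ℤ.* + 0 ℤ.+ + 0) ≡ a ℤ.+ σ ℤ.* c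
      e₀₀ = ℤ.solve-∀
      e₀₁ : ∀ σ a c τ b d → (ℤ.1ℤ ℤ.* a ℤ.+ (σ ℤ.* c ℤ.+ + 0)) ℤ.* τ ℤ.+ ((ℤ.1ℤ ℤ.* b ℤ.+ (σ ℤ.* d ℤ.+ + 0)) ℤ.* ℤ.1ℤ ℤ.+ + 0) ≡ (a ℤ.+ σ ℤ.* c) ℤ.* τ ℤ.+ (b ℤ.+ σ ℤ.* d)
      e₀₁ = ℤ.solve-∀
      e₁₀ : ∀ σ a c τ b d → (+ 0 ℤ.* a ℤ.+ (ℤ.1ℤ ℤ.* c ℤ.+ + 0)) ℤ.* ℤ.1ℤ ℤ.+ ((+ 0 ℤ.* b ℤ.+ (ℤ.1ℤ ℤ.* d ℤ.+ + 0)) ℤ.* + 0 ℤ.+ + 0) ≡ c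
      e₁₀ = ℤ.solve-∀
      e₁₁ : ∀ σ a c τ b d → (+ 0 ℤ.* a ℤ.+ (ℤ.1ℤ ℤ.* c ℤ.+ + 0)) ℤ.* τ ℤ.+ ((+ 0 ℤ.* b ℤ.+ (ℤ.1ℤ ℤ.* d ℤ.+ + 0)) ℤ.* ℤ.1ℤ ℤ.+ + 0) ≡ c ℤ.* τ ℤ.+ d
      e₁₁ = ℤ.solve-∀
      e″ : ∀ q a b d σ b′ d′ → q ℤ.* (b′ ℤ.* d ℤ.- σ ℤ.* d ℤ.* d′ ℤ.- b ℤ.* d′) ℤ.+ d ≡
           d ℤ.* (ℤ.1ℤ ℤ.+ b′ ℤ.* q) ℤ.- (a ℤ.+ σ ℤ.* q) ℤ.* d′ ℤ.* d ℤ.+ (a ℤ.* d ℤ.- b ℤ.* q) ℤ.* d′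
      e″ = ℤ.solve-∀
      cancel-d : ∀ a′ d d′ b q → d ℤ.* (a′ ℤ.* d′) ℤ.- a′ ℤ.* d′ ℤ.* d ℤ.+ (ℤ.1ℤ ℤ.+ b ℤ.* q ℤ.- b ℤ.* q) ℤ.* d′ ≡ d′
      cancel-d = ℤ.solve-∀
      qτ : q ℤ.* τ ℤ.+ d ≡ d′
      qτ = begin
        q ℤ.* τ ℤ.+ d
          ≡⟨ e″ q a b d σ b′ d′ ⟩
        d ℤ.* (ℤ.1ℤ ℤ.+ b′ ℤ.* q) ℤ.- (a ℤ.+ σ ℤ.* q) ℤ.* d′ ℤ.* d ℤ.+ (a ℤ.* d ℤ.- b ℤ.* q) ℤ.* d′
          ≡⟨ cong₂ (λ s t → d ℤ.* s ℤ.- t ℤ.* d′ ℤ.* d ℤ.+ (a ℤ.* d ℤ.- b ℤ.* q) ℤ.* d′) (sym y.determinant) (sym e) ⟩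
        d ℤ.* (a′ ℤ.* d′) ℤ.- a′ ℤ.* d′ ℤ.* d ℤ.+ (a ℤ.* d ℤ.- b ℤ.* q) ℤ.* d′
          ≡⟨ cong (λ s → d ℤ.* (a′ ℤ.* d′) ℤ.- a′ ℤ.* d′ ℤ.* d ℤ.+ (s ℤ.- b ℤ.* q) ℤ.* d′) x.determinant ⟩
        d ℤ.* (a′ ℤ.* d′) ℤ.- a′ ℤ.* d′ ℤ.* d ℤ.+ (ℤ.1ℤ ℤ.+ b ℤ.* q ℤ.- b ℤ.* q) ℤ.* d′
          ≡⟨ cancel-d a′ d d′ b q ⟩
        d′ ∎
      τ-eq : g ℤ.* τ ℤ.+ d ≡ d′
      τ-eq = trans (cong (λ c → c ℤ.* τ ℤ.+ d) x.lower-left) qτ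
      regroup : ∀ q a b d σ τ → ((a ℤ.+ σ ℤ.* q) ℤ.* τ ℤ.+ (b ℤ.+ σ ℤ.* d)) ℤ.* q ≡
                (a ℤ.+ σ ℤ.* q) ℤ.* (q ℤ.* τ ℤ.+ d) ℤ.- a ℤ.* d ℤ.+ b ℤ.* q
      regroup = ℤ.solve-∀
      finish : ∀ b b′ q → ℤ.1ℤ ℤ.+ b′ ℤ.* q ℤ.- (ℤ.1ℤ ℤ.+ b ℤ.* q) ℤ.+ b ℤ.* q ≡ b′ ℤ.* q
      finish = ℤ.solve-∀
      upper : (a ℤ.+ σ ℤ.* g) ℤ.* τ ℤ.+ (b ℤ.+ σ ℤ.* d) ≡ b′
      upper = ℤ.*-cancelʳ-≡ _ b′ q ⦃ ℕ⁺.nonZero m ⦄ (begin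
        ((a ℤ.+ σ ℤ.* g) ℤ.* τ ℤ.+ (b ℤ.+ σ ℤ.* d)) ℤ.* q
          ≡⟨ cong (λ c → ((a ℤ.+ σ ℤ.* c) ℤ.* τ ℤ.+ (b ℤ.+ σ ℤ.* d)) ℤ.* q) x.lower-left ⟩
        ((a ℤ.+ σ ℤ.* q) ℤ.* τ ℤ.+ (b ℤ.+ σ ℤ.* d)) ℤ.* q
          ≡⟨ regroup q a b d σ τ ⟩
        (a ℤ.+ σ ℤ.* q) ℤ.* (q ℤ.* τ ℤ.+ d) ℤ.- a ℤ.* d ℤ.+ b ℤ.* q
          ≡⟨ cong₂ (λ s t → s ℤ.- t ℤ.+ b ℤ.* q) (trans (cong₂ ℤ._*_ (sym e) qτ) y.determinant) x.determinant ⟩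
        ℤ.1ℤ ℤ.+ b′ ℤ.* q ℤ.- (ℤ.1ℤ ℤ.+ b ℤ.* q) ℤ.+ b ℤ.* q
          ≡⟨ finish b b′ q ⟩
        b′ ℤ.* q ∎)

  -- The correspondence between pairs of classes and classes for `D`.

  -- In the notation of the paper, (1⁺ ∷ init D) (fromℕ k) is Dₙ₋₂, where D₀ = 1.
  module Factorisation {k} (D : Vector ℕ⁺ (suc k)) (δ̄ κ : ℤ)
    (bézout : + value ((1⁺ ∷ init D) (fromℕ k)) ℤ.* δ̄ ≡ ℤ.1ℤ ℤ.+ κ ℤ.* + value (last D)) where
    private
      q = + value (last D)
      δ = + value ((1⁺ ∷ init D) (fromℕ k))
      ε = ℤP.sgn (fromℕ k)
      ε′ = ℤP.sgn (fromℕ (suc k))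
      D₂ : Vector ℕ⁺ 1
      D₂ = last D ∷ []
      1′ : Fin 2
      1′ = suc zero
      module T = TwoByTwo (last D)
      open ≡-Reasoning

      ε² : ε ℤ.* ε ≡ ℤ.1ℤ
      ε² = ℤP.sgn² (toℕ (fromℕ k))

      q-cancel : ∀ {x y} → q ℤ.* x ≡ q ℤ.* y → x ≡ y
      q-cancel {x} {y} e = ℤ.*-cancelˡ-≡ q x y ⦃ ℕ⁺.nonZero (last D) ⦄ e

    -- The corner β is forced by q β = ε′ + α θ. With b the upper right entry of `x`, the product α
    -- θ is ε (1 + κ q) (1 + b q), and ε′ = - ε removes its constant term before the division by
    -- `q`.
    α β θ : C D₂ → ℤ
    α x = δ ℤ.* C.γ x zero zero
    β x = ε ℤ.* (κ ℤ.+ C.γ x zero 1′ ℤ.+ κ ℤ.* C.γ x zero 1′ ℤ.* q)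
    θ x = ε ℤ.* δ̄ ℤ.* C.γ x 1′ 1′

    private
      condition : ∀ x → q ℤ.* β x ≡ ε′ ℤ.+ α x ℤ.* θ x
      condition x = begin
        q ℤ.* β x                                                        ≡⟨ step₁ q ε κ b ⟩
        ℤ.-1ℤ ℤ.* ε ℤ.+ ε ℤ.* ((ℤ.1ℤ ℤ.+ κ ℤ.* q) ℤ.* (ℤ.1ℤ ℤ.+ b ℤ.* q))
          ≡⟨ cong₂ (λ s t → ℤ.-1ℤ ℤ.* ε ℤ.+ ε ℤ.* (s ℤ.* t)) bézout (T.Entries.determinant x) ⟨
        ℤ.-1ℤ ℤ.* ε ℤ.+ ε ℤ.* (δ ℤ.* δ̄ ℤ.* (a ℤ.* d))                    ≡⟨ step₂ ε δ δ̄ a d ⟩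
        ε′ ℤ.+ α x ℤ.* θ x                                               ∎
        where
        a = C.γ x zero zero
        b = C.γ x zero 1′
        d = C.γ x 1′ 1′
        step₁ : ∀ q ε κ b → q ℤ.* (ε ℤ.* (κ ℤ.+ b ℤ.+ κ ℤ.* b ℤ.* q)) ≡
                ℤ.-1ℤ ℤ.* ε ℤ.+ ε ℤ.* ((ℤ.1ℤ ℤ.+ κ ℤ.* q) ℤ.* (ℤ.1ℤ ℤ.+ b ℤ.* q))
        step₁ = ℤ.solve-∀
        step₂ : ∀ ε δ δ̄ a d → ℤ.-1ℤ ℤ.* ε ℤ.+ ε ℤ.* (δ ℤ.* δ̄ ℤ.* (a ℤ.* d)) ≡
                ℤ.-1ℤ ℤ.* ε ℤ.+ δ ℤ.* a ℤ.* (ε ℤ.* δ̄ ℤ.* d)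
        step₂ = ℤ.solve-∀

    Φ : C (init D) → C D₂ → C D
    Φ y x = assemble D y (α x) (β x) (θ x) (condition x)

    -- The normal form determines δ a modulo `q`. Multiplying by δ̄ gives the congruence for a
    -- itself, which settles the class in SL(2,ℤ).
    Φ-injective : ∀ {y y′ x x′} → C.γ (Φ y x) ℤM.∼ C.γ (Φ y′ x′) → C.γ y ℤM.∼ C.γ y′ × C.γ x ℤM.∼ C.γ x′
    Φ-injective {y} {y′} {x} {x′} e = proj₁ h , T.∼-intro {x} {x′} (δ̄ ℤ.* σ ℤ.+ κ ℤ.* a ℤ.- κ ℤ.* a′) (unscale a a′ σ (proj₂ (proj₂ h)))
      where
      a = C.γ x zero zero
      a′ = C.γ x′ zero zero
      h : C.γ y ℤM.∼ C.γ y′ × ∃ λ σ → δ ℤ.* a ℤ.+ σ ℤ.* q ≡ δ ℤ.* a′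
      h = ℤN.P-injective {q = q} {C.γ y} {C.γ y′} {Invertible.γ⁻¹ y} q-cancel (Invertible.γ-inverseʳ y) {α x} {β x} {θ x} {α x′} {β x′} {θ x′} e
      σ = proj₁ (proj₂ h)
      unscale : ∀ a a′ σ → δ ℤ.* a ℤ.+ σ ℤ.* q ≡ δ ℤ.* a′ → a′ ≡ a ℤ.+ (δ̄ ℤ.* σ ℤ.+ κ ℤ.* a ℤ.- κ ℤ.* a′) ℤ.* q
      unscale a a′ σ e = begin
        a′                                             ≡⟨ step₁ a′ κ q ⟩
        (ℤ.1ℤ ℤ.+ κ ℤ.* q) ℤ.* a′ ℤ.- κ ℤ.* q ℤ.* a′   ≡⟨ cong (λ s → s ℤ.* a′ ℤ.- κ ℤ.* q ℤ.* a′) bézout ⟨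
        δ ℤ.* δ̄ ℤ.* a′ ℤ.- κ ℤ.* q ℤ.* a′              ≡⟨ step₂ δ δ̄ a′ κ q ⟩
        δ̄ ℤ.* (δ ℤ.* a′) ℤ.- κ ℤ.* q ℤ.* a′            ≡⟨ cong (λ s → δ̄ ℤ.* s ℤ.- κ ℤ.* q ℤ.* a′) e ⟨
        δ̄ ℤ.* (δ ℤ.* a ℤ.+ σ ℤ.* q) ℤ.- κ ℤ.* q ℤ.* a′ ≡⟨ step₃ δ δ̄ a a′ σ κ q ⟩
        δ ℤ.* δ̄ ℤ.* a ℤ.+ (δ̄ ℤ.* σ ℤ.- κ ℤ.* a′) ℤ.* q
          ≡⟨ cong (λ s → s ℤ.* a ℤ.+ (δ̄ ℤ.* σ ℤ.- κ ℤ.* a′) ℤ.* q) bézout ⟩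
        (ℤ.1ℤ ℤ.+ κ ℤ.* q) ℤ.* a ℤ.+ (δ̄ ℤ.* σ ℤ.- κ ℤ.* a′) ℤ.* q ≡⟨ step₄ δ̄ a a′ σ κ q ⟩
        a ℤ.+ (δ̄ ℤ.* σ ℤ.+ κ ℤ.* a ℤ.- κ ℤ.* a′) ℤ.* q ∎
        where
        step₁ : ∀ a′ κ q → a′ ≡ (ℤ.1ℤ ℤ.+ κ ℤ.* q) ℤ.* a′ ℤ.- κ ℤ.* q ℤ.* a′
        step₁ = ℤ.solve-∀
        step₂ : ∀ δ δ̄ a′ κ q → δ ℤ.* δ̄ ℤ.* a′ ℤ.- κ ℤ.* q ℤ.* a′ ≡ δ̄ ℤ.* (δ ℤ.* a′) ℤ.- κ ℤ.* q ℤ.* a′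
        step₂ = ℤ.solve-∀
        step₃ : ∀ δ δ̄ a a′ σ κ q → δ̄ ℤ.* (δ ℤ.* a ℤ.+ σ ℤ.* q) ℤ.- κ ℤ.* q ℤ.* a′ ≡
                δ ℤ.* δ̄ ℤ.* a ℤ.+ (δ̄ ℤ.* σ ℤ.- κ ℤ.* a′) ℤ.* q
        step₃ = ℤ.solve-∀
        step₄ : ∀ δ̄ a a′ σ κ q → (ℤ.1ℤ ℤ.+ κ ℤ.* q) ℤ.* a ℤ.+ (δ̄ ℤ.* σ ℤ.- κ ℤ.* a′) ℤ.* q ≡
                a ℤ.+ (δ̄ ℤ.* σ ℤ.+ κ ℤ.* a ℤ.- κ ℤ.* a′) ℤ.* q
        step₄ = ℤ.solve-∀

    module _ (z : C D) where
      private
        y₀ : C (init D)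
        y₀ = proj₁ (Decompose.cell D z δ̄ κ bézout)

      -- The representative `y` is arbitrary because the list for `init D` supplies its own. The
      -- equivalence from y₀ to `y` is lifted by conjugating u′ with Diag (q , 1 , ... , 1), so that
      -- it acts inside `scale q`.
      reduce : ∀ (y : C (init D)) → C.γ y₀ ℤM.∼ C.γ y → ∃₂ λ a s → ∃ λ t → C.γ z ℤM.∼ ℤN.P q a s t (C.γ y)
      reduce y (u′ , v′ , hu′ , hv′ , e) = proj₁ normal , proj₁ (proj₂ normal) , c′ zero ,
        ∼-trans {A = C.γ z} {Q₀} {Q₃} (≋⇒∼ {A = C.γ z} {Q₀} (ℤB.as-quad (C.γ z)))
          (∼-trans {A = Q₀} {Q₁} {Q₃}
            (ℤN.quad-∼ {u = û} {v′} hû hv′ ℤB.0ᵥ ℤB.0ᵥ (init (C.γ z zero)) (last (C.γ z zero)) A (λ i → last (C.γ z (suc i))))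
            (∼-trans {A = Q₁} {Q₂} {Q₃}
              (≋⇒∼ {A = Q₁} {Q₂} (ℤB.quad-cong {r = r′} {s = s′} {A = û ℤP.· A ℤP.· v′} {v = c′} (λ _ → refl) refl corner (λ _ → refl)))
              (proj₂ (proj₂ normal))))
        where
        open Invertible y
        module M = SetoidReasoning (ℤP.≋-setoid (suc k))
        A : ℤM.Matrix (suc k)
        A = ℤB.bl (C.γ z)
        U = proj₁ (proj₂ (Decompose.cell D z δ̄ κ bézout))
        hU = proj₁ (proj₂ (proj₂ (Decompose.cell D z δ̄ κ bézout)))
        UA = proj₂ (proj₂ (proj₂ (Decompose.cell D z δ̄ κ bézout)))
        û = ℤB.conj q u′ ℤP.· U
        hû = ℤP.U-· (ℤB.U-conj q hu′) hU
        r′ = (init (C.γ z zero) ℤB.+ᵥ ℤB.0ᵥ ℤB.⊙ A) ℤB.⊙ v′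
        s′ = (init (C.γ z zero) ℤB.+ᵥ ℤB.0ᵥ ℤB.⊙ A) ℤB.∙ ℤB.0ᵥ ℤ.+ (last (C.γ z zero) ℤ.+ ℤB.0ᵥ ℤB.∙ (λ i → last (C.γ z (suc i))))
        c′ = û ℤP.· A ℤB.⊡ ℤB.0ᵥ ℤB.+ᵥ û ℤB.⊡ (λ i → last (C.γ z (suc i)))
        Γ₀ = C.γ y₀
        normal = ℤN.normal-form {Γ = C.γ y} {Z = γ⁻¹} γ-inverseʳ γ-inverseˡ q r′ s′ c′
        Q₀ Q₁ Q₂ Q₃ : ℤM.Matrix (suc (suc k))
        Q₀ = ℤB.quad (init (C.γ z zero)) (last (C.γ z zero)) A (λ i → last (C.γ z (suc i)))
        Q₁ = ℤB.quad r′ s′ (û ℤP.· A ℤP.· v′) c′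
        Q₂ = ℤB.quad r′ s′ (ℤB.scale q (C.γ y)) c′
        Q₃ = ℤN.P q (proj₁ normal) (proj₁ (proj₂ normal)) (c′ zero) (C.γ y)
        corner : û ℤP.· A ℤP.· v′ ℤP.≋ ℤB.scale q (C.γ y)
        corner = M.begin
          û ℤP.· A ℤP.· v′
            M.≈⟨ ℤP.·-congʳ {B = v′} (ℤP.·-assoc (ℤB.conj q u′) U A) ⟩
          ℤB.conj q u′ ℤP.· (U ℤP.· A) ℤP.· v′
            M.≈⟨ ℤP.·-congʳ {B = v′} (ℤP.·-congˡ {A = ℤB.conj q u′} UA) ⟩
          ℤB.conj q u′ ℤP.· ℤB.scale q Γ₀ ℤP.· v′
            M.≈⟨ ℤP.·-congʳ {B = v′} (ℤB.conj-scale q hu′ Γ₀) ⟩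
          ℤB.scale q (u′ ℤP.· Γ₀) ℤP.· v′                     M.≈⟨ ℤB.scale-· q (u′ ℤP.· Γ₀) v′ ⟩
          ℤB.scale q (u′ ℤP.· Γ₀ ℤP.· v′)                     M.≈⟨ ℤB.scale-cong {p = q} {q = q} refl e ⟩
          ℤB.scale q (C.γ y)                                  M.∎

      -- The quantifiers follow the search through the two lists: the first offers some `y` in the
      -- class of y₀, then x₀ is chosen in terms of that `y`, and the second offers some `x` in the
      -- class of x₀. In this form the statement also absorbs the compatibility of `Φ` with
      -- equivalence.
      Φ-surjective : ∃ λ (y₀ : C (init D)) → ∀ (y : C (init D)) → C.γ y₀ ℤM.∼ C.γ y → ∃ λ (x₀ : C D₂) → ∀ (x : C D₂) → C.γ x₀ ℤM.∼ C.γ x →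
                     C.γ z ℤM.∼ C.γ (Φ y x)
      Φ-surjective = y₀ , λ y y₀∼y → lift y (reduce y y₀∼y)
        where
        lift : ∀ (y : C (init D)) → (∃₂ λ a s → ∃ λ t → C.γ z ℤM.∼ ℤN.P q a s t (C.γ y)) →
               ∃ λ (x₀ : C D₂) → ∀ (x : C D₂) → C.γ x₀ ℤM.∼ C.γ x → C.γ z ℤM.∼ C.γ (Φ y x)
        lift y (a , s , t , z∼P) = proj₁ x₀ , λ x x₀∼x → conclude x (T.∼-entries {proj₁ x₀} {x} x₀∼x)
          where
          -- The entries δ̄ a and ε δ t invert α and θ modulo `q`. As a t = q s + ε, their product
          -- is (1 + κ q) (1 + ε s q), and `b` is the coefficient of `q` in it.
          b = κ ℤ.+ ε ℤ.* s ℤ.+ κ ℤ.* ε ℤ.* s ℤ.* q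
          product : δ̄ ℤ.* a ℤ.* (ε ℤ.* δ ℤ.* t) ≡ ℤ.1ℤ ℤ.+ b ℤ.* q
          product = begin
            δ̄ ℤ.* a ℤ.* (ε ℤ.* δ ℤ.* t)                                        ≡⟨ step₁ δ δ̄ ε a t ⟩
            ε ℤ.* (δ ℤ.* δ̄) ℤ.* (ℤ.-1ℤ ℤ.* ε ℤ.+ a ℤ.* t ℤ.+ ε)
              ≡⟨ cong₂ (λ m n → ε ℤ.* m ℤ.* (n ℤ.+ ε)) bézout (sym (P-relation D z y a s t z∼P)) ⟩
            ε ℤ.* (ℤ.1ℤ ℤ.+ κ ℤ.* q) ℤ.* (q ℤ.* s ℤ.+ ε)                       ≡⟨ step₂ ε κ q s ⟩
            (ℤ.1ℤ ℤ.+ κ ℤ.* q) ℤ.* (ε ℤ.* s ℤ.* q ℤ.+ ε ℤ.* ε)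
              ≡⟨ cong (λ m → (ℤ.1ℤ ℤ.+ κ ℤ.* q) ℤ.* (ε ℤ.* s ℤ.* q ℤ.+ m)) ε² ⟩
            (ℤ.1ℤ ℤ.+ κ ℤ.* q) ℤ.* (ε ℤ.* s ℤ.* q ℤ.+ ℤ.1ℤ)                    ≡⟨ step₃ ε κ q s ⟩
            ℤ.1ℤ ℤ.+ b ℤ.* q                                                   ∎
            where
            step₁ : ∀ δ δ̄ ε a t → δ̄ ℤ.* a ℤ.* (ε ℤ.* δ ℤ.* t) ≡ ε ℤ.* (δ ℤ.* δ̄) ℤ.* (ℤ.-1ℤ ℤ.* ε ℤ.+ a ℤ.* t ℤ.+ ε)
            step₁ = ℤ.solve-∀
            step₂ : ∀ ε κ q s → ε ℤ.* (ℤ.1ℤ ℤ.+ κ ℤ.* q) ℤ.* (q ℤ.* s ℤ.+ ε) ≡ (ℤ.1ℤ ℤ.+ κ ℤ.* q) ℤ.* (ε ℤ.* s ℤ.* q ℤ.+ ε ℤ.* ε)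
            step₂ = ℤ.solve-∀
            step₃ : ∀ ε κ q s → (ℤ.1ℤ ℤ.+ κ ℤ.* q) ℤ.* (ε ℤ.* s ℤ.* q ℤ.+ ℤ.1ℤ) ≡
                    ℤ.1ℤ ℤ.+ (κ ℤ.+ ε ℤ.* s ℤ.+ κ ℤ.* ε ℤ.* s ℤ.* q) ℤ.* q
            step₃ = ℤ.solve-∀
          x₀ = T.cell₂ (δ̄ ℤ.* a) b (ε ℤ.* δ ℤ.* t) product
          conclude : ∀ (x : C D₂) → (∃₂ λ σ τ → C.γ x zero zero ≡ C.γ (proj₁ x₀) zero zero ℤ.+ σ ℤ.* q ×
                                       C.γ x 1′ 1′ ≡ C.γ (proj₁ x₀) 1′ 1′ ℤ.+ τ ℤ.* q) →
                     C.γ z ℤM.∼ C.γ (Φ y x)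
          conclude x (σ , τ , eσ , eτ) = final (ℤN.shift {Γ = C.γ y} {Z = Invertible.γ⁻¹ y} (Invertible.γ-inverseʳ y) q a s t σ′ τ′)
            where
            -- Congruence modulo `q` is turned into equality: α x = δ (δ̄ a + σ q) = a + (κ a + δ σ)
            -- q, and in the same way θ x = ε δ̄ (ε δ t + τ q).
            σ′ = κ ℤ.* a ℤ.+ δ ℤ.* σ
            τ′ = κ ℤ.* t ℤ.+ ε ℤ.* δ̄ ℤ.* τ
            a-eq : a ℤ.+ σ′ ℤ.* q ≡ α x
            a-eq = begin
              a ℤ.+ (κ ℤ.* a ℤ.+ δ ℤ.* σ) ℤ.* q                 ≡⟨ step₁ a κ δ σ q ⟩
              (ℤ.1ℤ ℤ.+ κ ℤ.* q) ℤ.* a ℤ.+ δ ℤ.* (σ ℤ.* q)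
                ≡⟨ cong (λ m → m ℤ.* a ℤ.+ δ ℤ.* (σ ℤ.* q)) bézout ⟨
              δ ℤ.* δ̄ ℤ.* a ℤ.+ δ ℤ.* (σ ℤ.* q)                 ≡⟨ step₂ δ δ̄ a (σ ℤ.* q) ⟩
              δ ℤ.* (δ̄ ℤ.* a ℤ.+ σ ℤ.* q)
                ≡⟨ cong (λ m → δ ℤ.* (m ℤ.+ σ ℤ.* q)) (proj₁ (proj₂ x₀)) ⟨
              δ ℤ.* (C.γ (proj₁ x₀) zero zero ℤ.+ σ ℤ.* q)      ≡⟨ cong (δ ℤ.*_) eσ ⟨
              α x                                               ∎
              where
              step₁ : ∀ a κ δ σ q → a ℤ.+ (κ ℤ.* a ℤ.+ δ ℤ.* σ) ℤ.* q ≡ (ℤ.1ℤ ℤ.+ κ ℤ.* q) ℤ.* a ℤ.+ δ ℤ.* (σ ℤ.* q)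
              step₁ = ℤ.solve-∀
              step₂ : ∀ δ δ̄ a s → δ ℤ.* δ̄ ℤ.* a ℤ.+ δ ℤ.* s ≡ δ ℤ.* (δ̄ ℤ.* a ℤ.+ s)
              step₂ = ℤ.solve-∀
            t-eq : t ℤ.+ τ′ ℤ.* q ≡ θ x
            t-eq = begin
              t ℤ.+ (κ ℤ.* t ℤ.+ ε ℤ.* δ̄ ℤ.* τ) ℤ.* q                          ≡⟨ step₁ t κ ε δ̄ τ q ⟩
              ℤ.1ℤ ℤ.* (ℤ.1ℤ ℤ.+ κ ℤ.* q) ℤ.* t ℤ.+ ε ℤ.* δ̄ ℤ.* (τ ℤ.* q)
                ≡⟨ cong₂ (λ m n → m ℤ.* n ℤ.* t ℤ.+ ε ℤ.* δ̄ ℤ.* (τ ℤ.* q)) ε² bézout ⟨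
              ε ℤ.* ε ℤ.* (δ ℤ.* δ̄) ℤ.* t ℤ.+ ε ℤ.* δ̄ ℤ.* (τ ℤ.* q)            ≡⟨ step₂ ε δ δ̄ t (τ ℤ.* q) ⟩
              ε ℤ.* δ̄ ℤ.* (ε ℤ.* δ ℤ.* t ℤ.+ τ ℤ.* q)
                ≡⟨ cong (λ m → ε ℤ.* δ̄ ℤ.* (m ℤ.+ τ ℤ.* q)) (proj₂ (proj₂ x₀)) ⟨
              ε ℤ.* δ̄ ℤ.* (C.γ (proj₁ x₀) 1′ 1′ ℤ.+ τ ℤ.* q)                   ≡⟨ cong (ε ℤ.* δ̄ ℤ.*_) eτ ⟨
              θ x                                                              ∎
              where
              step₁ : ∀ t κ ε δ̄ τ q → t ℤ.+ (κ ℤ.* t ℤ.+ ε ℤ.* δ̄ ℤ.* τ) ℤ.* q ≡ ℤ.1ℤ ℤ.* (ℤ.1ℤ ℤ.+ κ ℤ.* q) ℤ.* t ℤ.+ ε ℤ.* δ̄ ℤ.* (τ ℤ.* q)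
              step₁ = ℤ.solve-∀
              step₂ : ∀ ε δ δ̄ t s → ε ℤ.* ε ℤ.* (δ ℤ.* δ̄) ℤ.* t ℤ.+ ε ℤ.* δ̄ ℤ.* s ≡ ε ℤ.* δ̄ ℤ.* (ε ℤ.* δ ℤ.* t ℤ.+ s)
              step₂ = ℤ.solve-∀
            final : (∃ λ s′ → ℤN.P q a s t (C.γ y) ℤM.∼ ℤN.P q (a ℤ.+ σ′ ℤ.* q) s′ (t ℤ.+ τ′ ℤ.* q) (C.γ y)) →
                    C.γ z ℤM.∼ C.γ (Φ y x)
            final (s′ , P∼P′) = ∼-trans {A = C.γ z} {P′} {C.γ (Φ y x)} z∼P′ (≋⇒∼ {A = P′} {C.γ (Φ y x)} (ℤN.P-cong {q = q} {a = a ℤ.+ σ′ ℤ.* q} {a′ = α x} {s = s′} {s′ = β x} {t = t ℤ.+ τ′ ℤ.* q} {t′ = θ x} {Γ = C.γ y} a-eq s-eq t-eq (λ _ _ → refl)))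
              where
              P′ = ℤN.P q (a ℤ.+ σ′ ℤ.* q) s′ (t ℤ.+ τ′ ℤ.* q) (C.γ y)
              z∼P′ = ∼-trans {A = C.γ z} {ℤN.P q a s t (C.γ y)} {P′} z∼P P∼P′
              -- The corner produced by `shift` is unknown, but both corners satisfy q s = ε′ + a t
              -- with the same a and t.
              s-eq : s′ ≡ β x
              s-eq = q-cancel (begin
                q ℤ.* s′
                  ≡⟨ P-relation D z y (a ℤ.+ σ′ ℤ.* q) s′ (t ℤ.+ τ′ ℤ.* q) z∼P′ ⟩
                ε′ ℤ.+ (a ℤ.+ σ′ ℤ.* q) ℤ.* (t ℤ.+ τ′ ℤ.* q)
                  ≡⟨ cong₂ (λ m n → ε′ ℤ.+ m ℤ.* n) a-eq t-eq ⟩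
                ε′ ℤ.+ α x ℤ.* θ x                                     ≡⟨ condition x ⟨
                q ℤ.* β x                                              ∎)

  -- The characters on the classes, and their factorisation.

  superdiagonal : ∀ {a} {A : Set a} {n} → (Fin (suc n) → Fin (suc n) → A) → Vector A n
  superdiagonal u i = u (inject₁ i) (suc i)

  φ-∙ : ∀ {n} (x y : Vector ℤ n) → ι (x ℤB.∙ y) ≡ (λ i → ι (x i)) ℚB.∙ (λ i → ι (y i))
  φ-∙ {zero}  x y = refl
  φ-∙ {suc n} x y = trans (ι-+ (x zero ℤ.* y zero) (tail x ℤB.∙ tail y)) (cong₂ _+_ (ι-* (x zero) (y zero)) (φ-∙ (tail x) (tail y)))

  module Characters {ℓ₁ ℓ₂} (R : CommutativeRing ℓ₁ ℓ₂) (E : Exponential R) where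
    open Kloosterman R E
    open Exponential E
    module R = CommutativeRing R
    open R using (Carrier; _≈_) renaming (_*_ to _⊛_)
    open SetoidReasoning R.setoid
    open import Algebra.Properties.CommutativeSemigroup R.*-commutativeSemigroup using (interchange)

    -- Additivity alone makes e 0 an idempotent; e 1 = 1 identifies it.
    e-0 : e 0ℚ ≈ R.1#
    e-0 = begin
      e 0ℚ             ≈⟨ R.*-identityʳ _ ⟨
      e 0ℚ ⊛ R.1#      ≈⟨ R.*-congˡ e-1 ⟨
      e 0ℚ ⊛ e 1ℚ      ≈⟨ e-+ 0ℚ 1ℚ ⟨
      e 1ℚ             ≈⟨ e-1 ⟩
      R.1#             ∎

    e-ℕ : ∀ n → e (ι (+ n)) ≈ R.1#
    e-ℕ zero    = e-0
    e-ℕ (suc n) = begin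
      e (ι (+ suc n))            ≡⟨ cong e (ι-+ ℤ.1ℤ (+ n)) ⟩
      e (1ℚ + ι (+ n))           ≈⟨ e-+ 1ℚ (ι (+ n)) ⟩
      e 1ℚ ⊛ e (ι (+ n))         ≈⟨ R.*-cong e-1 (e-ℕ n) ⟩
      R.1# ⊛ R.1#                ≈⟨ R.*-identityˡ _ ⟩
      R.1#                       ∎

    e-ι : ∀ z → e (ι z) ≈ R.1#
    e-ι (+ n)        = e-ℕ n
    e-ι ℤ.-[1+ n ]   = begin
      e (ι ℤ.-[1+ n ])                        ≈⟨ R.*-identityʳ _ ⟨
      e (ι ℤ.-[1+ n ]) ⊛ R.1#                 ≈⟨ R.*-congˡ (e-ℕ (suc n)) ⟨
      e (ι ℤ.-[1+ n ]) ⊛ e (ι (+ suc n))      ≈⟨ e-+ _ _ ⟨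
      e (ι ℤ.-[1+ n ] + ι (+ suc n))          ≡⟨ cong e (ι-+ ℤ.-[1+ n ] (+ suc n)) ⟨
      e (ι (ℤ.-[1+ n ] ℤ.+ + suc n))          ≡⟨ cong (λ z → e (ι z)) (ℤ.+-inverseˡ (+ suc n)) ⟩
      e 0ℚ                                    ≈⟨ e-0 ⟩
      R.1#                                    ∎

    e-+ι : ∀ p z → e (p + ι z) ≈ e p
    e-+ι p z = R.trans (e-+ p (ι z)) (R.trans (R.*-congˡ (e-ι z)) (R.*-identityʳ _))

    module _ {r} (N : Vector ℤ r) where
      private
        ιN : Vector ℚ r
        ιN i = ι (N i)

      ψ-cong : ∀ {b b′} → b ℚP.≋ b′ → ψ N b ≈ ψ N b′
      ψ-cong {b} {b′} h = R.reflexive (cong e (ℚB.∙-cong {x = ιN} {ιN} {superdiagonal b} {superdiagonal b′} (λ _ → refl) (λ i → h (inject₁ i) (suc i))))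

      ψ-integral : ∀ {b b′} (u : ℤM.Matrix (suc r)) →
                   (∀ i → superdiagonal b′ i ≡ superdiagonal b i + ι (superdiagonal u i)) → ψ N b′ ≈ ψ N b
      ψ-integral {b} {b′} u h = R.trans (R.reflexive (cong e sums)) (e-+ι (ιN ℚB.∙ superdiagonal b) (N ℤB.∙ superdiagonal u))
        where
        ιu = λ i → ι (superdiagonal u i)
        sums : ιN ℚB.∙ superdiagonal b′ ≡ ιN ℚB.∙ superdiagonal b + ι (N ℤB.∙ superdiagonal u)
        sums = trans (ℚB.∙-cong {x = ιN} (λ _ → refl) h) (trans (ℚB.∙-comm ιN (superdiagonal b ℚB.+ᵥ ιu))
          (trans (ℚN.∙-distribʳ (superdiagonal b) ιu ιN)
            (cong₂ _+_ (ℚB.∙-comm (superdiagonal b) ιN) (trans (ℚB.∙-comm ιu ιN) (sym (φ-∙ N (superdiagonal u)))))))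

      ψ-·ˡ : ∀ {u b} → ℤP.Unipotent u → ℚP.Unipotent b → ψ N (φₘ u ℚP.· b) ≈ ψ N b
      ψ-·ˡ {u} {b} hu hb = ψ-integral {b} {φₘ u ℚP.· b} u
        (λ i → trans (ℚB.superdiagonal-· (φ-U hu) hb i) (ℚ.+-comm (ι (superdiagonal u i)) (superdiagonal b i)))

      ψ-·ʳ : ∀ {v b} → ℤP.Unipotent v → ℚP.Unipotent b → ψ N (b ℚP.· φₘ v) ≈ ψ N b
      ψ-·ʳ {v} {b} hv hb = ψ-integral {b} {b ℚP.· φₘ v} v (ℚB.superdiagonal-· hb (φ-U hv))

    term : ∀ {r} {D : Vector ℕ⁺ r} → Vector ℤ r → Vector ℤ r → C D → Carrier
    term M N x = ψ (reverse M) (C.b₁ x) ⊛ ψ N (C.b₂ x)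

    -- By uniqueness of the Bruhat factors, those of equivalent elements differ by integral
    -- unipotent matrices, which change the superdiagonals by integers only.
    term-cong : ∀ {r} {D : Vector ℕ⁺ r} M N {x y : C D} → C.γ x ℤM.∼ C.γ y → term M N x ≈ term M N y
    term-cong {D = D} M N {x} {y} (u , v , hu , hv , e) = R.sym (R.*-cong
      (R.trans (ψ-cong (reverse M) (ℚP.≋-sym (proj₁ same))) (ψ-·ˡ (reverse M) hu x.unip₁))
      (R.trans (ψ-cong N (ℚP.≋-sym (proj₂ same))) (ψ-·ʳ N hv x.unip₂)))
      where
      module B = Bruhat D
      module x = B.Cell (B.to x)
      module y = B.Cell (B.to y)
      same : φₘ u ℚP.· x.b₁ ℚP.≋ y.b₁ × x.b₂ ℚP.· φₘ v ℚP.≋ y.b₂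
      same = B.bruhat-unique (ℚP.U-· (φ-U hu) x.unip₁) (ℚP.U-· x.unip₂ (φ-U hv)) y.unip₁ y.unip₂
        (ℚP.≋-trans (ℚP.≋-sym (B.translate u v (B.to x))) (ℚP.≋-trans (λ i j → cong ι (e i j)) y.bruhat))

    module _ {m} (M N : Vector ℤ (2 ℕ.+ m)) (D : Vector ℕ⁺ (2 ℕ.+ m)) (δ̄ κ : ℤ)
      (bézout : + value (last (init D)) ℤ.* δ̄ ≡ ℤ.1ℤ ℤ.+ κ ℤ.* + value (last D)) where
      private
        q = + value (last D)
        q⁻ = 1⁺ ÷ last D
        δ = + value (last (init D))
        ε = ℤP.sgn (fromℕ (suc m))
        D₂ : Vector ℕ⁺ 1
        D₂ = last D ∷ []
        1′ : Fin 2
        1′ = suc zero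
        M′ = updateAt (init M) (fromℕ m) (q ℤ.*_)
        M₂ N₂ : Vector ℤ 1
        M₂ = δ ℤ.* last M ∷ []
        N₂ = last N ∷ []
      open Factorisation D δ̄ κ bézout using (Φ; Φ-injective; Φ-surjective; α; θ)

      private
        module Exponents (y : C (init D)) (x : C D₂) where
          module T = TwoByTwo.Entries (last D) x
          open ℚ.+-*-Solver using (_:*_; _:+_; _:=_; con) renaming (solve to solveℚ)
          a = C.γ x zero zero
          d = C.γ x 1′ 1′
          β = ι (ε ℤ.* δ ℤ.* θ x) * q⁻

          divide : ∀ {p z} → p * ι q ≡ ι z → p ≡ ι z * q⁻
          divide {p} {z} h = *-cancel (last D) (trans h (sym (trans (ℚ.*-assoc (ι z) q⁻ (ι q))
            (trans (cong (ι z *_) (trans (ℚ.*-comm q⁻ (ι q)) (1÷-inverse (last D)))) (ℚ.*-identityʳ (ι z))))))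

          -- Reversal pairs Mₙ₋₁ with δ a / q and Mₙ₋₂ with q (b₁)₀₁. Handing δ and `q` over to the
          -- coefficients produces `M₂` and the changed entry of `M′`.
          left : (λ i → ι (reverse M i)) ℚB.∙ superdiagonal (C.b₁ (Φ y x)) ≡
                 (λ i → ι (reverse M′ i)) ℚB.∙ superdiagonal (C.b₁ y) + (ι (δ ℤ.* last M) * C.b₁ x zero 1′ + 0ℚ)
          left = combined
            where
            p = C.b₁ y zero (suc zero)
            tails = (λ i → ι (M (inject₁ (inject₁ (opposite i))))) ℚB.∙ (λ i → C.b₁ y (suc (inject₁ i)) (suc (suc i)))
            tails′ : (λ i → ι (M′ (inject₁ (opposite i)))) ℚB.∙ (λ i → C.b₁ y (suc (inject₁ i)) (suc (suc i))) ≡ tails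
            tails′ = ℚB.∙-cong (λ i → cong ι (updateAt-minimal (inject₁ (opposite i)) (fromℕ m) (init M)
              (λ h → Fin.fromℕ≢inject₁ (sym h)))) (λ i → refl {x = C.b₁ y (suc (inject₁ i)) (suc (suc i))})
            rearrange : ∀ l d a q⁻ n q p t → l * (d * a * q⁻ * 1ℚ) + (n * (q * p) + t) ≡ q * n * p + t + (d * l * (a * q⁻) + 0ℚ)
            rearrange = solveℚ 8 (λ l d a q⁻ n q p t → l :* (d :* a :* q⁻ :* con 1ℚ) :+ (n :* (q :* p) :+ t) :=
                          q :* n :* p :+ t :+ (d :* l :* (a :* q⁻) :+ con 0ℚ)) refl
            combined : ι (last M) * (ι (δ ℤ.* a) * q⁻ * 1ℚ) + (ι (last (init M)) * (ι q * p) + tails) ≡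
                     ι (M′ (fromℕ m)) * p + (λ i → ι (M′ (inject₁ (opposite i)))) ℚB.∙ (λ i → C.b₁ y (suc (inject₁ i)) (suc (suc i)))
                       + (ι (δ ℤ.* last M) * C.b₁ x zero 1′ + 0ℚ)
            combined = trans (cong (λ s → ι (last M) * (s * q⁻ * 1ℚ) + (ι (last (init M)) * (ι q * p) + tails)) (ι-* δ a))
              (trans (rearrange (ι (last M)) (ι δ) (ι a) q⁻ (ι (last (init M))) (ι q) p tails)
                (cong₂ _+_ (cong₂ (λ s t → s * p + t)
                    (trans (sym (ι-* q (last (init M)))) (cong ι (sym (updateAt-updates (fromℕ m) (init M))))) (sym tails′))
                  (cong (_+ 0ℚ) (cong₂ _*_ (sym (ι-* δ (last M))) (sym (divide {z = a} T.b₁-entry))))))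

          -- Since ε² = 1 and δ δ̄ = 1 + κ q, the numerator is d + κ d q. The surplus κ d is an
          -- integer, on which `e` is trivial.
          β-eq : β ≡ C.b₂ x zero 1′ + ι (κ ℤ.* d)
          β-eq = *-cancel (last D) (trans (ℚ.*-assoc (ι (ε ℤ.* δ ℤ.* θ x)) q⁻ (ι q)) (trans
            (cong (ι (ε ℤ.* δ ℤ.* θ x) *_) (trans (ℚ.*-comm q⁻ (ι q)) (1÷-inverse (last D))))
            (trans (ℚ.*-identityʳ _) (trans (cong ι integers) (trans (ι-+ d (κ ℤ.* d ℤ.* q))
              (trans (cong₂ _+_ (sym T.b₂-entry) (ι-* (κ ℤ.* d) q)) (sym (ℚ.*-distribʳ-+ (ι q) (C.b₂ x zero 1′) (ι (κ ℤ.* d))))))))))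
            where
            integers : ε ℤ.* δ ℤ.* θ x ≡ d ℤ.+ κ ℤ.* d ℤ.* q
            integers = trans (step₁ ε δ δ̄ d) (trans (cong₂ (λ s t → s ℤ.* t ℤ.* d) (ℤP.sgn² (toℕ (fromℕ (suc m)))) bézout) (step₂ κ q d))
              where
              step₁ : ∀ ε δ δ̄ d → ε ℤ.* δ ℤ.* (ε ℤ.* δ̄ ℤ.* d) ≡ ε ℤ.* ε ℤ.* (δ ℤ.* δ̄) ℤ.* d
              step₁ = ℤ.solve-∀
              step₂ : ∀ κ q d → ℤ.1ℤ ℤ.* (ℤ.1ℤ ℤ.+ κ ℤ.* q) ℤ.* d ≡ d ℤ.+ κ ℤ.* d ℤ.* q
              step₂ = ℤ.solve-∀

          right : (λ i → ι (N i)) ℚB.∙ superdiagonal (C.b₂ (Φ y x)) ≡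
                  (λ i → ι (init N i)) ℚB.∙ superdiagonal (C.b₂ y) + (ι (last N) * C.b₂ x zero 1′ + 0ℚ) + ι (last N ℤ.* (κ ℤ.* d))
          right = trans (ℚΣ.sum-init-last {suc m} (λ i → ι (N i) * superdiagonal (C.b₂ (Φ y x)) i))
            (trans (cong₂ _+_
              (ℚB.∙-cong {x = λ i → ι (init N i)} (λ _ → refl) (λ i → ℚB.cap-ul (C.b₂ y) z (inject₁ i) (suc i)))
              (cong (ι (last N) *_) (trans (ℚB.cap-corner (C.b₂ y) z (fromℕ (suc m))) (trans (∷ʳ-last {n = suc m} ℚB.0ᵥ β) β-eq))))
              (trans (rearrange ((λ i → ι (init N i)) ℚB.∙ superdiagonal (C.b₂ y)) (ι (last N)) (C.b₂ x zero 1′) (ι (κ ℤ.* d)))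
                (cong (λ s → (λ i → ι (init N i)) ℚB.∙ superdiagonal (C.b₂ y) + (ι (last N) * C.b₂ x zero 1′ + 0ℚ) + s) (sym (ι-* (last N) (κ ℤ.* d))))))
            where
            import Algebra.Properties.Semiring.Sum (CommutativeRing.semiring ℚ.+-*-commutativeRing) as ℚΣ
            z = ℚB.0ᵥ ∷ʳ β
            rearrange : ∀ s n b t → s + n * (b + t) ≡ s + (n * b + 0ℚ) + n * t
            rearrange = solveℚ 4 (λ s n b t → s :+ n :* (b :+ t) := s :+ (n :* b :+ con 0ℚ) :+ n :* t) refl

      term-Φ : ∀ y x → term M N (Φ y x) ≈ term M′ (init N) y ⊛ term M₂ N₂ x
      term-Φ y x = begin
        ψ (reverse M) (C.b₁ (Φ y x)) ⊛ ψ N (C.b₂ (Φ y x))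
          ≈⟨ R.*-cong (R.trans (R.reflexive (cong e left)) (e-+ _ _))
               (R.trans (R.reflexive (cong e right)) (R.trans (e-+ι _ (last N ℤ.* (κ ℤ.* d))) (e-+ _ _))) ⟩
        ψ (reverse M′) (C.b₁ y) ⊛ ψ (reverse M₂) (C.b₁ x) ⊛ (ψ (init N) (C.b₂ y) ⊛ ψ N₂ (C.b₂ x))
          ≈⟨ interchange _ _ _ _ ⟩
        term M′ (init N) y ⊛ term M₂ N₂ x ∎
        where open Exponents y x

      -- Summation over the two lists of representatives.

      private
        products : List.List (C D)
        products = cartesianProductWith Φ (elements (init D)) (elements D₂)

        products-unique : Unique (X D) products
        products-unique = Unique.cartesianProductWith⁺ (X (init D)) (X D₂) (X D) Φ
          (λ {y} {y′} {x} {x′} → Φ-injective {y} {y′} {x} {x′}) (elements-unique (init D)) (elements-unique D₂)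

        products-complete : IsEnumeration (X D) products
        products-complete z = complete (Φ-surjective z)
          where
          complete : (∃ λ (y₀ : C (init D)) → ∀ (y : C (init D)) → C.γ y₀ ℤM.∼ C.γ y →
                       ∃ λ (x₀ : C D₂) → ∀ (x : C D₂) → C.γ x₀ ℤM.∼ C.γ x → C.γ z ℤM.∼ C.γ (Φ y x)) →
                     Any.Any (λ z′ → C.γ z ℤM.∼ C.γ z′) products
          complete (y₀ , h) = Any.cartesianProductWith⁺ Φ {P = y ≡_} {Q = λ x → C.γ x₀ ℤM.∼ C.γ x}
            (λ { {x = .y} {y = x} refl x₀∼x → hit x x₀∼x }) (proj₁ (proj₂ found)) (elements-complete D₂ x₀)
            where
            found = find (elements-complete (init D) y₀)
            y = proj₁ found
            x₀ = proj₁ (h y (proj₂ (proj₂ found)))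
            hit : ∀ x → C.γ x₀ ℤM.∼ C.γ x → C.γ z ℤM.∼ C.γ (Φ y x)
            hit = proj₂ (h y (proj₂ (proj₂ found)))

      S-factors : S M N D ≈ S M′ (init N) (init D) ⊛ S M₂ N₂ D₂
      S-factors = begin
        ListSum.Σ R (term M N) (elements D)
          ≈⟨ ListSum.Σ-↭ R (X D) (λ {x} {y} → term-cong M N {x} {y})
               (Unique-⊆-↭ (X D) (elements-unique D) products-unique (λ {z} _ → products-complete z) (λ {z} _ → elements-complete D z)) ⟩
        ListSum.Σ R (term M N) products
          ≈⟨ ListSum.Σ-cartesianProductWith R Φ term-Φ (elements (init D)) (elements D₂) ⟩
        S M′ (init N) (init D) ⊛ S M₂ N₂ D₂ ∎

open import Data.Integer.Base using (_*_)

proposition3p9 :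
  ∀ {a ℓ} (R : CommutativeRing a ℓ) (E : Exponential R) →
  let open Kloosterman R E
      module R = CommutativeRing R
  in
  ∀ m (M N : Vector ℤ (2 ℕ.+ m)) (D : Vector ℕ⁺ (2 ℕ.+ m)) →
  gcd (foldr ℕ._*_ 1 (map value (init D))) (value (last D)) ≡ 1 →
  S M N D
    R.≈ S (updateAt (init M) (fromℕ m) (+ value (last D) *_)) (init N) (init D)
    R.* S (+ value (last (init D)) * last M ∷ []) (last N ∷ []) (last D ∷ [])
proposition3p9 R E m M N D coprime =
  let open Factors.Characters R E
      δ̄ , κ , bézout = coprime-inverse λ (d∣δ , d∣q) → Coprimality.gcd≡1⇒coprime coprime
        (∣-trans d∣δ (last-∣-product (map value (init D))) , d∣q)
  in S-factors M N D δ̄ κ bézout
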